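{- There exists an absolute constant $c>0$ such that for every integer $n\ge 2$ there exist a set of at most $n$ points and a set of at most $n$ hyperplanes (planes) in $\mathbb{R}^3$ whose incidence matrix $M_{\mathrm{hyp}}$ satisfies $$\gamma_2(M_{\mathrm{hyp}})\ \ge\ c\,\frac{n^{1/4}}{\sqrt{\log n}}.$$
   Context: Incidence matrix: for a set $P$ of points and a set $\mathcal{H}$ of hyperplanes, it is the Boolean matrix with rows indexed by $\mathcal{H}$, columns indexed by $P$, and entry $M(H,x)=1$ if $x\in H$ and $0$ otherwise. $\gamma_2$-norm: for $M\in\mathbb{C}^{m\times n}$, $\gamma_2(M)=\min_{M=UV}\|U\|_{\mathrm{row}}\|V\|_{\mathrm{col}}$, where the minimum is over all factorizations $M=UV$ into complex matrices, $\|U\|_{\mathrm{row}}$ is the maximum $\ell_2$-norm of a row of $U$, and $\|V\|_{\mathrm{col}}$ is the maximum $\ell_2$-norm of a column of $V$. -}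

module Defs where

open import Algebra.Bundles.Raw using (RawMonoid)
import Algebra.Definitions.RawMonoid as RawMonoidDefs
open import Data.Bool.Base using (Bool; true; false)
open import Data.Empty using (⊥-elim)
open import Data.Fin.Base using (Fin)
open import Data.Integer.Base as ℤ using (+_; -[1+_])
import Data.Integer.Properties as ℤ
open import Data.Nat.Base as ℕ using (ℕ; zero; suc)
import Data.Nat.Properties as ℕ
import Data.Nat.Solver as ℕ
open import Data.Nat.Induction using (<-rec)
open import Data.Nat.Logarithm using (⌊log₂_⌋; ⌊log₂⌋-mono-≤; ⌊log₂[2^n]⌋≡n; ⌊log₂⌊n/2⌋⌋≡⌊log₂n⌋∸1)
open import Data.Product.Base using (∃-syntax; _×_; _,_; proj₁; proj₂)
open import Data.Rational.Base as ℚ using (ℚ; 0ℚ; 1ℚ; ½; _+_; _*_; _-_; -_; ∣_∣; _⊔_; _≤_; _<_; _/_; ↥_; ↧ₙ_; 1/_; mkℚ)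
open import Data.Rational.Properties
open import Data.Rational.Solver using (module +-*-Solver)
import Data.Rational.Unnormalised.Base as ℚᵘ
import Data.Rational.Unnormalised.Properties as ℚᵘ
open import Data.Sum.Base using (_⊎_; inj₁; inj₂)
open import Data.Vec.Functional using (Vector; foldr; zipWith)
open import Function.Base using (flip)
open import Function.Bundles using (_⇔_; mk⇔)
open import Function.Definitions using (Injective)
open import Level using (0ℓ)
open import Relation.Binary.Core using (Rel)
open import Relation.Binary.PropositionalEquality
open import Relation.Nullary using (yes; no; ¬_)

module _ where
  open +-*-Solver

  ½-double : ∀ p → p * ½ + p * ½ ≡ p
  ½-double = solve 1 (λ p → p :* con ½ :+ p :* con ½ := p) refl

  +-sub : ∀ p q → q + (p - q) ≡ p
  +-sub = solve 2 (λ p q → q :+ (p :- q) := p) refl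

  sub-+ : ∀ p q → (p + q) - q ≡ p
  sub-+ = solve 2 (λ p q → (p :+ q) :- q := p) refl

  sub-+ˡ : ∀ p q → (q + p) - q ≡ p
  sub-+ˡ = solve 2 (λ p q → (q :+ p) :- q := p) refl

  neg-sub : ∀ p q → - (p - q) ≡ q - p
  neg-sub = solve 2 (λ p q → :- (p :- q) := q :- p) refl

  neg-sub-neg : ∀ p q → (- p) - (- q) ≡ - (p - q)
  neg-sub-neg = solve 2 (λ p q → (:- p) :- (:- q) := :- (p :- q)) refl

  +-sub-+ : ∀ a b c d → (a + b) - (c + d) ≡ (a - c) + (b - d)
  +-sub-+ = solve 4 (λ a b c d → (a :+ b) :- (c :+ d) := (a :- c) :+ (b :- d)) refl

  *-sub-* : ∀ a b c d → a * b - c * d ≡ a * (b - d) + d * (a - c)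
  *-sub-* = solve 4 (λ a b c d → a :* b :- c :* d := a :* (b :- d) :+ d :* (a :- c)) refl

  square-+ : ∀ s h → (s + h) * (s + h) + h * h + (s * h + s * h + h * h + h * h)
                     ≡ (s + (h + h)) * (s + (h + h))
  square-+ = solve 2 (λ s h → (s :+ h) :* (s :+ h) :+ h :* h :+ (s :* h :+ s :* h :+ h :* h :+ h :* h)
                              := (s :+ (h :+ h)) :* (s :+ (h :+ h))) refl

0<½ : 0ℚ < ½
0<½ = positive⁻¹ ½

0<1 : 0ℚ < 1ℚ
0<1 = positive⁻¹ 1ℚ

pos-* : ∀ {p q} → 0ℚ < p → 0ℚ < q → 0ℚ < p * q
pos-* {p} {q} 0<p 0<q = positive⁻¹ (p * q) {{pos*pos⇒pos p {{ℚ.positive 0<p}} q {{ℚ.positive 0<q}}}}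

nonNeg-* : ∀ {p q} → 0ℚ ≤ p → 0ℚ ≤ q → 0ℚ ≤ p * q
nonNeg-* {p} {q} 0≤p 0≤q =
  nonNegative⁻¹ (p * q) {{nonNeg*nonNeg⇒nonNeg p {{ℚ.nonNegative 0≤p}} q {{ℚ.nonNegative 0≤q}}}}

nonNeg-+ : ∀ {p q} → 0ℚ ≤ p → 0ℚ ≤ q → 0ℚ ≤ p + q
nonNeg-+ {p} {q} 0≤p 0≤q = subst (_≤ p + q) (+-identityˡ 0ℚ) (+-mono-≤ 0≤p 0≤q)

p≤p+q : ∀ p {q} → 0ℚ ≤ q → p ≤ p + q
p≤p+q p {q} 0≤q = subst (_≤ p + q) (+-identityʳ p) (+-monoʳ-≤ p 0≤q)

p<p+q : ∀ p {q} → 0ℚ < q → p < p + q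
p<p+q p {q} 0<q = subst (_< p + q) (+-identityʳ p) (+-monoʳ-< p 0<q)

half-pos : ∀ {ε} → 0ℚ < ε → 0ℚ < ε * ½
half-pos 0<ε = pos-* 0<ε 0<½

*-mono-≤-nonNeg : ∀ {a b c d} → 0ℚ ≤ a → 0ℚ ≤ d → a ≤ b → c ≤ d → a * c ≤ b * d
*-mono-≤-nonNeg {a} {b} {c} {d} 0≤a 0≤d a≤b c≤d =
  ≤-trans (*-monoˡ-≤-nonNeg a {{ℚ.nonNegative 0≤a}} c≤d) (*-monoʳ-≤-nonNeg d {{ℚ.nonNegative 0≤d}} a≤b)

divide-pos : ∀ {ε B} → 0ℚ < ε → 0ℚ < B → ∃[ δ ] 0ℚ < δ × B * δ ≡ ε
divide-pos {ε} {B} 0<ε 0<B = ε * B⁻¹ , pos-* 0<ε (positive⁻¹ B⁻¹ {{1/pos⇒pos B}}) , eq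
  where
  instance
    B-pos : ℚ.Positive B
    B-pos = ℚ.positive 0<B
    B-nz : ℚ.NonZero B
    B-nz = pos⇒nonZero B
  B⁻¹ = 1/ B
  eq : B * (ε * B⁻¹) ≡ ε
  eq = trans (*-comm B _) (trans (*-assoc ε B⁻¹ B) (trans (cong (ε *_) (*-inverseˡ B)) (*-identityʳ ε)))

p≤∣p∣ : ∀ p → p ≤ ∣ p ∣
p≤∣p∣ p with ≤-total 0ℚ p
... | inj₁ 0≤p = ≤-reflexive (sym (0≤p⇒∣p∣≡p 0≤p))
... | inj₂ p≤0 = ≤-trans p≤0 (0≤∣p∣ p)

∣p-q∣≡∣q-p∣ : ∀ p q → ∣ p - q ∣ ≡ ∣ q - p ∣
∣p-q∣≡∣q-p∣ p q = trans (sym (∣-p∣≡∣p∣ (p - q))) (cong ∣_∣ (neg-sub p q))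

close⇒< : ∀ {ε} p q → ∣ p - q ∣ < ε → p < q + ε
close⇒< {ε} p q h = subst (_< q + ε) (+-sub p q) (+-monoʳ-< q (≤-<-trans (p≤∣p∣ (p - q)) h))

close-sym : ∀ {ε} p q → ∣ p - q ∣ < ε → ∣ q - p ∣ < ε
close-sym {ε} p q = subst (_< ε) (∣p-q∣≡∣q-p∣ p q)

<⇒close : ∀ {ε} p q → p < q + ε → q < p + ε → ∣ p - q ∣ < ε
<⇒close {ε} p q p<q+ε q<p+ε with ∣p∣≡p∨∣p∣≡-p (p - q)
... | inj₁ eq = subst₂ _<_ (sym eq) (sub-+ˡ ε q) (+-monoˡ-< (- q) p<q+ε)
... | inj₂ eq = subst₂ _<_ (sym (trans eq (neg-sub p q))) (sub-+ˡ ε p) (+-monoˡ-< (- p) q<p+ε)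

+-close : ∀ {δ η} a b c d → ∣ a - c ∣ < δ → ∣ b - d ∣ < η → ∣ (a + b) - (c + d) ∣ < δ + η
+-close a b c d h k = ≤-<-trans
  (subst (λ z → ∣ z ∣ ≤ ∣ a - c ∣ + ∣ b - d ∣) (sym (+-sub-+ a b c d)) (∣p+q∣≤∣p∣+∣q∣ (a - c) (b - d)))
  (+-mono-< h k)

⊔-close : ∀ {ε} a b c d → ∣ a - c ∣ < ε → ∣ b - d ∣ < ε → ∣ (a ⊔ b) - (c ⊔ d) ∣ < ε
⊔-close {ε} a b c d h k =
  <⇒close (a ⊔ b) (c ⊔ d) (one-side a b c d h k)
          (one-side c d a b (close-sym a c h) (close-sym b d k))
  where
  one-side : ∀ a b c d → ∣ a - c ∣ < ε → ∣ b - d ∣ < ε → a ⊔ b < (c ⊔ d) + ε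
  one-side a b c d h k with ⊔-sel a b
  ... | inj₁ eq = subst (_< _) (sym eq) (<-≤-trans (close⇒< a c h) (+-monoˡ-≤ ε (p≤p⊔q c d)))
  ... | inj₂ eq = subst (_< _) (sym eq) (<-≤-trans (close⇒< b d k) (+-monoˡ-≤ ε (p≤q⊔p c d)))

module _ (k l d e : ℕ) where
  private
    K = ℚᵘ.mkℚᵘ (+ k) d
    L = ℚᵘ.mkℚᵘ (+ l) e

  frac-≤ : k ℕ.* suc e ℕ.≤ l ℕ.* suc d → + k / suc d ≤ + l / suc e
  frac-≤ h = toℚᵘ-cancel-≤ (ℚᵘ.≤-trans (ℚᵘ.≤-reflexive (toℚᵘ-fromℚᵘ K))
    (ℚᵘ.≤-trans (ℚᵘ.*≤* (subst₂ ℤ._≤_ (ℤ.pos-* k (suc e)) (ℤ.pos-* l (suc d)) (ℤ.+≤+ h)))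
                (ℚᵘ.≤-reflexive (ℚᵘ.≃-sym (toℚᵘ-fromℚᵘ L)))))

  frac-< : k ℕ.* suc e ℕ.< l ℕ.* suc d → + k / suc d < + l / suc e
  frac-< h = toℚᵘ-cancel-< (ℚᵘ.≤-<-trans (ℚᵘ.≤-reflexive (toℚᵘ-fromℚᵘ K))
    (ℚᵘ.<-≤-trans (ℚᵘ.*<* (subst₂ ℤ._<_ (ℤ.pos-* k (suc e)) (ℤ.pos-* l (suc d)) (ℤ.+<+ h)))
                  (ℚᵘ.≤-reflexive (ℚᵘ.≃-sym (toℚᵘ-fromℚᵘ L)))))

/-*-/ : ∀ k l d e → (+ k / suc d) * (+ l / suc e) ≡ + (k ℕ.* l) / (suc d ℕ.* suc e)
/-*-/ k l d e = toℚᵘ-injective (ℚᵘ.≃-trans (toℚᵘ-homo-* (+ k / suc d) (+ l / suc e))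
  (ℚᵘ.≃-trans (ℚᵘ.*-cong (toℚᵘ-fromℚᵘ (ℚᵘ.mkℚᵘ (+ k) d)) (toℚᵘ-fromℚᵘ (ℚᵘ.mkℚᵘ (+ l) e)))
  (ℚᵘ.≃-trans (ℚᵘ.≃-reflexive (cong (λ z → ℚᵘ.mkℚᵘ z (e ℕ.+ d ℕ.* suc e)) (sym (ℤ.pos-* k l))))
              (ℚᵘ.≃-sym (toℚᵘ-fromℚᵘ (ℚᵘ.mkℚᵘ (+ (k ℕ.* l)) (e ℕ.+ d ℕ.* suc e)))))))

/-suc : ∀ k d → + suc k / suc d ≡ + k / suc d + + 1 / suc d
/-suc k d = toℚᵘ-injective (ℚᵘ.≃-trans (toℚᵘ-fromℚᵘ (ℚᵘ.mkℚᵘ (+ suc k) d))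
  (ℚᵘ.≃-trans (ℚᵘ.*≡* eq)
  (ℚᵘ.≃-sym (ℚᵘ.≃-trans (toℚᵘ-homo-+ (+ k / suc d) (+ 1 / suc d))
    (ℚᵘ.+-cong (toℚᵘ-fromℚᵘ (ℚᵘ.mkℚᵘ (+ k) d)) (toℚᵘ-fromℚᵘ (ℚᵘ.mkℚᵘ (+ 1) d)))))))
  where
  D = suc d
  eq : + suc k ℤ.* + (D ℕ.* D) ≡ (+ k ℤ.* + D ℤ.+ + 1 ℤ.* + D) ℤ.* + D
  eq = begin
    + suc k ℤ.* + (D ℕ.* D)                   ≡⟨ cong (+ suc k ℤ.*_) (ℤ.pos-* D D) ⟩
    + suc k ℤ.* (+ D ℤ.* + D)                 ≡⟨ ℤ.*-assoc (+ suc k) (+ D) (+ D) ⟨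
    (+ suc k ℤ.* + D) ℤ.* + D                 ≡⟨ cong (λ z → (+ z ℤ.* + D) ℤ.* + D) (ℕ.+-comm 1 k) ⟩
    ((+ k ℤ.+ + 1) ℤ.* + D) ℤ.* + D           ≡⟨ cong (ℤ._* + D) (ℤ.*-distribʳ-+ (+ D) (+ k) (+ 1)) ⟩
    (+ k ℤ.* + D ℤ.+ + 1 ℤ.* + D) ℤ.* + D     ∎
    where open ≡-Reasoning

/-nonNeg : ∀ k d → 0ℚ ≤ + k / suc d
/-nonNeg k d = frac-≤ 0 k 0 d ℕ.z≤n

1/-≤ : ∀ {m n} → m ℕ.≤ n → + 1 / suc n ≤ + 1 / suc m
1/-≤ {m} {n} m≤n = frac-≤ 1 1 n m (ℕ.*-monoʳ-≤ 1 (ℕ.s≤s m≤n))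

archimedean : ∀ {ε} → 0ℚ < ε → ∃[ N ] ∀ n → N ℕ.≤ n → + 1 / suc n ≤ ε
archimedean {mkℚ (+ zero) d c} (ℚ.*<* (ℤ.+<+ ()))
archimedean {mkℚ -[1+ a ] d c} (ℚ.*<* ())
archimedean {ε@(mkℚ (+ suc a) d c)} _ = d , λ n d≤n →
  ≤-trans (1/-≤ d≤n) (≤-trans (frac-≤ 1 (suc a) d d (ℕ.*-monoˡ-≤ (suc d) {1} {suc a} (ℕ.s≤s ℕ.z≤n)))
                              (≤-reflexive (↥p/↧p≡p ε)))

⌊√_⌋ : ℕ → ℕ
⌊√ zero ⌋  = zero
⌊√ suc n ⌋ with suc ⌊√ n ⌋ ℕ.* suc ⌊√ n ⌋ ℕ.≤? suc n
... | yes _ = suc ⌊√ n ⌋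
... | no  _ = ⌊√ n ⌋

⌊√⌋-spec : ∀ n → ⌊√ n ⌋ ℕ.* ⌊√ n ⌋ ℕ.≤ n × n ℕ.< suc ⌊√ n ⌋ ℕ.* suc ⌊√ n ⌋
⌊√⌋-spec zero = ℕ.z≤n , ℕ.s≤s ℕ.z≤n
⌊√⌋-spec (suc n) with suc ⌊√ n ⌋ ℕ.* suc ⌊√ n ⌋ ℕ.≤? suc n
... | yes h = h , ℕ.≤-<-trans (proj₂ (⌊√⌋-spec n)) (ℕ.*-mono-< k<1+k k<1+k)
  where k<1+k = ℕ.n<1+n (suc ⌊√ n ⌋)
... | no h = ℕ.m≤n⇒m≤1+n (proj₁ (⌊√⌋-spec n)) , ℕ.≰⇒> h

⌊log₂⌋-lower : ∀ n → .{{ℕ.NonZero n}} → 2 ℕ.^ ⌊log₂ n ⌋ ℕ.≤ n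
⌊log₂⌋-lower n {{nz}} = <-rec (λ n → 1 ℕ.≤ n → 2 ℕ.^ ⌊log₂ n ⌋ ℕ.≤ n) step n (ℕ.>-nonZero⁻¹ n)
  where
  step : ∀ n → (∀ {m} → m ℕ.< n → 1 ℕ.≤ m → 2 ℕ.^ ⌊log₂ m ⌋ ℕ.≤ m) → 1 ℕ.≤ n → 2 ℕ.^ ⌊log₂ n ⌋ ℕ.≤ n
  step 1 rec _ = ℕ.≤-refl
  step n@(suc (suc m)) rec _ = begin
    2 ℕ.^ ⌊log₂ n ⌋               ≡⟨ cong (2 ℕ.^_) (ℕ.m+[n∸m]≡n {1} 1≤log) ⟨
    2 ℕ.* 2 ℕ.^ (⌊log₂ n ⌋ ℕ.∸ 1) ≡⟨ cong (λ z → 2 ℕ.* 2 ℕ.^ z) (⌊log₂⌊n/2⌋⌋≡⌊log₂n⌋∸1 n) ⟨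
    2 ℕ.* 2 ℕ.^ ⌊log₂ h ⌋         ≤⟨ ℕ.*-monoʳ-≤ 2 (rec (ℕ.⌊n/2⌋<n (suc m)) (ℕ.s≤s ℕ.z≤n)) ⟩
    h ℕ.+ (h ℕ.+ 0)               ≡⟨ cong (h ℕ.+_) (ℕ.+-identityʳ h) ⟩
    h ℕ.+ h                       ≤⟨ ℕ.+-monoʳ-≤ h (ℕ.⌊n/2⌋≤⌈n/2⌉ n) ⟩
    h ℕ.+ ℕ.⌈ n /2⌉               ≡⟨ ℕ.⌊n/2⌋+⌈n/2⌉≡n n ⟩
    n                             ∎
    where
    open ℕ.≤-Reasoning
    h = ℕ.⌊ n /2⌋
    1≤log : 1 ℕ.≤ ⌊log₂ n ⌋
    1≤log = ⌊log₂⌋-mono-≤ {2} {n} (ℕ.s≤s (ℕ.s≤s ℕ.z≤n))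

⌊log₂⌋-upper : ∀ n → n ℕ.< 2 ℕ.^ suc ⌊log₂ n ⌋
⌊log₂⌋-upper n with n ℕ.<? 2 ℕ.^ suc ⌊log₂ n ⌋
... | yes h = h
... | no h = ⊥-elim (ℕ.n≮n _ (subst (ℕ._≤ ⌊log₂ n ⌋) (⌊log₂[2^n]⌋≡n (suc ⌊log₂ n ⌋))
                                    (⌊log₂⌋-mono-≤ (ℕ.≮⇒≥ h))))

Eventually : (ℕ → Set) → Set
Eventually P = ∃[ N ] ∀ n → N ℕ.≤ n → P n

IsCauchy : (ℕ → ℚ) → Set
IsCauchy x = ∀ ε → 0ℚ < ε → ∃[ N ] ∀ m n → N ℕ.≤ m → N ℕ.≤ n → ∣ x m - x n ∣ < ε

-- Real numbers are Cauchy sequences of rationals; their equality is _≃ℝ_.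
record ℝ : Set where
  constructor mkℝ
  field
    seq    : ℕ → ℚ
    cauchy : IsCauchy seq

open ℝ public

infix 4 _≃ℝ_ _≤ℝ_ _<ℝ_ _#ℝ_

_≃ℝ_ _≤ℝ_ _<ℝ_ _#ℝ_ : Rel ℝ 0ℓ
x ≃ℝ y = ∀ ε → 0ℚ < ε → Eventually λ n → ∣ seq x n - seq y n ∣ < ε
x ≤ℝ y = ∀ ε → 0ℚ < ε → Eventually λ n → seq x n < seq y n + ε
x <ℝ y = ∃[ ε ] 0ℚ < ε × Eventually λ n → seq x n + ε < seq y n
x #ℝ y = x <ℝ y ⊎ y <ℝ x

≤⊔ˡ : ∀ {M N n} → M ℕ.⊔ N ℕ.≤ n → M ℕ.≤ n
≤⊔ˡ {M} {N} = ℕ.≤-trans (ℕ.m≤m⊔n M N)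

≤⊔ʳ : ∀ {M N n} → M ℕ.⊔ N ℕ.≤ n → N ℕ.≤ n
≤⊔ʳ {M} {N} = ℕ.≤-trans (ℕ.m≤n⊔m M N)

≃ℝ⇒≤ℝ : ∀ x y → x ≃ℝ y → x ≤ℝ y
≃ℝ⇒≤ℝ x y h ε 0<ε with h ε 0<ε
... | N , f = N , λ n le → close⇒< (seq x n) (seq y n) (f n le)

≤ℝ-trans : ∀ x y z → x ≤ℝ y → y ≤ℝ z → x ≤ℝ z
≤ℝ-trans x y z h k ε 0<ε with h (ε * ½) (half-pos 0<ε) | k (ε * ½) (half-pos 0<ε)
... | M , f | N , g = M ℕ.⊔ N , λ n le →
  <-trans (f n (≤⊔ˡ {M} {N} le))
    (subst (seq y n + ε * ½ <_)
           (trans (+-assoc (seq z n) _ _) (cong (λ e → seq z n + e) (½-double ε)))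
           (+-monoˡ-< (ε * ½) (g n (≤⊔ʳ {M} {N} le))))

fromℚ : ℚ → ℝ
fromℚ q = mkℝ (λ _ → q) λ ε 0<ε → 0 , λ _ _ _ _ →
  subst (_< ε) (cong ∣_∣ (sym (+-inverseʳ q))) 0<ε

fromℕ : ℕ → ℝ
fromℕ n = fromℚ (+ n / 1)

0ℝ 1ℝ : ℝ
0ℝ = fromℚ 0ℚ
1ℝ = fromℚ 1ℚ

infixl 6 _+ℝ_ _-ℝ_ _⊔ℝ_
infixl 7 _*ℝ_ _÷ℝ_[_]
infix  8 -ℝ_ _⁻¹ℝ[_]

_+ℝ_ : ℝ → ℝ → ℝ
seq    (x +ℝ y) n = seq x n + seq y n
cauchy (x +ℝ y) ε 0<ε with cauchy x (ε * ½) (half-pos 0<ε) | cauchy y (ε * ½) (half-pos 0<ε)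
... | M , f | N , g = M ℕ.⊔ N , λ m n p q →
  subst (∣ (seq x m + seq y m) - (seq x n + seq y n) ∣ <_) (½-double ε)
    (+-close (seq x m) (seq y m) (seq x n) (seq y n)
      (f m n (≤⊔ˡ {M} {N} p) (≤⊔ˡ {M} {N} q)) (g m n (≤⊔ʳ {M} {N} p) (≤⊔ʳ {M} {N} q)))

-ℝ_ : ℝ → ℝ
seq    (-ℝ x) n = - seq x n
cauchy (-ℝ x) ε 0<ε with cauchy x ε 0<ε
... | N , f = N , λ m n p q →
  subst (_< ε) (sym (trans (cong ∣_∣ (neg-sub-neg (seq x m) (seq x n))) (∣-p∣≡∣p∣ (seq x m - seq x n))))
    (f m n p q)

_-ℝ_ : ℝ → ℝ → ℝ
x -ℝ y = x +ℝ -ℝ y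

_⊔ℝ_ : ℝ → ℝ → ℝ
seq    (x ⊔ℝ y) n = seq x n ⊔ seq y n
cauchy (x ⊔ℝ y) ε 0<ε with cauchy x ε 0<ε | cauchy y ε 0<ε
... | M , f | N , g = M ℕ.⊔ N , λ m n p q →
  ⊔-close (seq x m) (seq y m) (seq x n) (seq y n)
    (f m n (≤⊔ˡ {M} {N} p) (≤⊔ˡ {M} {N} q)) (g m n (≤⊔ʳ {M} {N} p) (≤⊔ʳ {M} {N} q))

bounded : ∀ x → ∃[ B ] 0ℚ < B × Eventually λ n → ∣ seq x n ∣ < B
bounded x with cauchy x 1ℚ 0<1
... | N , f = ∣ seq x N ∣ + 1ℚ , <-≤-trans 0<1 1≤B , N , λ n le →
    subst (λ z → ∣ z ∣ < ∣ seq x N ∣ + 1ℚ) (+-sub (seq x n) (seq x N))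
      (≤-<-trans (∣p+q∣≤∣p∣+∣q∣ (seq x N) (seq x n - seq x N))
                 (+-monoʳ-< ∣ seq x N ∣ (f n N le ℕ.≤-refl)))
  where
  1≤B : 1ℚ ≤ ∣ seq x N ∣ + 1ℚ
  1≤B = subst (1ℚ ≤_) (+-comm 1ℚ ∣ seq x N ∣) (p≤p+q 1ℚ (0≤∣p∣ (seq x N)))

_*ℝ_ : ℝ → ℝ → ℝ
seq    (x *ℝ y) n = seq x n * seq y n
cauchy (x *ℝ y) ε 0<ε =
  let A , 0<A , M , a = bounded x
      B , 0<B , N , b = bounded y
      δ , 0<δ , Aδ = divide-pos (half-pos 0<ε) 0<A
      η , 0<η , Bη = divide-pos (half-pos 0<ε) 0<B
      K , f = cauchy y δ 0<δ
      L , g = cauchy x η 0<η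
  in (M ℕ.⊔ N) ℕ.⊔ (K ℕ.⊔ L) , λ m n p q →
  let xm = seq x m ; ym = seq y m ; xn = seq x n ; yn = seq y n
      M≤m = ≤⊔ˡ {M} {N} (≤⊔ˡ {M ℕ.⊔ N} {K ℕ.⊔ L} p)
      N≤n = ≤⊔ʳ {M} {N} (≤⊔ˡ {M ℕ.⊔ N} {K ℕ.⊔ L} q)
      K≤m = ≤⊔ˡ {K} {L} (≤⊔ʳ {M ℕ.⊔ N} {K ℕ.⊔ L} p)
      K≤n = ≤⊔ˡ {K} {L} (≤⊔ʳ {M ℕ.⊔ N} {K ℕ.⊔ L} q)
      L≤m = ≤⊔ʳ {K} {L} (≤⊔ʳ {M ℕ.⊔ N} {K ℕ.⊔ L} p)
      L≤n = ≤⊔ʳ {K} {L} (≤⊔ʳ {M ℕ.⊔ N} {K ℕ.⊔ L} q)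
      s = product-< xm (ym - yn) (a m M≤m) (f m n K≤m K≤n) 0<A Aδ
      t = product-< yn (xm - xn) (b n N≤n) (g m n L≤m L≤n) 0<B Bη
  in subst (λ z → ∣ z ∣ < ε) (sym (*-sub-* xm ym xn yn))
       (≤-<-trans (∣p+q∣≤∣p∣+∣q∣ (xm * (ym - yn)) (yn * (xm - xn)))
                  (subst (∣ xm * (ym - yn) ∣ + ∣ yn * (xm - xn) ∣ <_) (½-double ε) (+-mono-< s t)))
  where
  product-< : ∀ {C δ η} u v → ∣ u ∣ < C → ∣ v ∣ < δ → 0ℚ < C → C * δ ≡ η → ∣ u * v ∣ < η
  product-< {C} {δ} u v u<C v<δ 0<C eq = subst₂ _<_ (sym (∣p*q∣≡∣p∣*∣q∣ u v)) eq
    (≤-<-trans (*-monoʳ-≤-nonNeg ∣ v ∣ {{∣-∣-nonNeg v}} (<⇒≤ u<C))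
               (*-monoʳ-<-pos C {{ℚ.positive 0<C}} v<δ))

-- The value at 0 is irrelevant: it is only ever used at the finitely many
-- places where the sequence of a positive real may vanish.
inverse : ℚ → ℚ
inverse p with p ≟ 0ℚ
... | yes _  = 0ℚ
... | no p≢0 = (1/ p) {{ℚ.≢-nonZero p≢0}}

inverse-* : ∀ {p} → 0ℚ < p → inverse p * p ≡ 1ℚ
inverse-* {p} 0<p with p ≟ 0ℚ
... | yes p≡0 = ⊥-elim (<-irrefl (sym p≡0) 0<p)
... | no p≢0  = *-inverseˡ p {{ℚ.≢-nonZero p≢0}}

inverse-close : ∀ {δ ε a b} → 0ℚ < δ → 0ℚ < ε → δ < a → δ < b →
                ∣ a - b ∣ < ε * (δ * δ) → ∣ inverse a - inverse b ∣ < ε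
inverse-close {δ} {ε} {a} {b} 0<δ 0<ε δ<a δ<b h =
  *-cancelʳ-<-nonNeg (a * b) {{ℚ.nonNegative (<⇒≤ (pos-* 0<a 0<b))}} {∣ i - j ∣} {ε}
    (subst (_< ε * (a * b)) (sym eq)
      (<-≤-trans h (*-monoˡ-≤-nonNeg ε {{ℚ.nonNegative (<⇒≤ 0<ε)}}
        (*-mono-≤-nonNeg (<⇒≤ 0<δ) (<⇒≤ 0<b) (<⇒≤ δ<a) (<⇒≤ δ<b)))))
  where
  i = inverse a
  j = inverse b
  0<a = <-trans 0<δ δ<a
  0<b = <-trans 0<δ δ<b
  eq₁ : (i - j) * (a * b) ≡ b - a
  eq₁ = begin
    (i - j) * (a * b)           ≡⟨ rearrange i j a b ⟩
    (i * a) * b - (j * b) * a   ≡⟨ cong₂ (λ u v → u * b - v * a) (inverse-* 0<a) (inverse-* 0<b) ⟩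
    1ℚ * b - 1ℚ * a             ≡⟨ cong₂ _-_ (*-identityˡ b) (*-identityˡ a) ⟩
    b - a                       ∎
    where
    open ≡-Reasoning
    open +-*-Solver
    rearrange : ∀ i j a b → (i - j) * (a * b) ≡ (i * a) * b - (j * b) * a
    rearrange = solve 4 (λ i j a b → (i :- j) :* (a :* b) := (i :* a) :* b :- (j :* b) :* a) refl
  eq : ∣ i - j ∣ * (a * b) ≡ ∣ a - b ∣
  eq = begin
    ∣ i - j ∣ * (a * b)       ≡⟨ cong (∣ i - j ∣ *_) (0≤p⇒∣p∣≡p (<⇒≤ (pos-* 0<a 0<b))) ⟨
    ∣ i - j ∣ * ∣ a * b ∣     ≡⟨ ∣p*q∣≡∣p∣*∣q∣ (i - j) (a * b) ⟨
    ∣ (i - j) * (a * b) ∣     ≡⟨ cong ∣_∣ eq₁ ⟩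
    ∣ b - a ∣                 ≡⟨ ∣p-q∣≡∣q-p∣ b a ⟩
    ∣ a - b ∣                 ∎
    where open ≡-Reasoning

_⁻¹ℝ[_] : (x : ℝ) → 0ℝ <ℝ x → ℝ
seq    (x ⁻¹ℝ[ _ ]) n = inverse (seq x n)
cauchy (x ⁻¹ℝ[ δ , 0<δ , M , f ]) ε 0<ε with cauchy x (ε * (δ * δ)) (pos-* 0<ε (pos-* 0<δ 0<δ))
... | N , g = M ℕ.⊔ N , λ m n p q →
  inverse-close 0<δ 0<ε
    (subst (_< seq x m) (+-identityˡ δ) (f m (≤⊔ˡ {M} {N} p)))
    (subst (_< seq x n) (+-identityˡ δ) (f n (≤⊔ˡ {M} {N} q)))
    (g m n (≤⊔ʳ {M} {N} p) (≤⊔ʳ {M} {N} q))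

_÷ℝ_[_] : ℝ → (y : ℝ) → 0ℝ <ℝ y → ℝ
x ÷ℝ y [ 0<y ] = x *ℝ y ⁻¹ℝ[ 0<y ]

-- For p = a / b ≥ 0, √p = √(a b) / b is approximated from below with error
-- less than 1 / (n + 1).
√≈ : ℕ → ℚ → ℚ
√≈ n p = + ⌊√ ℤ.∣ ↥ p ∣ ℕ.* ↧ₙ p ℕ.* (suc n ℕ.* suc n) ⌋ / (↧ₙ p ℕ.* suc n)

√≈-nonNeg : ∀ n p → 0ℚ ≤ √≈ n p
√≈-nonNeg n p@(mkℚ a b _) =
  /-nonNeg ⌊√ ℤ.∣ a ∣ ℕ.* suc b ℕ.* (suc n ℕ.* suc n) ⌋ (n ℕ.+ b ℕ.* suc n)

√≈-spec : ∀ n p → 0ℚ ≤ p →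
          √≈ n p * √≈ n p ≤ p × p < (√≈ n p + + 1 / suc n) * (√≈ n p + + 1 / suc n)
√≈-spec n (mkℚ -[1+ a ] b c) (ℚ.*≤* ())
√≈-spec n p@(mkℚ (+ a) b c) 0≤p = lower , <-≤-trans upper (*-mono-≤-nonNeg 0≤s′ 0≤s+1/N s′≤ s′≤)
  where
  D-1 = n ℕ.+ b ℕ.* suc n
  D = suc D-1
  k = ⌊√ a ℕ.* suc b ℕ.* (suc n ℕ.* suc n) ⌋
  spec = ⌊√⌋-spec (a ℕ.* suc b ℕ.* (suc n ℕ.* suc n))
  s′ = + suc k / D
  p≡ : + a / suc b ≡ p
  p≡ = ↥p/↧p≡p p
  clear : a ℕ.* suc b ℕ.* (suc n ℕ.* suc n) ℕ.* suc b ≡ a ℕ.* (D ℕ.* D)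
  clear = solve 3 (λ a b n → a :* b :* (n :* n) :* b := a :* ((b :* n) :* (b :* n))) refl a (suc b) (suc n)
    where open ℕ.+-*-Solver
  lower : √≈ n p * √≈ n p ≤ p
  lower = subst₂ _≤_ (sym (/-*-/ k k D-1 D-1)) p≡
    (frac-≤ (k ℕ.* k) a (D-1 ℕ.+ D-1 ℕ.* D) b
      (ℕ.≤-trans (ℕ.*-monoˡ-≤ (suc b) (proj₁ spec)) (ℕ.≤-reflexive clear)))
  upper : p < s′ * s′
  upper = subst₂ _<_ p≡ (sym (/-*-/ (suc k) (suc k) D-1 D-1))
    (frac-< a (suc k ℕ.* suc k) b (D-1 ℕ.+ D-1 ℕ.* D)
      (ℕ.≤-<-trans (ℕ.≤-reflexive (sym clear)) (ℕ.*-monoˡ-< (suc b) (proj₂ spec))))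
  0≤s′ : 0ℚ ≤ s′
  0≤s′ = /-nonNeg (suc k) D-1
  s′≤ : s′ ≤ √≈ n p + + 1 / suc n
  s′≤ = ≤-trans (≤-reflexive (/-suc k D-1)) (+-monoʳ-≤ (√≈ n p) (1/-≤ (ℕ.m≤m+n n (b ℕ.* suc n))))
  0≤s+1/N : 0ℚ ≤ √≈ n p + + 1 / suc n
  0≤s+1/N = ≤-trans 0≤s′ s′≤

square-cancel : ∀ {ε s t r p q} → 0ℚ < ε → 0ℚ ≤ s → 0ℚ ≤ t → 0ℚ ≤ r → r ≤ ε * ½ →
                s * s ≤ p → q < (t + r) * (t + r) → p < q + (ε * ½) * (ε * ½) → s < t + ε
square-cancel {ε} {s} {t} {r} {p} {q} 0<ε 0≤s 0≤t 0≤r r≤h s²≤p q<[t+r]² p<q+h² =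
  ≰⇒> λ t+ε≤s → <-irrefl refl (begin-strict
    p                                        <⟨ p<q+h² ⟩
    q + h * h                                <⟨ +-monoˡ-< (h * h) q<[t+r]² ⟩
    (t + r) * (t + r) + h * h                ≤⟨ +-monoˡ-≤ (h * h) (*-mono-≤-nonNeg 0≤t+r 0≤t+h t+r≤ t+r≤) ⟩
    (t + h) * (t + h) + h * h                ≤⟨ p≤p+q _ rest ⟩
    (t + h) * (t + h) + h * h + (t * h + t * h + h * h + h * h) ≡⟨ square-+ t h ⟩
    (t + (h + h)) * (t + (h + h))            ≡⟨ cong (λ z → (t + z) * (t + z)) (½-double ε) ⟩
    (t + ε) * (t + ε)                        ≤⟨ *-mono-≤-nonNeg 0≤t+ε 0≤s t+ε≤s t+ε≤s ⟩
    s * s                                    ≤⟨ s²≤p ⟩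
    p                                        ∎)
  where
  open ≤-Reasoning
  h = ε * ½
  0≤h = <⇒≤ (half-pos 0<ε)
  0≤t+r = nonNeg-+ 0≤t 0≤r
  0≤t+h = nonNeg-+ 0≤t 0≤h
  0≤t+ε = nonNeg-+ 0≤t (<⇒≤ 0<ε)
  t+r≤ = +-monoʳ-≤ t r≤h
  0≤th = nonNeg-* 0≤t 0≤h
  0≤hh = nonNeg-* 0≤h 0≤h
  rest = nonNeg-+ (nonNeg-+ (nonNeg-+ 0≤th 0≤th) 0≤hh) 0≤hh

√≈-close : ∀ {ε} m n p q → 0ℚ < ε → 0ℚ ≤ p → 0ℚ ≤ q → + 1 / suc n ≤ ε * ½ →
           p < q + (ε * ½) * (ε * ½) → √≈ m p < √≈ n q + ε
√≈-close m n p q 0<ε 0≤p 0≤q r≤h =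
  square-cancel 0<ε (√≈-nonNeg m p) (√≈-nonNeg n q) (/-nonNeg 1 n) r≤h
    (proj₁ (√≈-spec m p 0≤p)) (proj₂ (√≈-spec n q 0≤q))

square-lower : ∀ {ε h s r p} → 0ℚ ≤ s → 0ℚ ≤ r → 0ℚ ≤ h → (h + h) * (h + h) ≤ ε → r ≤ h →
               ε < p → p < (s + r) * (s + r) → h ≤ s
square-lower {ε} {h} {s} {r} {p} 0≤s 0≤r 0≤h [2h]²≤ε r≤h ε<p p<[s+r]² =
  ≮⇒≥ λ s<h → <-irrefl refl (begin-strict
    p                  <⟨ p<[s+r]² ⟩
    (s + r) * (s + r)  ≤⟨ *-mono-≤-nonNeg (nonNeg-+ 0≤s 0≤r) (nonNeg-+ 0≤h 0≤h)
                            (+-mono-≤ (<⇒≤ s<h) r≤h) (+-mono-≤ (<⇒≤ s<h) r≤h) ⟩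
    (h + h) * (h + h)  ≤⟨ [2h]²≤ε ⟩
    ε                  <⟨ ε<p ⟩
    p                  ∎)
  where open ≤-Reasoning

-- √ is extended by 0 to the negative reals.
√ : ℝ → ℝ
seq    (√ x) n = √≈ n (seq x n ⊔ 0ℚ)
cauchy (√ x) ε 0<ε =
  let M , f = archimedean (half-pos 0<ε)
      N , g = cauchy x ((ε * ½) * (ε * ½)) (pos-* (half-pos 0<ε) (half-pos 0<ε))
      x⁺ = λ k → seq x k ⊔ 0ℚ
      0≤x⁺ = λ k → p≤q⊔p (seq x k) 0ℚ
  in M ℕ.⊔ N , λ m n p q →
  let cl = g m n (≤⊔ʳ {M} {N} p) (≤⊔ʳ {M} {N} q)
      cl⁺ = ⊔-close (seq x m) 0ℚ (seq x n) 0ℚ cl (≤-<-trans (0≤∣p∣ (seq x m - seq x n)) cl)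
  in <⇒close (√≈ m (x⁺ m)) (√≈ n (x⁺ n))
       (√≈-close m n (x⁺ m) (x⁺ n) 0<ε (0≤x⁺ m) (0≤x⁺ n) (f n (≤⊔ˡ {M} {N} q))
         (close⇒< (x⁺ m) (x⁺ n) cl⁺))
       (√≈-close n m (x⁺ n) (x⁺ m) 0<ε (0≤x⁺ n) (0≤x⁺ m) (f m (≤⊔ˡ {M} {N} p))
         (close⇒< (x⁺ n) (x⁺ m) (close-sym (x⁺ m) (x⁺ n) cl⁺)))

√-pos : ∀ x → 0ℝ <ℝ x → 0ℝ <ℝ √ x
√-pos x (ε , 0<ε , M , f) =
  let N , g = archimedean 0<h
  in h * ½ , half-pos 0<h , M ℕ.⊔ N , λ n le →
    let x⁺  = seq x n ⊔ 0ℚ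
        ε<x = subst (_< seq x n) (+-identityˡ ε) (f n (≤⊔ˡ {M} {N} le))
        h≤  = square-lower (√≈-nonNeg n x⁺) (/-nonNeg 1 n) (<⇒≤ 0<h) [2h]²≤ε (g n (≤⊔ʳ {M} {N} le))
                (<-≤-trans ε<x (p≤p⊔q (seq x n) 0ℚ)) (proj₂ (√≈-spec n x⁺ (p≤q⊔p (seq x n) 0ℚ)))
    in subst (_< √≈ n x⁺) (sym (+-identityˡ (h * ½))) (<-≤-trans h½<h h≤)
  where
  open ≤-Reasoning
  μ = ε ℚ.⊓ 1ℚ
  h = μ * ½
  0<μ : 0ℚ < μ
  0<μ with ⊓-sel ε 1ℚ
  ... | inj₁ eq = subst (0ℚ <_) (sym eq) 0<ε
  ... | inj₂ eq = subst (0ℚ <_) (sym eq) 0<1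
  0<h = half-pos 0<μ
  h½<h : h * ½ < h
  h½<h = subst (h * ½ <_) (½-double h) (p<p+q (h * ½) (half-pos 0<h))
  [2h]²≤ε : (h + h) * (h + h) ≤ ε
  [2h]²≤ε = begin
    (h + h) * (h + h)   ≡⟨ cong (λ z → z * z) (½-double μ) ⟩
    μ * μ               ≤⟨ *-monoˡ-≤-nonNeg μ {{ℚ.nonNegative (<⇒≤ 0<μ)}} (p⊓q≤q ε 1ℚ) ⟩
    μ * 1ℚ              ≡⟨ *-identityʳ μ ⟩
    μ                   ≤⟨ p⊓q≤p ε 1ℚ ⟩
    ε                   ∎

⌊log₂⌋-quotient-< : ∀ n → .{{ℕ.NonZero n}} → ∀ j k →
  + ⌊log₂ n ℕ.^ suc j ⌋ / suc j < + ⌊log₂ n ℕ.^ suc k ⌋ / suc k + + 1 / suc k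
⌊log₂⌋-quotient-< n j k = subst (+ a / suc j <_) (/-suc b k) (frac-< a (suc b) j k a<b)
  where
  open ℕ.≤-Reasoning
  a = ⌊log₂ n ℕ.^ suc j ⌋
  b = ⌊log₂ n ℕ.^ suc k ⌋
  powers : 2 ℕ.^ (a ℕ.* suc k) ℕ.< 2 ℕ.^ (suc b ℕ.* suc j)
  powers = begin-strict
    2 ℕ.^ (a ℕ.* suc k)         ≡⟨ ℕ.^-*-assoc 2 a (suc k) ⟨
    (2 ℕ.^ a) ℕ.^ suc k         ≤⟨ ℕ.^-monoˡ-≤ (suc k) (⌊log₂⌋-lower (n ℕ.^ suc j) {{ℕ.m^n≢0 n (suc j)}}) ⟩
    (n ℕ.^ suc j) ℕ.^ suc k     ≡⟨ ℕ.^-*-assoc n (suc j) (suc k) ⟩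
    n ℕ.^ (suc j ℕ.* suc k)     ≡⟨ cong (n ℕ.^_) (ℕ.*-comm (suc j) (suc k)) ⟩
    n ℕ.^ (suc k ℕ.* suc j)     ≡⟨ ℕ.^-*-assoc n (suc k) (suc j) ⟨
    (n ℕ.^ suc k) ℕ.^ suc j     <⟨ ℕ.^-monoˡ-< (suc j) (⌊log₂⌋-upper (n ℕ.^ suc k)) ⟩
    (2 ℕ.^ suc b) ℕ.^ suc j     ≡⟨ ℕ.^-*-assoc 2 (suc b) (suc j) ⟩
    2 ℕ.^ (suc b ℕ.* suc j)     ∎
  a<b : a ℕ.* suc k ℕ.< suc b ℕ.* suc j
  a<b with a ℕ.* suc k ℕ.<? suc b ℕ.* suc j
  ... | yes lt = lt
  ... | no ≮ = ⊥-elim (ℕ.<⇒≱ powers (ℕ.^-monoʳ-≤ 2 (ℕ.≮⇒≥ ≮)))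

log₂≈ : ℕ → ℕ → ℚ
log₂≈ n k = + ⌊log₂ n ℕ.^ suc k ⌋ / suc k

log₂≈-cauchy : ∀ n → IsCauchy (log₂≈ n)
log₂≈-cauchy zero ε 0<ε = 0 , λ i j _ _ →
  subst (λ z → ∣ z ∣ < ε) (sym (cong₂ _-_ (0/n≡0 (suc i)) (0/n≡0 (suc j)))) 0<ε
log₂≈-cauchy n@(suc _) ε 0<ε =
  let N , f = archimedean 0<ε
  in N , λ i j p q →
  <⇒close (log₂≈ n i) (log₂≈ n j)
    (<-≤-trans (⌊log₂⌋-quotient-< n i j) (+-monoʳ-≤ (log₂≈ n j) (f j q)))
    (<-≤-trans (⌊log₂⌋-quotient-< n j i) (+-monoʳ-≤ (log₂≈ n i) (f i p)))

-- The binary logarithm of n ≥ 1, as the limit of ⌊log₂ nᵏ⌋ / k; log₂ 0 is 0.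
log₂ : ℕ → ℝ
log₂ n = mkℝ (log₂≈ n) (log₂≈-cauchy n)

log₂-pos : ∀ n → 2 ℕ.≤ n → 0ℝ <ℝ log₂ n
log₂-pos n 2≤n = ½ , 0<½ , 0 , λ k _ → <-≤-trans ½<1
    (frac-≤ 1 ⌊log₂ n ℕ.^ suc k ⌋ 0 k (ℕ.≤-trans (ℕ.≤-reflexive (ℕ.*-identityˡ (suc k)))
      (ℕ.≤-trans (k≤log k) (ℕ.≤-reflexive (sym (ℕ.*-identityʳ ⌊log₂ n ℕ.^ suc k ⌋))))))
  where
  ½<1 : 0ℚ + ½ < 1ℚ
  ½<1 = ℚ.*<* (ℤ.+<+ (ℕ.s≤s (ℕ.s≤s ℕ.z≤n)))
  k≤log : ∀ k → suc k ℕ.≤ ⌊log₂ n ℕ.^ suc k ⌋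
  k≤log k = subst (ℕ._≤ ⌊log₂ n ℕ.^ suc k ⌋) (⌊log₂[2^n]⌋≡n (suc k))
    (⌊log₂⌋-mono-≤ (ℕ.^-monoˡ-≤ (suc k) 2≤n))

ℝ-+-rawMonoid : RawMonoid 0ℓ 0ℓ
ℝ-+-rawMonoid = record { Carrier = ℝ ; _≈_ = _≃ℝ_ ; _∙_ = _+ℝ_ ; ε = 0ℝ }

∑ℝ : ∀ {n} → Vector ℝ n → ℝ
∑ℝ = RawMonoidDefs.sum ℝ-+-rawMonoid

Point : ℕ → Set
Point d = Vector ℝ d

infix 4 _≈ₚ_ _∈_ _≐ₕ_

_≈ₚ_ : ∀ {d} → Rel (Point d) 0ℓ
x ≈ₚ y = ∀ i → x i ≃ℝ y i

_·_ : ∀ {d} → Vector ℝ d → Vector ℝ d → ℝ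
x · y = ∑ℝ (zipWith _*ℝ_ x y)

record Hyperplane (d : ℕ) : Set where
  field
    normal  : Vector ℝ d
    offset  : ℝ
    nonzero : ∃[ i ] normal i #ℝ 0ℝ

_∈_ : ∀ {d} → Point d → Hyperplane d → Set
x ∈ H = normal · x ≃ℝ offset
  where open Hyperplane H

-- Different equations may describe the same hyperplane, so hyperplanes are
-- compared as sets of points.
_≐ₕ_ : ∀ {d} → Rel (Hyperplane d) 0ℓ
H ≐ₕ K = ∀ x → x ∈ H ⇔ x ∈ K

-- A set of at most n elements of A (up to _≈_), listed without repetition.
record SetOfAtMost (n : ℕ) {A : Set} (_≈_ : Rel A 0ℓ) : Set where
  field
    size      : ℕ
    size≤n    : size ℕ.≤ n
    element   : Fin size → A
    injective : Injective _≡_ _≈_ element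

open SetOfAtMost public using (size; element)

Matrix : Set → ℕ → ℕ → Set
Matrix A m n = Vector (Vector A n) m

-- Incidence on real points is undecidable, so the incidence matrix is
-- specified by its entries instead of being computed from P and 𝓗.
IsIncidenceMatrix : ∀ {d k l} (𝓗 : SetOfAtMost k (_≐ₕ_ {d})) (P : SetOfAtMost l (_≈ₚ_ {d})) →
                    Matrix Bool (size 𝓗) (size P) → Set
IsIncidenceMatrix 𝓗 P M = ∀ i j →
  (M i j ≡ true  ×   element P j ∈ element 𝓗 i) ⊎
  (M i j ≡ false × ¬ element P j ∈ element 𝓗 i)

infix 5 _+i_

record ℂ : Set where
  constructor _+i_
  field
    re im : ℝ

open ℂ public

infix  4 _≃ℂ_
infixl 6 _+ℂ_
infixl 7 _*ℂ_

_≃ℂ_ : Rel ℂ 0ℓ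
z ≃ℂ w = re z ≃ℝ re w × im z ≃ℝ im w

_+ℂ_ _*ℂ_ : ℂ → ℂ → ℂ
z +ℂ w = (re z +ℝ re w) +i (im z +ℝ im w)
z *ℂ w = (re z *ℝ re w -ℝ im z *ℝ im w) +i (re z *ℝ im w +ℝ im z *ℝ re w)

0ℂ 1ℂ : ℂ
0ℂ = 0ℝ +i 0ℝ
1ℂ = 1ℝ +i 0ℝ

∣_∣² : ℂ → ℝ
∣ z ∣² = re z *ℝ re z +ℝ im z *ℝ im z

ℂ-+-rawMonoid : RawMonoid 0ℓ 0ℓ
ℂ-+-rawMonoid = record { Carrier = ℂ ; _≈_ = _≃ℂ_ ; _∙_ = _+ℂ_ ; ε = 0ℂ }

∑ℂ : ∀ {n} → Vector ℂ n → ℂ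
∑ℂ = RawMonoidDefs.sum ℂ-+-rawMonoid

toℂ : Bool → ℂ
toℂ true  = 1ℂ
toℂ false = 0ℂ

toℂᴹ : ∀ {m n} → Matrix Bool m n → Matrix ℂ m n
toℂᴹ M i j = toℂ (M i j)

infix  4 _≃ᴹ_
infixl 7 _*ᴹ_

_≃ᴹ_ : ∀ {m n} → Rel (Matrix ℂ m n) 0ℓ
A ≃ᴹ B = ∀ i j → A i j ≃ℂ B i j

_*ᴹ_ : ∀ {m k n} → Matrix ℂ m k → Matrix ℂ k n → Matrix ℂ m n
(U *ᴹ V) i j = ∑ℂ (λ l → U i l *ℂ V l j)

‖_‖₂ : ∀ {n} → Vector ℂ n → ℝ
‖ v ‖₂ = √ (∑ℝ (λ l → ∣ v l ∣²))

-- The maximum of a vector of nonnegative reals; it is 0 for the empty vector.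
max : ∀ {n} → Vector ℝ n → ℝ
max = foldr _⊔ℝ_ 0ℝ

‖_‖row : ∀ {m n} → Matrix ℂ m n → ℝ
‖ U ‖row = max (λ i → ‖ U i ‖₂)

‖_‖col : ∀ {m n} → Matrix ℂ m n → ℝ
‖ V ‖col = max (λ j → ‖ flip V j ‖₂)

record Factorization {m n} (M : Matrix ℂ m n) : Set where
  field
    inner   : ℕ
    U       : Matrix ℂ m inner
    V       : Matrix ℂ inner n
    factors : M ≃ᴹ U *ᴹ V

  cost : ℝ
  cost = ‖ U ‖row *ℝ ‖ V ‖col

open Factorization public using (cost)

Isγ₂ : ∀ {m n} → Matrix ℂ m n → ℝ → Set
Isγ₂ M g = (∃[ F ] cost {M = M} F ≃ℝ g) × (∀ (F : Factorization M) → g ≤ℝ cost F)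

-- That the minimum over all factorizations is attained is a compactness
-- argument, so γ₂ is not available as a function.  A lower bound on a minimum
-- is a lower bound on every competitor; γ₂≥⇔ relates this to Isγ₂.
γ₂_≥_ : ∀ {m n} → Matrix ℂ m n → ℝ → Set
γ₂ M ≥ t = ∀ (F : Factorization M) → t ≤ℝ cost F

γ₂≥⇔ : ∀ {m n} (M : Matrix ℂ m n) {g} → Isγ₂ M g → ∀ t → (γ₂ M ≥ t) ⇔ (t ≤ℝ g)
γ₂≥⇔ M {g} ((F , F≃g) , g≤) t = mk⇔
  (λ t≤ → ≤ℝ-trans t (cost F) g (t≤ F) (≃ℝ⇒≤ℝ (cost F) g F≃g))
  (λ t≤g G → ≤ℝ-trans t g (cost G) t≤g (g≤ G))

{-# OPTIONS --safe #-}
module Submission where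

-- Let r = 2ᵏ be of order n^(1/4).  The points (x , y , z) with x, y < r and z < r², and the planes
-- a x + b y + z = β with a, b < r, have r⁶ incidences.  If two planes share two points, then the
-- differences of the parameters satisfy (a - a′)(x - x′) = (b′ - b)(y - y′), so that the number of
-- such configurations is governed by the number of solutions of the equation i j = k l in integers
-- below r, which is O(r² log r).
--
-- For M = U V, the ratio of (∑ σ²)³ and ∑ σ⁴ (σ the singular values of M) bounds (∑ σ)², hence
-- ‖U‖²‖V‖², from below.  To avoid singular values, M is paired with the regularised inverse
-- q = (λ + M Mᵀ)⁻¹ M, whose operator norm is at most 1 / (2 √λ).  The matrix q is rational, and the
-- whole argument is carried out on the rational approximations of U and V.

-- The matrix q stands in for the polar factor of M, for which the pairing with M would be exactly ∑
-- σ. With λ at least ∑ σ⁴ / ∑ σ², the pairing ⟨q, M⟩ = ∑ σ² / (λ + σ²) is still at least ∑ σ² / (2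
-- λ), and q stays rational because inverting λ + M Mᵀ takes only field operations. Here ∑ σ² is the
-- number of incidences, at least r⁶, and λ is 96 (k + 1) r², so the square of the cost is at least
-- of order r¹² / (λ r⁸), that is r² / (k + 1). The logarithm of the theorem is thus the one in the
-- count of solutions of i j = k l. At each index the approximations of U and V multiply to M only
-- up to an error. Since q depends on M alone, the error in the pairing is at most the entrywise
-- error times the sum of the absolute entries of q, hence eventually at most half of ⟨q, M⟩.
-- Working with approximations therefore costs a constant factor and nothing else.

open import Defs

-- Counting incidences and rectangles of the grid configuration.

module Counting where
  open import Data.Nat.Base
  open import Data.Nat.Properties
  open import Data.Nat.DivMod using (_/_; m/n*n≤m; /-monoʳ-≤; m*n/n≡m; m*[n/m]≡n; /-monoˡ-≤; n/1≡n)
  open import Data.Nat.Divisibility using (_∣_; divides)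
  open import Data.Nat.GCD using (gcd; gcd[m,n]∣m; gcd[m,n]∣n; gcd[m,n]≢0)
  open import Data.Nat.Coprimality using (coprime-/gcd; coprime-divisor)
  open import Data.Nat.Solver using (module +-*-Solver)
  import Data.Integer.Base as ℤ
  import Data.Integer.Properties as ℤ
  import Data.Integer.Solver as ℤ
  open import Data.List.Base using (List; []; _∷_; _++_; map; length; upTo; applyUpTo; cartesianProduct)
  open import Data.List.Properties using (length-upTo)
  open import Data.List.Membership.Propositional renaming (_∈_ to _∈ˡ_)
  open import Data.List.Membership.Propositional.Properties using (∈-upTo⁺; ∈-upTo⁻; ∈-cartesianProduct⁺; ∈-cartesianProduct⁻)
  open import Data.List.Relation.Unary.Any using (here; there)
  open import Data.List.Relation.Unary.All as All using (All; []; _∷_)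
  open import Data.List.Relation.Unary.AllPairs using ([]; _∷_)
  open import Data.List.Relation.Unary.Unique.Propositional using (Unique)
  open import Data.List.Relation.Unary.Unique.Propositional.Properties using (upTo⁺; cartesianProduct⁺)
  open import Data.Product.Base using (_×_; _,_; proj₁; proj₂; ∃-syntax)
  open import Data.Product.Properties using (≡-dec)
  open import Data.Sum.Base using (inj₁; inj₂)
  open import Data.Empty using (⊥-elim)
  open import Function.Base using (_∘_)
  open import Relation.Nullary using (Dec; yes; no)
  open import Relation.Nullary.Decidable using (_×-dec_; ¬?)
  open import Relation.Binary.Definitions using (DecidableEquality)
  open import Relation.Binary.PropositionalEquality

  private
    variable
      A B : Set
      P Q : Set

  𝟙 : Dec P → ℕ
  𝟙 (yes _) = 1
  𝟙 (no _)  = 0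

  𝟙-≤ : ∀ {n} (P? : Dec P) → (P → 1 ≤ n) → 𝟙 P? ≤ n
  𝟙-≤ (yes p) h = h p
  𝟙-≤ (no _)  h = z≤n

  𝟙-true : (P? : Dec P) → P → 1 ≤ 𝟙 P?
  𝟙-true (yes _) _ = ≤-refl
  𝟙-true (no ¬p) p = ⊥-elim (¬p p)

  𝟙-mono : (P? : Dec P) (Q? : Dec Q) → (P → Q) → 𝟙 P? ≤ 𝟙 Q?
  𝟙-mono P? Q? h = 𝟙-≤ P? (𝟙-true Q? ∘ h)

  𝟙-× : (P? : Dec P) (Q? : Dec Q) → 𝟙 (P? ×-dec Q?) ≡ 𝟙 P? * 𝟙 Q?
  𝟙-× (yes _) (yes _) = refl
  𝟙-× (yes _) (no _)  = refl
  𝟙-× (no _)  _       = refl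

  ∑ : List A → (A → ℕ) → ℕ
  ∑ []       f = 0
  ∑ (x ∷ xs) f = f x + ∑ xs f

  infix 5 ∑-syntax
  ∑-syntax = ∑
  syntax ∑-syntax xs (λ x → e) = ∑[ x ← xs ] e

  ∑-cong : ∀ (xs : List A) {f g} → (∀ x → f x ≡ g x) → ∑ xs f ≡ ∑ xs g
  ∑-cong []       h = refl
  ∑-cong (x ∷ xs) h = cong₂ _+_ (h x) (∑-cong xs h)

  ∑-mono-∈ : ∀ (xs : List A) {f g} → (∀ {x} → x ∈ˡ xs → f x ≤ g x) → ∑ xs f ≤ ∑ xs g
  ∑-mono-∈ []       h = z≤n
  ∑-mono-∈ (x ∷ xs) h = +-mono-≤ (h (here refl)) (∑-mono-∈ xs (h ∘ there))

  ∑-mono : ∀ (xs : List A) {f g} → (∀ x → f x ≤ g x) → ∑ xs f ≤ ∑ xs g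
  ∑-mono xs h = ∑-mono-∈ xs (λ {x} _ → h x)

  ∑-++ : ∀ (xs ys : List A) f → ∑ (xs ++ ys) f ≡ ∑ xs f + ∑ ys f
  ∑-++ []       ys f = refl
  ∑-++ (x ∷ xs) ys f = trans (cong (f x +_) (∑-++ xs ys f)) (sym (+-assoc (f x) _ _))

  ∑-map : ∀ (g : A → B) xs f → ∑ (map g xs) f ≡ ∑ xs (f ∘ g)
  ∑-map g []       f = refl
  ∑-map g (x ∷ xs) f = cong (f (g x) +_) (∑-map g xs f)

  ∑-+ : ∀ (xs : List A) f g → (∑[ x ← xs ] (f x + g x)) ≡ ∑ xs f + ∑ xs g
  ∑-+ []       f g = refl
  ∑-+ (x ∷ xs) f g = trans (cong (f x + g x +_) (∑-+ xs f g))
    (solve 4 (λ a b c d → (a :+ b) :+ (c :+ d) := (a :+ c) :+ (b :+ d)) refl (f x) (g x) (∑ xs f) (∑ xs g))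
    where open +-*-Solver

  ∑-*ˡ : ∀ (xs : List A) c f → (∑[ x ← xs ] c * f x) ≡ c * ∑ xs f
  ∑-*ˡ []       c f = sym (*-zeroʳ c)
  ∑-*ˡ (x ∷ xs) c f = trans (cong (c * f x +_) (∑-*ˡ xs c f)) (sym (*-distribˡ-+ c (f x) _))

  ∑-*ʳ : ∀ (xs : List A) f c → (∑[ x ← xs ] f x * c) ≡ ∑ xs f * c
  ∑-*ʳ xs f c = trans (∑-cong xs (λ x → *-comm (f x) c)) (trans (∑-*ˡ xs c f) (*-comm c _))

  ∑-const : ∀ (xs : List A) c → (∑[ x ← xs ] c) ≡ length xs * c
  ∑-const []       c = refl
  ∑-const (x ∷ xs) c = cong (c +_) (∑-const xs c)

  ∑-upTo-const : ∀ n c → (∑[ x ← upTo n ] c) ≡ n * c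
  ∑-upTo-const n c = trans (∑-const (upTo n) c) (cong (_* c) (length-upTo n))

  ∑-swap : ∀ (xs : List A) (ys : List B) (f : A → B → ℕ) → (∑[ x ← xs ] ∑[ y ← ys ] f x y) ≡ (∑[ y ← ys ] ∑[ x ← xs ] f x y)
  ∑-swap []       ys f = sym (trans (∑-const ys 0) (*-zeroʳ (length ys)))
  ∑-swap (x ∷ xs) ys f = trans (cong (∑ ys (f x) +_) (∑-swap xs ys f)) (sym (∑-+ ys (f x) _))

  ∑-∑* : ∀ (xs : List A) (ys : List B) f g → (∑[ x ← xs ] ∑[ y ← ys ] f x * g y) ≡ ∑ xs f * ∑ ys g
  ∑-∑* xs ys f g = trans (∑-cong xs (λ x → ∑-*ˡ ys (f x) g)) (∑-*ʳ xs f (∑ ys g))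

  ∑-× : ∀ (xs : List A) (ys : List B) f → ∑ (cartesianProduct xs ys) f ≡ (∑[ x ← xs ] ∑[ y ← ys ] f (x , y))
  ∑-× []       ys f = refl
  ∑-× (x ∷ xs) ys f = trans (∑-++ (map (x ,_) ys) (cartesianProduct xs ys) f)
    (cong₂ _+_ (∑-map (x ,_) ys f) (∑-× xs ys f))

  ∈⇒≤∑ : ∀ {xs : List A} {x} f → x ∈ˡ xs → f x ≤ ∑ xs f
  ∈⇒≤∑ {xs = y ∷ xs} f (here refl) = m≤m+n (f y) _
  ∈⇒≤∑ {xs = y ∷ xs} f (there x∈) = ≤-trans (∈⇒≤∑ f x∈) (m≤n+m _ (f y))

  ∑-𝟙≡ : (_≟ᴬ_ : DecidableEquality A) {xs : List A} → Unique xs → ∀ c → (∑[ x ← xs ] 𝟙 (c ≟ᴬ x)) ≤ 1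
  ∑-𝟙≡ _≟ᴬ_ {[]}     []          c = z≤n
  ∑-𝟙≡ _≟ᴬ_ {x ∷ xs} (x∉ ∷ uniq) c with c ≟ᴬ x
  ... | no _     = ∑-𝟙≡ _≟ᴬ_ uniq c
  ... | yes refl = s≤s (≤-trans (∑-mono-∈ xs {g = λ _ → 0} λ {y} y∈ → 𝟙-≤ (c ≟ᴬ y) (λ { refl → ⊥-elim (All.lookup x∉ y∈ refl) }))
                     (≤-reflexive (trans (∑-const xs 0) (*-zeroʳ (length xs)))))

  -- Double counting of the pairs with `φ y ≡ x`: every counted `x` has a counted preimage, and
  -- every `y` accounts for at most one `x` because `xs` has no repetitions.
  ∑-cover : (_≟ᴬ_ : DecidableEquality A) {xs : List A} → Unique xs →
    {P : A → Set} (P? : ∀ x → Dec (P x)) (ys : List B) {Q : B → Set} (Q? : ∀ y → Dec (Q y)) (φ : B → A) →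
    (∀ {x} → x ∈ˡ xs → P x → ∃[ y ] y ∈ˡ ys × Q y × φ y ≡ x) →
    (∑[ x ← xs ] 𝟙 (P? x)) ≤ (∑[ y ← ys ] 𝟙 (Q? y))
  ∑-cover _≟ᴬ_ {xs} uniq P? ys Q? φ cover = begin
    (∑[ x ← xs ] 𝟙 (P? x))
      ≤⟨ ∑-mono-∈ xs (λ {x} x∈ → 𝟙-≤ (P? x) λ p →
           let y , y∈ , q , φy≡x = cover x∈ p
           in ≤-trans (*-mono-≤ (𝟙-true (Q? y) q) (𝟙-true (φ y ≟ᴬ x) φy≡x))
                      (∈⇒≤∑ (λ y → 𝟙 (Q? y) * 𝟙 (φ y ≟ᴬ x)) y∈)) ⟩
    (∑[ x ← xs ] ∑[ y ← ys ] 𝟙 (Q? y) * 𝟙 (φ y ≟ᴬ x))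
      ≡⟨ ∑-swap xs ys _ ⟩
    (∑[ y ← ys ] ∑[ x ← xs ] 𝟙 (Q? y) * 𝟙 (φ y ≟ᴬ x))
      ≡⟨ ∑-cong ys (λ y → ∑-*ˡ xs (𝟙 (Q? y)) _) ⟩
    (∑[ y ← ys ] 𝟙 (Q? y) * (∑[ x ← xs ] 𝟙 (φ y ≟ᴬ x)))
      ≤⟨ ∑-mono ys (λ y → ≤-trans (*-monoʳ-≤ (𝟙 (Q? y)) (∑-𝟙≡ _≟ᴬ_ uniq (φ y))) (≤-reflexive (*-identityʳ _))) ⟩
    (∑[ y ← ys ] 𝟙 (Q? y)) ∎
    where open ≤-Reasoning

  infixr 6 _⊗_
  _⊗_ : List A → List B → List (A × B)
  _⊗_ = cartesianProduct

  ∑-𝟙< : ∀ n m → (∑[ x ← upTo n ] 𝟙 (x <? m)) ≤ m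
  ∑-𝟙< n m = begin
    (∑[ x ← upTo n ] 𝟙 (x <? m))  ≤⟨ ∑-cover _≟_ (upTo⁺ n) (_<? m) (upTo m) (λ _ → yes refl) (λ x → x)
                                        (λ {x} _ x<m → x , ∈-upTo⁺ x<m , refl {x = 0} , refl) ⟩
    (∑[ x ← upTo m ] 1)           ≡⟨ ∑-upTo-const m 1 ⟩
    m * 1                         ≡⟨ *-identityʳ m ⟩
    m                             ∎
    where open ≤-Reasoning

  ∑-applyUpTo : ∀ (g : ℕ → A) n f → ∑ (applyUpTo g n) f ≡ ∑ (upTo n) (f ∘ g)
  ∑-applyUpTo {A} g zero    f = refl
  ∑-applyUpTo {A} g (suc n) f = cong (f (g 0) +_) (trans (∑-applyUpTo (g ∘ suc) n f) (sym (∑-applyUpTo suc n (f ∘ g))))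

  ∑-upTo-+ : ∀ m n f → ∑ (upTo (m + n)) f ≡ ∑ (upTo m) f + (∑[ i ← upTo n ] f (m + i))
  ∑-upTo-+ zero    n f = refl
  ∑-upTo-+ (suc m) n f = begin
    f 0 + ∑ (applyUpTo suc (m + n)) f                                   ≡⟨ cong (f 0 +_) (∑-applyUpTo suc (m + n) f) ⟩
    f 0 + ∑ (upTo (m + n)) (f ∘ suc)                                    ≡⟨ cong (f 0 +_) (∑-upTo-+ m n (f ∘ suc)) ⟩
    f 0 + (∑ (upTo m) (f ∘ suc) + (∑[ i ← upTo n ] f (suc m + i)))      ≡⟨ +-assoc (f 0) _ _ ⟨
    f 0 + ∑ (upTo m) (f ∘ suc) + (∑[ i ← upTo n ] f (suc m + i))        ≡⟨ cong (λ s → f 0 + s + (∑[ i ← upTo n ] f (suc m + i))) (∑-applyUpTo suc m f) ⟨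
    f 0 + ∑ (applyUpTo suc m) f + (∑[ i ← upTo n ] f (suc m + i))       ∎
    where open ≡-Reasoning

  -- A harmonic sum split into dyadic blocks: the block of the 2ᵏ denominators above 2ᵏ contributes
  -- at most `r`. This is the source of the logarithm.
  ∑-quotients : ∀ k r → (∑[ g ← upTo (2 ^ k) ] r / suc g) ≤ suc k * r
  ∑-quotients zero    r = ≤-reflexive (cong (_+ 0) (n/1≡n r))
  ∑-quotients (suc k) r = begin
    ∑ (upTo (2 ^ k + (2 ^ k + 0))) q                           ≡⟨ cong (λ n → ∑ (upTo (2 ^ k + n)) q) (+-identityʳ (2 ^ k)) ⟩
    ∑ (upTo (2 ^ k + 2 ^ k)) q                                 ≡⟨ ∑-upTo-+ (2 ^ k) (2 ^ k) q ⟩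
    ∑ (upTo (2 ^ k)) q + (∑[ i ← upTo (2 ^ k) ] q (2 ^ k + i))  ≤⟨ +-mono-≤ (∑-quotients k r) (∑-mono (upTo (2 ^ k)) (λ i → /-monoʳ-≤ r (m≤n⇒m≤1+n (m≤m+n (2 ^ k) i)))) ⟩
    suc k * r + (∑[ i ← upTo (2 ^ k) ] r / 2 ^ k)               ≡⟨ cong (suc k * r +_) (∑-upTo-const (2 ^ k) _) ⟩
    suc k * r + 2 ^ k * (r / 2 ^ k)                            ≤⟨ +-monoʳ-≤ (suc k * r) (≤-trans (≤-reflexive (*-comm (2 ^ k) _)) (m/n*n≤m r (2 ^ k))) ⟩
    suc k * r + r                                              ≡⟨ +-comm (suc k * r) r ⟩
    suc (suc k) * r                                            ∎
    where
    open ≤-Reasoning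
    q = λ g → r / suc g
    instance
      2^k≢0 : NonZero (2 ^ k)
      2^k≢0 = m^n≢0 2 k

  *≤⇒≤/ : ∀ m {n r} .{{_ : NonZero m}} → m * n ≤ r → n ≤ r / m
  *≤⇒≤/ m {n} {r} h = begin
    n          ≡⟨ m*n/n≡m n m ⟨
    n * m / m  ≡⟨ cong (_/ m) (*-comm n m) ⟩
    m * n / m  ≤⟨ /-monoˡ-≤ m h ⟩
    r / m      ∎
    where open ≤-Reasoning

  -- With g = gcd(c, a), the quotients u = a / g and v = c / g are coprime and u b = v d; hence v
  -- divides b, and h is the quotient.
  four-number : ∀ a b c d .{{_ : NonZero a}} .{{_ : NonZero c}} → a * b ≡ c * d →
    ∃[ g ] ∃[ u ] ∃[ v ] ∃[ h ] a ≡ g * u × b ≡ v * h × c ≡ g * v × d ≡ u * h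
  four-number a b c d ab≡cd = factor (coprime-divisor {v} {u} {b} (coprime-/gcd c a) (divides d (trans ub≡vd (*-comm v d))))
    where
    open ≡-Reasoning
    g = gcd c a
    instance
      g≢0 : NonZero g
      g≢0 = ≢-nonZero (gcd[m,n]≢0 c a (inj₁ (≢-nonZero⁻¹ c)))
    v = c / g
    u = a / g
    gu≡a : g * u ≡ a
    gu≡a = m*[n/m]≡n (gcd[m,n]∣n c a)
    gv≡c : g * v ≡ c
    gv≡c = m*[n/m]≡n (gcd[m,n]∣m c a)
    instance
      v≢0 : NonZero v
      v≢0 = ≢-nonZero λ v≡0 → ≢-nonZero⁻¹ c (trans (sym gv≡c) (trans (cong (g *_) v≡0) (*-zeroʳ g)))
    ub≡vd : u * b ≡ v * d
    ub≡vd = *-cancelˡ-≡ _ _ g (begin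
      g * (u * b)  ≡⟨ *-assoc g u b ⟨
      g * u * b    ≡⟨ cong (_* b) gu≡a ⟩
      a * b        ≡⟨ ab≡cd ⟩
      c * d        ≡⟨ cong (_* d) gv≡c ⟨
      g * v * d    ≡⟨ *-assoc g v d ⟩
      g * (v * d)  ∎)
    factor : v ∣ b → ∃[ g ] ∃[ u ] ∃[ v ] ∃[ h ] a ≡ g * u × b ≡ v * h × c ≡ g * v × d ≡ u * h
    factor (divides h b≡hv) = g , u , v , h , sym gu≡a , trans b≡hv (*-comm h v) , sym gv≡c , *-cancelˡ-≡ _ _ v (begin
      v * d        ≡⟨ ub≡vd ⟨
      u * b        ≡⟨ cong (u *_) b≡hv ⟩
      u * (h * v)  ≡⟨ solve 3 (λ u h v → u :* (h :* v) := v :* (u :* h)) refl u h v ⟩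
      v * (u * h)  ∎)
      where open +-*-Solver

  ℕ² : Set
  ℕ² = ℕ × ℕ

  _≟²_ : DecidableEquality ℕ²
  _≟²_ = ≡-dec _≟_ _≟_

  -- The multiplicative energy of the interval [0, r).
  product-energy : ℕ → ℕ
  product-energy r = ∑[ ab ← upTo r ⊗ upTo r ] ∑[ cd ← upTo r ⊗ upTo r ] 𝟙 (proj₁ ab * proj₂ ab ≟ proj₁ cd * proj₂ cd)

  -- Vanishing products are counted apart, because `four-number` parametrises only solutions with
  -- nonzero factors.
  ∑-𝟙-zero-product : ∀ r → (∑[ ab ← upTo r ⊗ upTo r ] 𝟙 (proj₁ ab * proj₂ ab ≟ 0)) ≤ 2 * r
  ∑-𝟙-zero-product r = begin
    (∑[ ab ← R ⊗ R ] 𝟙 (proj₁ ab * proj₂ ab ≟ 0))        ≡⟨ ∑-× R R _ ⟩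
    (∑[ a ← R ] ∑[ b ← R ] 𝟙 (a * b ≟ 0))               ≤⟨ ∑-mono R (λ a → ∑-mono R (λ b → 𝟙-≤ (a * b ≟ 0) (split a b))) ⟩
    (∑[ a ← R ] ∑[ b ← R ] 𝟙 (0 ≟ a) + 𝟙 (0 ≟ b))       ≡⟨ ∑-cong R (λ a → ∑-+ R (λ _ → 𝟙 (0 ≟ a)) (λ b → 𝟙 (0 ≟ b))) ⟩
    (∑[ a ← R ] (∑[ b ← R ] 𝟙 (0 ≟ a)) + (∑[ b ← R ] 𝟙 (0 ≟ b)))  ≤⟨ ∑-mono R (λ a → +-mono-≤ (≤-reflexive (∑-upTo-const r _)) (∑-𝟙≡ _≟_ (upTo⁺ r) 0)) ⟩
    (∑[ a ← R ] r * 𝟙 (0 ≟ a) + 1)                      ≡⟨ ∑-+ R _ _ ⟩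
    (∑[ a ← R ] r * 𝟙 (0 ≟ a)) + (∑[ a ← R ] 1)         ≡⟨ cong₂ _+_ (∑-*ˡ R r _) (∑-upTo-const r 1) ⟩
    r * (∑[ a ← R ] 𝟙 (0 ≟ a)) + r * 1                  ≤⟨ +-monoˡ-≤ (r * 1) (*-monoʳ-≤ r (∑-𝟙≡ _≟_ (upTo⁺ r) 0)) ⟩
    r * 1 + r * 1                                       ≡⟨ solve 1 (λ r → r :* con 1 :+ r :* con 1 := con 2 :* r) refl r ⟩
    2 * r                                               ∎
    where
    open ≤-Reasoning
    open +-*-Solver
    R = upTo r
    split : ∀ a b → a * b ≡ 0 → 1 ≤ 𝟙 (0 ≟ a) + 𝟙 (0 ≟ b)
    split a b ab≡0 with m*n≡0⇒m≡0∨n≡0 a ab≡0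
    ... | inj₁ a≡0 = ≤-trans (𝟙-true (0 ≟ a) (sym a≡0)) (m≤m+n _ _)
    ... | inj₂ b≡0 = ≤-trans (𝟙-true (0 ≟ b) (sym b≡0)) (m≤n+m _ _)

  module _ (k : ℕ) where
    private
      r = 2 ^ k
      R = upTo r

      q : ℕ → ℕ
      q g = r / suc g

      -- The variables are the four parameters of `four-number`, each diminished by one. So
      -- `u < q g` says `suc u ≤ r / suc g`, which follows from `suc g * suc u < r`; the four
      -- conditions come from the four numbers a, c, d, b in this order.
      Good : ℕ² × ℕ² → Set
      Good ((g , h) , (u , v)) = (u < q g × v < q g) × (u < q h × v < q h)

      good? : ∀ y → Dec (Good y)
      good? ((g , h) , (u , v)) = ((u <? q g) ×-dec (v <? q g)) ×-dec ((u <? q h) ×-dec (v <? q h))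

      φ : ℕ² × ℕ² → ℕ² × ℕ²
      φ ((g , h) , (u , v)) = (suc g * suc u , suc v * suc h) , (suc g * suc v , suc u * suc h)

      square : ℕ → ℕ
      square m = ∑[ uv ← R ⊗ R ] 𝟙 ((proj₁ uv <? m) ×-dec (proj₂ uv <? m))

      square≤ : ∀ m → square m ≤ m * m
      square≤ m = begin
        square m                                            ≡⟨ ∑-× R R _ ⟩
        (∑[ u ← R ] ∑[ v ← R ] 𝟙 ((u <? m) ×-dec (v <? m)))  ≡⟨ ∑-cong R (λ u → ∑-cong R (λ v → 𝟙-× (u <? m) (v <? m))) ⟩
        (∑[ u ← R ] ∑[ v ← R ] 𝟙 (u <? m) * 𝟙 (v <? m))      ≡⟨ ∑-∑* R R _ _ ⟩
        (∑[ u ← R ] 𝟙 (u <? m)) * (∑[ v ← R ] 𝟙 (v <? m))    ≤⟨ *-mono-≤ (∑-𝟙< r m) (∑-𝟙< r m) ⟩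
        m * m                                               ∎
        where open ≤-Reasoning

      -- For each g at most `suc g` values of h survive, and `suc g * q g ≤ r`. One factor of the
      -- square is thereby exchanged for r, and a harmonic sum remains.
      dyadic : (∑[ g ← R ] ∑[ h ← R ] 𝟙 (h <? suc g) * (q g * q g)) ≤ suc k * (r * r)
      dyadic = begin
        (∑[ g ← R ] ∑[ h ← R ] 𝟙 (h <? suc g) * (q g * q g))   ≡⟨ ∑-cong R (λ g → ∑-*ʳ R _ (q g * q g)) ⟩
        (∑[ g ← R ] (∑[ h ← R ] 𝟙 (h <? suc g)) * (q g * q g)) ≤⟨ ∑-mono R (λ g → ≤-trans (*-monoˡ-≤ (q g * q g) (∑-𝟙< r (suc g))) (g*q*q≤ g)) ⟩
        (∑[ g ← R ] r * q g)                                   ≡⟨ ∑-*ˡ R r q ⟩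
        r * ∑ R q                                              ≤⟨ *-monoʳ-≤ r (∑-quotients k r) ⟩
        r * (suc k * r)                                        ≡⟨ solve 2 (λ r k → r :* (k :* r) := k :* (r :* r)) refl r (suc k) ⟩
        suc k * (r * r)                                        ∎
        where
        open ≤-Reasoning
        open +-*-Solver
        g*q*q≤ : ∀ g → suc g * (q g * q g) ≤ r * q g
        g*q*q≤ g = begin
          suc g * (q g * q g)  ≡⟨ solve 2 (λ g q → g :* (q :* q) := (q :* g) :* q) refl (suc g) (q g) ⟩
          q g * suc g * q g    ≤⟨ *-monoˡ-≤ (q g) (m/n*n≤m r (suc g)) ⟩
          r * q g              ∎

      ∑-good : (∑[ y ← (R ⊗ R) ⊗ (R ⊗ R) ] 𝟙 (good? y)) ≤ 2 * (suc k * (r * r))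
      ∑-good = begin
        (∑[ y ← (R ⊗ R) ⊗ (R ⊗ R) ] 𝟙 (good? y))                    ≡⟨ ∑-× (R ⊗ R) (R ⊗ R) _ ⟩
        (∑[ gh ← R ⊗ R ] ∑[ uv ← R ⊗ R ] 𝟙 (good? (gh , uv)))       ≡⟨ ∑-× R R _ ⟩
        (∑[ g ← R ] ∑[ h ← R ] ∑[ uv ← R ⊗ R ] 𝟙 (good? ((g , h) , uv))) ≤⟨ ∑-mono R (λ g → ∑-mono R (λ h → by-order g h)) ⟩
        (∑[ g ← R ] ∑[ h ← R ] w g h + w h g)                       ≡⟨ ∑-cong R (λ g → ∑-+ R (w g) (λ h → w h g)) ⟩
        (∑[ g ← R ] (∑[ h ← R ] w g h) + (∑[ h ← R ] w h g))         ≡⟨ ∑-+ R _ _ ⟩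
        (∑[ g ← R ] ∑[ h ← R ] w g h) + (∑[ g ← R ] ∑[ h ← R ] w h g) ≡⟨ cong ((∑[ g ← R ] ∑[ h ← R ] w g h) +_) (∑-swap R R (λ g h → w h g)) ⟩
        (∑[ g ← R ] ∑[ h ← R ] w g h) + (∑[ h ← R ] ∑[ g ← R ] w h g) ≤⟨ +-mono-≤ dyadic dyadic ⟩
        suc k * (r * r) + suc k * (r * r)                           ≡⟨ cong (suc k * (r * r) +_) (+-identityʳ _) ⟨
        2 * (suc k * (r * r))                                       ∎
        where
        open ≤-Reasoning
        w : ℕ → ℕ → ℕ
        w g h = 𝟙 (h <? suc g) * (q g * q g)
        w-true : ∀ {g h n} → h ≤ g → n ≤ q g * q g → n ≤ w g h
        w-true {g} {h} h≤g n≤ = ≤-trans n≤ (≤-trans (≤-reflexive (sym (*-identityˡ _))) (*-monoˡ-≤ (q g * q g) (𝟙-true (h <? suc g) (s≤s h≤g))))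
        -- Only the constraints on u and v that come from the larger of g and h are kept, since
        -- these are the stronger ones; the smaller of the two is then summed out in `dyadic`.
        by-order : ∀ g h → (∑[ uv ← R ⊗ R ] 𝟙 (good? ((g , h) , uv))) ≤ w g h + w h g
        by-order g h with ≤-total h g
        ... | inj₁ h≤g = ≤-trans (w-true h≤g (≤-trans (∑-mono (R ⊗ R) (λ uv → 𝟙-mono (good? ((g , h) , uv)) _ proj₁)) (square≤ (q g)))) (m≤m+n _ _)
        ... | inj₂ g≤h = ≤-trans (w-true g≤h (≤-trans (∑-mono (R ⊗ R) (λ uv → 𝟙-mono (good? ((g , h) , uv)) _ proj₂)) (square≤ (q h)))) (m≤n+m _ _)

      NonZeroSolution : ℕ² × ℕ² → Set
      NonZeroSolution ((a , b) , (c , d)) = a * b ≡ c * d × a * b ≢ 0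

      nonZeroSolution? : ∀ x → Dec (NonZeroSolution x)
      nonZeroSolution? ((a , b) , (c , d)) = (a * b ≟ c * d) ×-dec ¬? (a * b ≟ 0)

      parametrised : ∀ {x} → x ∈ˡ (R ⊗ R) ⊗ (R ⊗ R) → NonZeroSolution x →
                     ∃[ y ] y ∈ˡ (R ⊗ R) ⊗ (R ⊗ R) × Good y × φ y ≡ x
      parametrised {(a , b) , (c , d)} x∈ (ab≡cd , ab≢0) =
        build (four-number a b c d {{≢-nonZero λ { refl → ab≢0 refl }}} {{≢-nonZero λ { refl → ab≢0 ab≡cd }}} ab≡cd)
        where
        ab∈ = ∈-cartesianProduct⁻ R R (proj₁ (∈-cartesianProduct⁻ (R ⊗ R) (R ⊗ R) x∈))
        cd∈ = ∈-cartesianProduct⁻ R R (proj₂ (∈-cartesianProduct⁻ (R ⊗ R) (R ⊗ R) x∈))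
        a< = ∈-upTo⁻ (proj₁ ab∈)
        b< = ∈-upTo⁻ (proj₂ ab∈)
        c< = ∈-upTo⁻ (proj₁ cd∈)
        d< = ∈-upTo⁻ (proj₂ cd∈)
        build : (∃[ g ] ∃[ u ] ∃[ v ] ∃[ h ] a ≡ g * u × b ≡ v * h × c ≡ g * v × d ≡ u * h) →
                ∃[ y ] y ∈ˡ (R ⊗ R) ⊗ (R ⊗ R) × Good y × φ y ≡ ((a , b) , (c , d))
        build (zero , u , v , h , refl , _) = ⊥-elim (ab≢0 refl)
        build (suc g , zero , v , h , refl , _) = ⊥-elim (ab≢0 (cong (_* b) (*-zeroʳ g)))
        build (suc g , suc u , zero , h , refl , refl , _) = ⊥-elim (ab≢0 (*-zeroʳ (suc g * suc u)))
        build (suc g , suc u , suc v , zero , refl , refl , _) =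
          ⊥-elim (ab≢0 (trans (cong (suc g * suc u *_) (*-zeroʳ (suc v))) (*-zeroʳ (suc g * suc u))))
        build (suc g , suc u , suc v , suc h , refl , refl , refl , refl) =
          ((g , h) , (u , v)) ,
          ∈-cartesianProduct⁺ (∈-cartesianProduct⁺ (∈-upTo⁺ (≤-trans (m≤m*n (suc g) (suc u)) (<⇒≤ a<))) (∈-upTo⁺ (≤-trans (m≤n*m (suc h) (suc v)) (<⇒≤ b<))))
                              (∈-cartesianProduct⁺ (∈-upTo⁺ (≤-trans (m≤n*m (suc u) (suc g)) (<⇒≤ a<))) (∈-upTo⁺ (≤-trans (m≤n*m (suc v) (suc g)) (<⇒≤ c<)))) ,
          ((*≤⇒≤/ (suc g) (<⇒≤ a<) , *≤⇒≤/ (suc g) (<⇒≤ c<)) ,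
           (*≤⇒≤/ (suc h) (≤-trans (≤-reflexive (*-comm (suc h) (suc u))) (<⇒≤ d<)) ,
            *≤⇒≤/ (suc h) (≤-trans (≤-reflexive (*-comm (suc h) (suc v))) (<⇒≤ b<)))) ,
          refl

    product-energy≤ : product-energy r ≤ 6 * (suc k * (r * r))
    product-energy≤ = begin
      (∑[ ab ← R ⊗ R ] ∑[ cd ← R ⊗ R ] 𝟙 (Π ab ≟ Π cd))
        ≤⟨ ∑-mono (R ⊗ R) (λ ab → ∑-mono (R ⊗ R) (λ cd → 𝟙-≤ (Π ab ≟ Π cd) (split ab cd))) ⟩
      (∑[ ab ← R ⊗ R ] ∑[ cd ← R ⊗ R ] Z ab * Z cd + 𝟙 (nonZeroSolution? (ab , cd)))
        ≡⟨ ∑-cong (R ⊗ R) (λ ab → ∑-+ (R ⊗ R) _ _) ⟩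
      (∑[ ab ← R ⊗ R ] (∑[ cd ← R ⊗ R ] Z ab * Z cd) + (∑[ cd ← R ⊗ R ] 𝟙 (nonZeroSolution? (ab , cd))))
        ≡⟨ ∑-+ (R ⊗ R) _ _ ⟩
      (∑[ ab ← R ⊗ R ] ∑[ cd ← R ⊗ R ] Z ab * Z cd) + (∑[ ab ← R ⊗ R ] ∑[ cd ← R ⊗ R ] 𝟙 (nonZeroSolution? (ab , cd)))
        ≡⟨ cong₂ _+_ (∑-∑* (R ⊗ R) (R ⊗ R) Z Z) (sym (∑-× (R ⊗ R) (R ⊗ R) (λ x → 𝟙 (nonZeroSolution? x)))) ⟩
      ∑ (R ⊗ R) Z * ∑ (R ⊗ R) Z + (∑[ x ← (R ⊗ R) ⊗ (R ⊗ R) ] 𝟙 (nonZeroSolution? x))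
        ≤⟨ +-mono-≤ (*-mono-≤ (∑-𝟙-zero-product r) (∑-𝟙-zero-product r))
                    (≤-trans (∑-cover (≡-dec _≟²_ _≟²_) (cartesianProduct⁺ R²! R²!) nonZeroSolution?
                                      ((R ⊗ R) ⊗ (R ⊗ R)) good? φ parametrised)
                             ∑-good) ⟩
      (2 * r) * (2 * r) + 2 * (suc k * (r * r))
        -- The 4 r² of the vanishing products is absorbed into the logarithmic term, as k + 1 ≥ 1.
        ≤⟨ m≤m+n _ (4 * (k * (r * r))) ⟩
      (2 * r) * (2 * r) + 2 * (suc k * (r * r)) + 4 * (k * (r * r))
        ≡⟨ solve 2 (λ r k → (con 2 :* r) :* (con 2 :* r) :+ con 2 :* ((con 1 :+ k) :* (r :* r)) :+ con 4 :* (k :* (r :* r))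
                            := con 6 :* ((con 1 :+ k) :* (r :* r))) refl r k ⟩
      6 * (suc k * (r * r)) ∎
      where
      open ≤-Reasoning
      open +-*-Solver
      Π : ℕ² → ℕ
      Π ab = proj₁ ab * proj₂ ab
      Z : ℕ² → ℕ
      Z ab = 𝟙 (Π ab ≟ 0)
      R²! = cartesianProduct⁺ (upTo⁺ r) (upTo⁺ r)
      split : ∀ ab cd → Π ab ≡ Π cd → 1 ≤ Z ab * Z cd + 𝟙 (nonZeroSolution? (ab , cd))
      split ab cd eq with Π ab ≟ 0
      ... | yes z = ≤-trans (≤-trans (𝟙-true (Π cd ≟ 0) (trans (sym eq) z)) (m≤m+n _ _)) (m≤m+n _ _)
      ... | no nz = 𝟙-true ((Π ab ≟ Π cd) ×-dec yes nz) (eq , nz)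

  -- For fixed a, a given difference is attained by at most two b, so each difference comes from at
  -- most 2 r pairs. The comparison of φ with c ψ is built in so that the bound can be nested:
  -- `differences≤` uses it four times, each inner instance serving as the hypothesis of the outer
  -- one.
  ∑-∣-∣ : ∀ r c {φ ψ : ℕ → ℕ} → (∀ k → φ k ≤ c * ψ k) →
          (∑[ p ← upTo r ⊗ upTo r ] φ ∣ proj₁ p - proj₂ p ∣) ≤ 2 * r * c * ∑ (upTo r) ψ
  ∑-∣-∣ r c {φ} {ψ} φ≤ = begin
    (∑[ p ← R ⊗ R ] φ ∣ proj₁ p - proj₂ p ∣)     ≡⟨ ∑-× R R _ ⟩
    (∑[ a ← R ] ∑[ b ← R ] φ ∣ a - b ∣)          ≤⟨ ∑-mono-∈ R (λ {a} a∈ → row a (∈-upTo⁻ a∈)) ⟩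
    (∑[ a ← R ] 2 * ∑ R φ)                      ≡⟨ ∑-upTo-const r _ ⟩
    r * (2 * ∑ R φ)                             ≤⟨ *-monoʳ-≤ r (*-monoʳ-≤ 2 (≤-trans (∑-mono R φ≤) (≤-reflexive (∑-*ˡ R c ψ)))) ⟩
    r * (2 * (c * ∑ R ψ))                       ≡⟨ solve 3 (λ r c s → r :* (con 2 :* (c :* s)) := con 2 :* r :* c :* s) refl r c (∑ R ψ) ⟩
    2 * r * c * ∑ R ψ                           ∎
    where
    open ≤-Reasoning
    open +-*-Solver
    R = upTo r
    near : ℕ → ℕ → ℕ → ℕ
    -- For k > a the truncated difference produces a spurious match at b = 0, which is harmless in
    -- an upper bound.
    near a k b = 𝟙 (a + k ≟ b) + 𝟙 (a ∸ k ≟ b)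
    is-near : ∀ a b → 1 ≤ near a ∣ a - b ∣ b
    is-near a b with ≤-total a b
    ... | inj₁ a≤b = ≤-trans (𝟙-true (_ ≟ b) (trans (cong (a +_) (m≤n⇒∣m-n∣≡n∸m a≤b)) (m+[n∸m]≡n a≤b))) (m≤m+n _ _)
    ... | inj₂ b≤a = ≤-trans (𝟙-true (_ ≟ b) (trans (cong (a ∸_) (m≤n⇒∣n-m∣≡n∸m b≤a)) (m∸[m∸n]≡n b≤a))) (m≤n+m _ _)
    row : ∀ a → a < r → (∑[ b ← R ] φ ∣ a - b ∣) ≤ 2 * ∑ R φ
    row a a<r = begin
      (∑[ b ← R ] φ ∣ a - b ∣)                        ≤⟨ ∑-mono-∈ R (λ {b} b∈ → ≤-trans (m≤m*n _ _ {{>-nonZero (is-near a b)}})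
                                                         (∈⇒≤∑ (λ k → φ k * near a k b) (∈-upTo⁺ (≤-<-trans (∣m-n∣≤m⊔n a b) (⊔-lub a<r (∈-upTo⁻ b∈)))))) ⟩
      (∑[ b ← R ] ∑[ k ← R ] φ k * near a k b)        ≡⟨ ∑-swap R R _ ⟩
      (∑[ k ← R ] ∑[ b ← R ] φ k * near a k b)        ≡⟨ ∑-cong R (λ k → ∑-*ˡ R (φ k) (near a k)) ⟩
      (∑[ k ← R ] φ k * ∑ R (near a k))               ≤⟨ ∑-mono R (λ k → *-monoʳ-≤ (φ k) (≤-trans (≤-reflexive (∑-+ R _ _))
                                                           (+-mono-≤ (∑-𝟙≡ _≟_ (upTo⁺ r) (a + k)) (∑-𝟙≡ _≟_ (upTo⁺ r) (a ∸ k))))) ⟩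
      (∑[ k ← R ] φ k * 2)                            ≡⟨ ∑-*ʳ R φ 2 ⟩
      ∑ R φ * 2                                       ≡⟨ *-comm (∑ R φ) 2 ⟩
      2 * ∑ R φ                                       ∎

  ℕ³ : Set
  ℕ³ = ℕ × ℕ²

  _≟³_ : DecidableEquality ℕ³
  _≟³_ = ≡-dec _≟_ _≟²_

  Incident : ℕ³ → ℕ³ → Set
  Incident (a , (b , β)) (x , (y , z)) = a * x + b * y + z ≡ β

  incident? : ∀ h p → Dec (Incident h p)
  incident? (a , (b , β)) (x , (y , z)) = a * x + b * y + z ≟ β

  points : ℕ → List ℕ³
  points r = upTo r ⊗ upTo r ⊗ upTo (r * r)

  -- One more than the largest value of a x + b y + z, so that every slope (a, b) has a plane
  -- through every point. With `pred r` in place of r the value at r = 1 is 1, and the smallest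
  -- configuration has a single plane.
  height : ℕ → ℕ
  height r = pred r * pred r + pred r * pred r + r * r

  planes : ℕ → List ℕ³
  planes r = upTo r ⊗ upTo r ⊗ upTo (height r)

  -- The entries of the Gram matrix Mᵀ M. Accordingly `incidences` is its trace ∑ σ², and
  -- `rectangles` its squared Frobenius norm ∑ σ⁴.
  common : ℕ → ℕ³ → ℕ³ → ℕ
  common r p p′ = ∑[ h ← planes r ] 𝟙 (incident? h p) * 𝟙 (incident? h p′)

  incidences : ℕ → ℕ
  incidences r = ∑[ p ← points r ] common r p p

  rectangles : ℕ → ℕ
  rectangles r = ∑[ p ← points r ] ∑[ p′ ← points r ] common r p p′ * common r p p′

  module _ where
    open import Data.Integer.Base using (+_)

    ∣⊖∣≡∣-∣ : ∀ m n → ℤ.∣ m ℤ.⊖ n ∣ ≡ ∣ m - n ∣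
    ∣⊖∣≡∣-∣ m n with ≤-total m n
    ... | inj₁ m≤n = trans (ℤ.∣⊖∣-≤ m≤n) (sym (m≤n⇒∣m-n∣≡n∸m m≤n))
    ... | inj₂ n≤m = trans (ℤ.∣m⊖n∣≡∣n⊖m∣ m n) (trans (ℤ.∣⊖∣-≤ n≤m) (sym (m≤n⇒∣n-m∣≡n∸m n≤m)))

    -- Subtracting the two equations eliminates z and z′. Absolute values then remove the sign and
    -- leave an equation between products of natural numbers, as counted by `product-energy`.
    rectangle-equation : ∀ {a a′ b b′ x x′ y y′ z z′} →
      a * x + b * y + z ≡ a * x′ + b * y′ + z′ → a′ * x + b′ * y + z ≡ a′ * x′ + b′ * y′ + z′ →
      ∣ a - a′ ∣ * ∣ x - x′ ∣ ≡ ∣ b - b′ ∣ * ∣ y - y′ ∣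
    rectangle-equation {a} {a′} {b} {b′} {x} {x′} {y} {y′} {z} {z′} eq eq′ = begin
      ∣ a - a′ ∣ * ∣ x - x′ ∣                        ≡⟨ ∣-∣* a a′ x x′ ⟩
      ℤ.∣ (+ a ℤ.- + a′) ℤ.* (+ x ℤ.- + x′) ∣        ≡⟨ cong ℤ.∣_∣ opposite ⟩
      ℤ.∣ ℤ.- ((+ b ℤ.- + b′) ℤ.* (+ y ℤ.- + y′)) ∣  ≡⟨ ℤ.∣-i∣≡∣i∣ ((+ b ℤ.- + b′) ℤ.* (+ y ℤ.- + y′)) ⟩
      ℤ.∣ (+ b ℤ.- + b′) ℤ.* (+ y ℤ.- + y′) ∣        ≡⟨ ∣-∣* b b′ y y′ ⟨
      ∣ b - b′ ∣ * ∣ y - y′ ∣                        ∎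
      where
      open ≡-Reasoning
      ∣-∣* : ∀ a a′ x x′ → ∣ a - a′ ∣ * ∣ x - x′ ∣ ≡ ℤ.∣ (+ a ℤ.- + a′) ℤ.* (+ x ℤ.- + x′) ∣
      ∣-∣* a a′ x x′ = sym (trans (ℤ.abs-* (+ a ℤ.- + a′) (+ x ℤ.- + x′))
        (cong₂ _*_ (trans (cong ℤ.∣_∣ (ℤ.m-n≡m⊖n a a′)) (∣⊖∣≡∣-∣ a a′)) (trans (cong ℤ.∣_∣ (ℤ.m-n≡m⊖n x x′)) (∣⊖∣≡∣-∣ x x′))))
      pos : ∀ a b x y z → + (a * x + b * y + z) ≡ + a ℤ.* + x ℤ.+ + b ℤ.* + y ℤ.+ + z
      pos a b x y z = cong₂ (λ s t → s ℤ.+ t ℤ.+ + z) (ℤ.pos-* a x) (ℤ.pos-* b y)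
      lift : ∀ a b → a * x + b * y + z ≡ a * x′ + b * y′ + z′ →
             + a ℤ.* + x ℤ.+ + b ℤ.* + y ℤ.+ + z ≡ + a ℤ.* + x′ ℤ.+ + b ℤ.* + y′ ℤ.+ + z′
      lift a b e = trans (sym (pos a b x y z)) (trans (cong +_ e) (pos a b x′ y′ z′))
      open ℤ.+-*-Solver
      opposite : (+ a ℤ.- + a′) ℤ.* (+ x ℤ.- + x′) ≡ ℤ.- ((+ b ℤ.- + b′) ℤ.* (+ y ℤ.- + y′))
      opposite = begin
        (+ a ℤ.- + a′) ℤ.* (+ x ℤ.- + x′)
          ≡⟨ solve 10 (λ a a′ b b′ x x′ y y′ z z′ → (a :- a′) :* (x :- x′) :=
               ((a :* x :+ b :* y :+ z) :- (a :* x′ :+ b :* y′ :+ z′)) :- ((a′ :* x :+ b′ :* y :+ z) :- (a′ :* x′ :+ b′ :* y′ :+ z′))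
                 :+ (:- ((b :- b′) :* (y :- y′)))) refl (+ a) (+ a′) (+ b) (+ b′) (+ x) (+ x′) (+ y) (+ y′) (+ z) (+ z′) ⟩
        (L ℤ.- L′) ℤ.- (K ℤ.- K′) ℤ.+ N
          ≡⟨ cong₂ (λ s t → (s ℤ.- L′) ℤ.- (t ℤ.- K′) ℤ.+ N) (lift a b eq) (lift a′ b′ eq′) ⟩
        (L′ ℤ.- L′) ℤ.- (K′ ℤ.- K′) ℤ.+ N
          ≡⟨ solve 3 (λ l k n → (l :- l) :- (k :- k) :+ n := n) refl L′ K′ N ⟩
        N ∎
        where
        L  = + a ℤ.* + x ℤ.+ + b ℤ.* + y ℤ.+ + z
        L′ = + a ℤ.* + x′ ℤ.+ + b ℤ.* + y′ ℤ.+ + z′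
        K  = + a′ ℤ.* + x ℤ.+ + b′ ℤ.* + y ℤ.+ + z
        K′ = + a′ ℤ.* + x′ ℤ.+ + b′ ℤ.* + y′ ℤ.+ + z′
        N  = ℤ.- ((+ b ℤ.- + b′) ℤ.* (+ y ℤ.- + y′))

  module _ (r : ℕ) where
    private
      R = upTo r
      R! = upTo⁺ r
      D = R ⊗ R

      Δ : ℕ² → ℕ
      Δ p = ∣ proj₁ p - proj₂ p ∣

      16r⁴ = 2 * r * (2 * r * (2 * r * (2 * r * 1)))

    differences≤ : (∑[ a ← D ] ∑[ x ← D ] ∑[ b ← D ] ∑[ y ← D ] 𝟙 (Δ a * Δ x ≟ Δ b * Δ y)) ≤ 16r⁴ * product-energy r
    differences≤ = begin
      (∑[ a ← D ] ∑[ x ← D ] ∑[ b ← D ] ∑[ y ← D ] F (Δ a) (Δ x) (Δ b) (Δ y))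
        ≤⟨ ∑-∣-∣ r _ (λ i → ∑-∣-∣ r _ (λ j → ∑-∣-∣ r _ (λ k → ∑-∣-∣ r 1 (λ l → ≤-reflexive (sym (*-identityˡ (F i j k l))))))) ⟩
      16r⁴ * (∑[ i ← R ] ∑[ j ← R ] ∑[ k ← R ] ∑[ l ← R ] F i j k l)
        ≡⟨ cong (16r⁴ *_) (trans (∑-× R R _) (∑-cong R (λ i → ∑-cong R (λ j → ∑-× R R (λ kl → F i j (proj₁ kl) (proj₂ kl)))))) ⟨
      16r⁴ * product-energy r ∎
      where
      open ≤-Reasoning
      F : ℕ → ℕ → ℕ → ℕ → ℕ
      F i j k l = 𝟙 (i * j ≟ k * l)

    private
      Ps = points r
      Hs = planes r

    points-unique : Unique Ps
    points-unique = cartesianProduct⁺ R! (cartesianProduct⁺ R! (upTo⁺ (r * r)))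

    planes-unique : Unique Hs
    planes-unique = cartesianProduct⁺ R! (cartesianProduct⁺ R! (upTo⁺ (height r)))

    private
      Rectangle : (ℕ³ × ℕ³) × (ℕ³ × ℕ³) → Set
      Rectangle ((p , p′) , (h , h′)) = (Incident h p × Incident h p′) × (Incident h′ p × Incident h′ p′)

      rectangle? : ∀ x → Dec (Rectangle x)
      rectangle? ((p , p′) , (h , h′)) = (incident? h p ×-dec incident? h p′) ×-dec (incident? h′ p ×-dec incident? h′ p′)

      Params : Set
      Params = ℕ × ((ℕ² × ℕ²) × (ℕ² × ℕ²))

      Admissible : Params → Set
      Admissible (z , ((a , x) , (b , y))) = Δ a * Δ x ≡ Δ b * Δ y

      admissible? : ∀ y → Dec (Admissible y)
      admissible? (z , ((a , x) , (b , y))) = Δ a * Δ x ≟ Δ b * Δ y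

      -- A rectangle is recovered from z and the four pairs: the offsets are the values of the two
      -- linear forms at the first point, and z′ is solved from the first plane at the second point.
      -- On a rectangle the truncated subtraction is exact.
      φ : Params → (ℕ³ × ℕ³) × (ℕ³ × ℕ³)
      φ (z , (((a , a′) , (x , x′)) , ((b , b′) , (y , y′)))) =
        ((x , (y , z)) , (x′ , (y′ , (a * x + b * y + z) ∸ (a * x′ + b * y′)))) ,
        ((a , (b , a * x + b * y + z)) , (a′ , (b′ , a′ * x + b′ * y + z)))

      parameters : List Params
      parameters = upTo (r * r) ⊗ (D ⊗ D) ⊗ (D ⊗ D)

      determined : ∀ {x} → x ∈ˡ (Ps ⊗ Ps) ⊗ (Hs ⊗ Hs) → Rectangle x → ∃[ y ] y ∈ˡ parameters × Admissible y × φ y ≡ x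
      determined {((x , (y , z)) , (x′ , (y′ , z′))) , ((a , (b , β)) , (a′ , (b′ , β′)))} x∈ ((refl , eq) , (refl , eq′)) =
        (z , (((a , a′) , (x , x′)) , ((b , b′) , (y , y′)))) ,
        ∈-cartesianProduct⁺ z∈ (∈-cartesianProduct⁺ (∈-cartesianProduct⁺ (∈-cartesianProduct⁺ a∈ a′∈) (∈-cartesianProduct⁺ x∈R x′∈))
                                                    (∈-cartesianProduct⁺ (∈-cartesianProduct⁺ b∈ b′∈) (∈-cartesianProduct⁺ y∈ y′∈))) ,
        rectangle-equation {a} {a′} {b} {b′} {x} {x′} {y} {y′} (sym eq) (sym eq′) ,
        cong (λ z′ → ((x , (y , z)) , (x′ , (y′ , z′))) , ((a , (b , β)) , (a′ , (b′ , β′))))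
          (trans (cong (_∸ (a * x′ + b * y′)) (sym eq)) (m+n∸m≡n (a * x′ + b * y′) z′))
        where
        pp = ∈-cartesianProduct⁻ Ps Ps (proj₁ (∈-cartesianProduct⁻ (Ps ⊗ Ps) (Hs ⊗ Hs) x∈))
        hh = ∈-cartesianProduct⁻ Hs Hs (proj₂ (∈-cartesianProduct⁻ (Ps ⊗ Ps) (Hs ⊗ Hs) x∈))
        split : ∀ {n p} → p ∈ˡ R ⊗ R ⊗ upTo n → proj₁ p ∈ˡ R × proj₁ (proj₂ p) ∈ˡ R × proj₂ (proj₂ p) ∈ˡ upTo n
        split {n} p∈ = let u , v = ∈-cartesianProduct⁻ R (R ⊗ upTo n) p∈ in u , ∈-cartesianProduct⁻ R (upTo n) v
        x∈R = proj₁ (split (proj₁ pp))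
        y∈  = proj₁ (proj₂ (split (proj₁ pp)))
        z∈  = proj₂ (proj₂ (split (proj₁ pp)))
        x′∈ = proj₁ (split (proj₂ pp))
        y′∈ = proj₁ (proj₂ (split (proj₂ pp)))
        a∈  = proj₁ (split (proj₁ hh))
        b∈  = proj₁ (proj₂ (split (proj₁ hh)))
        a′∈ = proj₁ (split (proj₂ hh))
        b′∈ = proj₁ (proj₂ (split (proj₂ hh)))

      common-square : ∀ p p′ → common r p p′ * common r p p′ ≡ (∑[ hh ← Hs ⊗ Hs ] 𝟙 (rectangle? ((p , p′) , hh)))
      common-square p p′ = begin
        common r p p′ * common r p p′                     ≡⟨ ∑-∑* Hs Hs _ _ ⟨
        (∑[ h ← Hs ] ∑[ h′ ← Hs ] (𝟙 (incident? h p) * 𝟙 (incident? h p′)) * (𝟙 (incident? h′ p) * 𝟙 (incident? h′ p′)))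
          ≡⟨ ∑-cong Hs (λ h → ∑-cong Hs (λ h′ → cong₂ _*_ (𝟙-× (incident? h p) (incident? h p′)) (𝟙-× (incident? h′ p) (incident? h′ p′)))) ⟨
        (∑[ h ← Hs ] ∑[ h′ ← Hs ] 𝟙 (incident? h p ×-dec incident? h p′) * 𝟙 (incident? h′ p ×-dec incident? h′ p′))
          ≡⟨ ∑-cong Hs (λ h → ∑-cong Hs (λ h′ → 𝟙-× (incident? h p ×-dec incident? h p′) (incident? h′ p ×-dec incident? h′ p′))) ⟨
        (∑[ h ← Hs ] ∑[ h′ ← Hs ] 𝟙 (rectangle? ((p , p′) , (h , h′))))
          ≡⟨ ∑-× Hs Hs _ ⟨
        (∑[ hh ← Hs ⊗ Hs ] 𝟙 (rectangle? ((p , p′) , hh))) ∎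
        where open ≡-Reasoning

    rectangles≤differences : rectangles r ≤ r * r * (16r⁴ * product-energy r)
    rectangles≤differences = begin
      rectangles r
        ≡⟨ ∑-× Ps Ps (λ pp → common r (proj₁ pp) (proj₂ pp) * common r (proj₁ pp) (proj₂ pp)) ⟨
      (∑[ pp ← Ps ⊗ Ps ] common r (proj₁ pp) (proj₂ pp) * common r (proj₁ pp) (proj₂ pp))
        ≡⟨ ∑-cong (Ps ⊗ Ps) (λ pp → common-square (proj₁ pp) (proj₂ pp)) ⟩
      (∑[ pp ← Ps ⊗ Ps ] ∑[ hh ← Hs ⊗ Hs ] 𝟙 (rectangle? (pp , hh)))
        ≡⟨ ∑-× (Ps ⊗ Ps) (Hs ⊗ Hs) _ ⟨
      (∑[ x ← (Ps ⊗ Ps) ⊗ (Hs ⊗ Hs) ] 𝟙 (rectangle? x))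
        ≤⟨ ∑-cover (≡-dec (≡-dec _≟³_ _≟³_) (≡-dec _≟³_ _≟³_)) (cartesianProduct⁺ (cartesianProduct⁺ points-unique points-unique) (cartesianProduct⁺ planes-unique planes-unique))
             rectangle? parameters admissible? φ determined ⟩
      (∑[ y ← parameters ] 𝟙 (admissible? y))
        ≡⟨ ∑-× (upTo (r * r)) ((D ⊗ D) ⊗ (D ⊗ D)) _ ⟩
      (∑[ z ← upTo (r * r) ] ∑[ t ← (D ⊗ D) ⊗ (D ⊗ D) ] 𝟙 (admissible? (z , t)))
        ≡⟨ ∑-cong (upTo (r * r)) (λ z → trans (∑-× (D ⊗ D) (D ⊗ D) _) (trans (∑-× D D _)
             (∑-cong D (λ a → ∑-cong D (λ x → ∑-× D D _))))) ⟩
      (∑[ z ← upTo (r * r) ] ∑[ a ← D ] ∑[ x ← D ] ∑[ b ← D ] ∑[ y ← D ] 𝟙 (Δ a * Δ x ≟ Δ b * Δ y))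
        ≡⟨ ∑-upTo-const (r * r) _ ⟩
      r * r * (∑[ a ← D ] ∑[ x ← D ] ∑[ b ← D ] ∑[ y ← D ] 𝟙 (Δ a * Δ x ≟ Δ b * Δ y))
        ≤⟨ *-monoʳ-≤ (r * r) differences≤ ⟩
      r * r * (16r⁴ * product-energy r) ∎
      where open ≤-Reasoning

    r⁶ : ℕ
    r⁶ = r * (r * (r * r)) * (r * r)

    -- Each of the r⁴ points lies on one plane for each of the r² slopes (a, b); `height` leaves
    -- room for its offset.
    r⁶≤incidences : r⁶ ≤ incidences r
    r⁶≤incidences = begin
      r * (r * (r * r)) * (r * r)
        ≡⟨ cong (_* (r * r)) (trans (cong (r *_) (trans (cong (r *_) (sym (∑-upTo-const′ (r * r)))) (sym (∑-upTo-const r _)))) (sym (∑-upTo-const r _))) ⟩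
      (∑[ x ← R ] ∑[ y ← R ] ∑[ z ← upTo (r * r) ] 1) * (r * r)
        ≡⟨ cong (_* (r * r)) (trans (∑-× R (R ⊗ upTo (r * r)) _) (∑-cong R (λ x → ∑-× R (upTo (r * r)) _))) ⟨
      (∑[ p ← Ps ] 1) * (r * r)
        ≡⟨ ∑-*ʳ Ps (λ _ → 1) (r * r) ⟨
      (∑[ p ← Ps ] 1 * (r * r))
        ≤⟨ ∑-mono-∈ Ps (λ {p} p∈ → ≤-trans (≤-reflexive (*-identityˡ (r * r))) (degree p p∈)) ⟩
      incidences r ∎
      where
      open ≤-Reasoning
      ∑-upTo-const′ : ∀ n → (∑[ z ← upTo n ] 1) ≡ n
      ∑-upTo-const′ n = trans (∑-upTo-const n 1) (*-identityʳ n)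
      degree : ∀ p → p ∈ˡ Ps → r * r ≤ common r p p
      degree p@(x , (y , z)) p∈ = begin
        r * r                             ≡⟨ cong (r *_) (∑-upTo-const′ r) ⟨
        r * (∑[ b ← R ] 1)                ≡⟨ ∑-upTo-const r _ ⟨
        (∑[ a ← R ] ∑[ b ← R ] 1)         ≤⟨ ∑-mono-∈ R (λ {a} a∈ → ∑-mono-∈ R (λ {b} b∈ → one-plane a b (∈-upTo⁻ a∈) (∈-upTo⁻ b∈))) ⟩
        (∑[ a ← R ] ∑[ b ← R ] ∑[ β ← upTo (height r) ] f (a , (b , β)))
                                          ≡⟨ trans (∑-× R (R ⊗ upTo (height r)) _) (∑-cong R (λ a → ∑-× R (upTo (height r)) _)) ⟨
        common r p p                      ∎
        where
        f : ℕ³ → ℕ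
        f h = 𝟙 (incident? h p) * 𝟙 (incident? h p)
        xyz∈ = ∈-cartesianProduct⁻ R (R ⊗ upTo (r * r)) p∈
        yz∈  = ∈-cartesianProduct⁻ R (upTo (r * r)) (proj₂ xyz∈)
        x< = ∈-upTo⁻ (proj₁ xyz∈)
        y< = ∈-upTo⁻ (proj₁ yz∈)
        z< = ∈-upTo⁻ (proj₂ yz∈)
        one-plane : ∀ a b → a < r → b < r → 1 ≤ (∑[ β ← upTo (height r) ] f (a , (b , β)))
        one-plane a b a< b< = ≤-trans
          (*-mono-≤ (𝟙-true (incident? (a , (b , a * x + b * y + z)) p) refl) (𝟙-true (incident? (a , (b , a * x + b * y + z)) p) refl))
          (∈⇒≤∑ (λ β → f (a , (b , β))) (∈-upTo⁺ (+-mono-≤-< (+-mono-≤ (*-mono-≤ (<⇒≤pred a<) (<⇒≤pred x<)) (*-mono-≤ (<⇒≤pred b<) (<⇒≤pred y<))) z<)))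

  -- The constant is 96 = 16 · 6, with 16 from the passage to differences and 6 from
  -- `product-energy≤`. Six of the factors r are exchanged for `incidences`, which gives the form ∑
  -- σ⁴ ≤ λ ∑ σ² and thereby fixes λ.
  rectangles≤ : ∀ k → rectangles (2 ^ k) ≤ 96 * (suc k * (2 ^ k * 2 ^ k)) * incidences (2 ^ k)
  rectangles≤ k = begin
    rectangles r
      ≤⟨ rectangles≤differences r ⟩
    r * r * (2 * r * (2 * r * (2 * r * (2 * r * 1))) * product-energy r)
      ≤⟨ *-monoʳ-≤ (r * r) (*-monoʳ-≤ (2 * r * (2 * r * (2 * r * (2 * r * 1)))) (product-energy≤ k)) ⟩
    r * r * (2 * r * (2 * r * (2 * r * (2 * r * 1))) * (6 * (suc k * (r * r))))
      ≡⟨ solve 2 (λ r κ → r :* r :* (con 2 :* r :* (con 2 :* r :* (con 2 :* r :* (con 2 :* r :* con 1))) :* (con 6 :* (κ :* (r :* r))))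
                          := con 96 :* (κ :* (r :* r)) :* (r :* (r :* (r :* r)) :* (r :* r))) refl r (suc k) ⟩
    96 * (suc k * (r * r)) * r⁶ r
      ≤⟨ *-monoʳ-≤ (96 * (suc k * (r * r))) (r⁶≤incidences r) ⟩
    96 * (suc k * (r * r)) * incidences r ∎
    where
    open ≤-Reasoning
    open +-*-Solver
    r = 2 ^ k

  length-⊗ : ∀ (xs : List A) (ys : List B) → length (xs ⊗ ys) ≡ length xs * length ys
  length-⊗ xs ys = begin
    length (xs ⊗ ys)              ≡⟨ *-identityʳ _ ⟨
    length (xs ⊗ ys) * 1          ≡⟨ ∑-const (xs ⊗ ys) 1 ⟨
    (∑[ p ← xs ⊗ ys ] 1)          ≡⟨ ∑-× xs ys _ ⟩
    (∑[ x ← xs ] ∑[ y ← ys ] 1)   ≡⟨ ∑-const xs _ ⟩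
    length xs * (∑[ y ← ys ] 1)   ≡⟨ cong (length xs *_) (trans (∑-const ys 1) (*-identityʳ _)) ⟩
    length xs * length ys         ∎
    where open ≡-Reasoning

  length-box : ∀ r m → length (upTo r ⊗ upTo r ⊗ upTo m) ≡ r * (r * m)
  length-box r m = trans (length-⊗ (upTo r) (upTo r ⊗ upTo m))
    (cong₂ _*_ (length-upTo r) (trans (length-⊗ (upTo r) (upTo m)) (cong₂ _*_ (length-upTo r) (length-upTo m))))

  height≤ : ∀ r → height r ≤ 3 * (r * r)
  height≤ r = begin
    pred r * pred r + pred r * pred r + r * r  ≤⟨ +-monoˡ-≤ (r * r) (+-mono-≤ p²≤ p²≤) ⟩
    r * r + r * r + r * r                      ≡⟨ solve 1 (λ s → s :+ s :+ s := con 3 :* s) refl (r * r) ⟩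
    3 * (r * r)                                ∎
    where
    open ≤-Reasoning
    open +-*-Solver
    p²≤ = *-mono-≤ (pred[n]≤n {r}) (pred[n]≤n {r})

-- Rational linear algebra and the regularised inverse.

module LinearAlgebra where
  open import Algebra.Bundles using (CommutativeRing)
  open import Data.Fin.Base using (Fin; zero; suc)
  open import Data.Nat.Base using (ℕ; zero; suc)
  open import Data.Product.Base using (_,_; proj₁; proj₂; Σ-syntax)
  open import Data.Rational.Base as ℚ using (ℚ; 0ℚ; 1ℚ; _+_; _*_; _-_; -_; _≤_; _<_; ∣_∣; 1/_)
  open import Data.Rational.Properties
  open import Data.Rational.Solver using (module +-*-Solver)
  open import Data.Sum.Base using (inj₁; inj₂)
  open import Data.Vec.Functional using (Vector)
  open import Function.Base using (_∘_)
  open import Relation.Binary.PropositionalEquality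
  open import Relation.Nullary using (yes; no)
  import Algebra.Properties.Semiring.Sum (CommutativeRing.semiring +-*-commutativeRing) as Sum
  open Sum public using (sum)
  open +-*-Solver

  private
    variable
      m n k : ℕ

  Σ-cong : {f g : Vector ℚ n} → (∀ i → f i ≡ g i) → sum f ≡ sum g
  Σ-cong = Sum.sum-cong-≗

  Σ-+ : (f g : Vector ℚ n) → sum (λ i → f i + g i) ≡ sum f + sum g
  Σ-+ = Sum.∑-distrib-+

  Σ-* : ∀ c (f : Vector ℚ n) → sum (λ i → c * f i) ≡ c * sum f
  Σ-* c f = sym (Sum.*-distribˡ-sum c f)

  Σ-lin : ∀ (f g : Vector ℚ n) c → sum (λ i → f i - c * g i) ≡ sum f - c * sum g
  Σ-lin f g c = trans (Σ-+ f (λ i → - (c * g i))) (cong (sum f +_)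
    (trans (Σ-cong (λ i → neg-distribˡ-* c (g i))) (trans (Σ-* (- c) g) (sym (neg-distribˡ-* c (sum g))))))

  Σ-swap : (f : Fin m → Fin n → ℚ) → sum (λ i → sum (λ j → f i j)) ≡ sum (λ j → sum (λ i → f i j))
  Σ-swap = Sum.∑-comm

  Σ-mono : {f g : Vector ℚ n} → (∀ i → f i ≤ g i) → sum f ≤ sum g
  Σ-mono {zero}  h = ≤-refl
  Σ-mono {suc n} h = +-mono-≤ (h zero) (Σ-mono (h ∘ suc))

  Σ-nonNeg : {f : Vector ℚ n} → (∀ i → 0ℚ ≤ f i) → 0ℚ ≤ sum f
  Σ-nonNeg {zero}  h = ≤-refl
  Σ-nonNeg {suc n} h = nonNeg-+ (h zero) (Σ-nonNeg (h ∘ suc))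

  square-nonNeg : ∀ p → 0ℚ ≤ p * p
  square-nonNeg p with ≤-total 0ℚ p
  ... | inj₁ 0≤p = nonNeg-* 0≤p 0≤p
  ... | inj₂ p≤0 = subst (0ℚ ≤_) (solve 1 (λ p → (:- p) :* (:- p) := p :* p) refl p)
                         (nonNeg-* (neg-antimono-≤ p≤0) (neg-antimono-≤ p≤0))

  0≤q-p⇒p≤q : ∀ {p q} → 0ℚ ≤ q - p → p ≤ q
  0≤q-p⇒p≤q {p} {q} h = subst (p ≤_) (+-sub q p) (p≤p+q p h)

  p≤q⇒0≤q-p : ∀ {p q} → p ≤ q → 0ℚ ≤ q - p
  p≤q⇒0≤q-p {p} {q} h = subst (_≤ q - p) (+-inverseʳ p) (+-monoˡ-≤ (- p) h)

  dot : Vector ℚ n → Vector ℚ n → ℚ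
  dot u v = sum (λ i → u i * v i)

  dot-comm : (u v : Vector ℚ n) → dot u v ≡ dot v u
  dot-comm u v = Σ-cong (λ i → *-comm (u i) (v i))

  dot-nonNeg : (u : Vector ℚ n) → 0ℚ ≤ dot u u
  dot-nonNeg u = Σ-nonNeg (λ i → square-nonNeg (u i))

  dot-linˡ : ∀ (u v w : Vector ℚ n) c → dot (λ i → u i - c * v i) w ≡ dot u w - c * dot v w
  dot-linˡ u v w c = trans (Σ-cong (λ i → solve 4 (λ u v w c → (u :- c :* v) :* w := u :* w :- c :* (v :* w)) refl (u i) (v i) (w i) c))
                           (Σ-lin (λ i → u i * w i) (λ i → v i * w i) c)

  dot-linʳ : ∀ (w u v : Vector ℚ n) c → dot w (λ i → u i - c * v i) ≡ dot w u - c * dot w v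
  dot-linʳ w u v c = trans (dot-comm w _) (trans (dot-linˡ u v w c) (cong₂ (λ s t → s - c * t) (dot-comm u w) (dot-comm v w)))

  dot-Σʳ : ∀ (w : Vector ℚ m) (c : Vector ℚ n) (v : Fin n → Vector ℚ m) →
           dot w (λ i → sum (λ j → c j * v j i)) ≡ sum (λ j → c j * dot (v j) w)
  dot-Σʳ w c v = begin
    sum (λ i → w i * sum (λ j → c j * v j i))    ≡⟨ Σ-cong (λ i → Σ-* (w i) (λ j → c j * v j i)) ⟨
    sum (λ i → sum (λ j → w i * (c j * v j i)))  ≡⟨ Σ-swap (λ i j → w i * (c j * v j i)) ⟩
    sum (λ j → sum (λ i → w i * (c j * v j i)))  ≡⟨ Σ-cong (λ j → trans (Σ-cong (λ i → solve 3 (λ w c v → w :* (c :* v) := c :* (v :* w)) refl (w i) (c j) (v j i)))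
                                                                        (Σ-* (c j) (λ i → v j i * w i))) ⟩
    sum (λ j → c j * dot (v j) w)                ∎
    where open ≡-Reasoning

  cancel-nonNeg : ∀ {c p} → 0ℚ < c → 0ℚ ≤ c * p → 0ℚ ≤ p
  cancel-nonNeg {c} {p} 0<c 0≤cp = *-cancelˡ-≤-pos c {{ℚ.positive 0<c}} (subst (_≤ c * p) (sym (*-zeroʳ c)) 0≤cp)

  -- The form is homogeneous in s and t, so its critical direction can be taken as (T, A) or (B, T)
  -- without a division. If A = B = 0, its values at s = 1, t = ±½ are ∓T and force T = 0.
  discriminant : ∀ {A B T} → 0ℚ ≤ A → 0ℚ ≤ B →
                 (∀ s t → 0ℚ ≤ s * s * A - (s * t * T + s * t * T) + t * t * B) → T * T ≤ A * B
  discriminant {A} {B} {T} 0≤A 0≤B h with 0ℚ <? A | 0ℚ <? B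
  ... | yes 0<A | _ = 0≤q-p⇒p≤q (cancel-nonNeg 0<A (subst (0ℚ ≤_)
        (solve 3 (λ A B T → T :* T :* A :- (T :* A :* T :+ T :* A :* T) :+ A :* A :* B := A :* (A :* B :- T :* T)) refl A B T) (h T A)))
  ... | no _ | yes 0<B = 0≤q-p⇒p≤q (cancel-nonNeg 0<B (subst (0ℚ ≤_)
        (solve 3 (λ A B T → B :* B :* A :- (B :* T :* T :+ B :* T :* T) :+ T :* T :* B := B :* (A :* B :- T :* T)) refl A B T) (h B T)))
  ... | no 0≮A | no 0≮B = ≤-reflexive (trans (cong (_* T) T≡0) (trans (*-zeroˡ T) (sym (trans (cong (_* B) A≡0) (*-zeroˡ B)))))
    where
    A≡0 : A ≡ 0ℚ
    A≡0 = ≤-antisym (≮⇒≥ 0≮A) 0≤A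
    B≡0 : B ≡ 0ℚ
    B≡0 = ≤-antisym (≮⇒≥ 0≮B) 0≤B
    h₀ : ∀ t → 0ℚ ≤ 1ℚ * 1ℚ * 0ℚ - (1ℚ * t * T + 1ℚ * t * T) + t * t * 0ℚ
    h₀ t = subst₂ (λ a b → 0ℚ ≤ 1ℚ * 1ℚ * a - (1ℚ * t * T + 1ℚ * t * T) + t * t * b) A≡0 B≡0 (h 1ℚ t)
    0≤T : 0ℚ ≤ T
    0≤T = subst (0ℚ ≤_) (solve 1 (λ T → con 1ℚ :* con 1ℚ :* con 0ℚ :- (con 1ℚ :* con (- ℚ.½) :* T :+ con 1ℚ :* con (- ℚ.½) :* T) :+ con (- ℚ.½) :* con (- ℚ.½) :* con 0ℚ := T) refl T) (h₀ (- ℚ.½))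
    0≤-T : 0ℚ ≤ 0ℚ - T
    0≤-T = subst (0ℚ ≤_) (solve 1 (λ T → con 1ℚ :* con 1ℚ :* con 0ℚ :- (con 1ℚ :* con ℚ.½ :* T :+ con 1ℚ :* con ℚ.½ :* T) :+ con ℚ.½ :* con ℚ.½ :* con 0ℚ := con 0ℚ :- T) refl T) (h₀ ℚ.½)
    T≡0 : T ≡ 0ℚ
    T≡0 = ≤-antisym (0≤q-p⇒p≤q 0≤-T) 0≤T

  Σ-quadratic : ∀ (f g h : Vector ℚ n) a b c →
    sum (λ i → a * f i - (b * g i + b * g i) + c * h i) ≡ a * sum f - (b * sum g + b * sum g) + c * sum h
  Σ-quadratic f g h a b c = begin
    sum (λ i → a * f i - (b * g i + b * g i) + c * h i)
      ≡⟨ Σ-cong (λ i → solve 6 (λ a f b g c h → a :* f :- (b :* g :+ b :* g) :+ c :* h := (a :* f :+ c :* h) :- (b :+ b) :* g) refl a (f i) b (g i) c (h i)) ⟩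
    sum (λ i → (a * f i + c * h i) - (b + b) * g i)
      ≡⟨ Σ-lin (λ i → a * f i + c * h i) g (b + b) ⟩
    sum (λ i → a * f i + c * h i) - (b + b) * sum g
      ≡⟨ cong (_- (b + b) * sum g) (trans (Σ-+ (λ i → a * f i) (λ i → c * h i)) (cong₂ _+_ (Σ-* a f) (Σ-* c h))) ⟩
    (a * sum f + c * sum h) - (b + b) * sum g
      ≡⟨ solve 6 (λ a f b g c h → a :* f :- (b :* g :+ b :* g) :+ c :* h := (a :* f :+ c :* h) :- (b :+ b) :* g) refl a (sum f) b (sum g) c (sum h) ⟨
    a * sum f - (b * sum g + b * sum g) + c * sum h ∎
    where open ≡-Reasoning

  -- Cauchy-Schwarz for the Frobenius inner product, from the nonnegativity of the sum of the
  -- squared norms of s u - t w over the family.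
  cauchy-schwarz : ∀ (u w : Fin k → Vector ℚ m) → let T = sum (λ l → dot (u l) (w l)) in
    T * T ≤ sum (λ l → dot (u l) (u l)) * sum (λ l → dot (w l) (w l))
  cauchy-schwarz u w = discriminant (Σ-nonNeg (λ l → dot-nonNeg (u l))) (Σ-nonNeg (λ l → dot-nonNeg (w l)))
    λ s t → subst (0ℚ ≤_) (trans (Σ-cong (λ l → expand s t (u l) (w l)))
                                 (Σ-quadratic (λ l → dot (u l) (u l)) (λ l → dot (u l) (w l)) (λ l → dot (w l) (w l)) (s * s) (s * t) (t * t)))
                          (Σ-nonNeg (λ l → dot-nonNeg (λ i → s * u l i - t * w l i)))
    where
    expand : ∀ s t (x y : Vector ℚ n) → dot (λ i → s * x i - t * y i) (λ i → s * x i - t * y i)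
             ≡ s * s * dot x x - (s * t * dot x y + s * t * dot x y) + t * t * dot y y
    expand s t x y = trans
      (Σ-cong (λ i → solve 4 (λ s t x y → (s :* x :- t :* y) :* (s :* x :- t :* y)
                        := s :* s :* (x :* x) :- (s :* t :* (x :* y) :+ s :* t :* (x :* y)) :+ t :* t :* (y :* y)) refl s t (x i) (y i)))
      (Σ-quadratic (λ i → x i * x i) (λ i → x i * y i) (λ i → y i * y i) (s * s) (s * t) (t * t))

  4ℚ : ℚ
  4ℚ = 1ℚ + 1ℚ + 1ℚ + 1ℚ

  module Regularised (lam : ℚ) (0<lam : 0ℚ < lam) where

    -- λ + M Mᵀ for the matrix with columns M j.
    G : (Fin n → Vector ℚ m) → Vector ℚ m → Vector ℚ m
    G M w i = lam * w i + sum (λ j → dot (M j) w * M j i)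

    G-lin : ∀ (M : Fin n → Vector ℚ m) v w c i → G M (λ i → v i - c * w i) i ≡ G M v i - c * G M w i
    G-lin M v w c i = begin
      lam * (v i - c * w i) + sum (λ j → dot (M j) (λ i → v i - c * w i) * M j i)
        ≡⟨ cong (lam * (v i - c * w i) +_) (trans
             (Σ-cong (λ j → trans (cong (_* M j i) (dot-linʳ (M j) v w c))
               (solve 4 (λ a b c x → (a :- c :* b) :* x := a :* x :- c :* (b :* x)) refl (dot (M j) v) (dot (M j) w) c (M j i))))
             (Σ-lin (λ j → dot (M j) v * M j i) (λ j → dot (M j) w * M j i) c)) ⟩
      lam * (v i - c * w i) + (sum (λ j → dot (M j) v * M j i) - c * sum (λ j → dot (M j) w * M j i))
        ≡⟨ solve 6 (λ l v w c s t → l :* (v :- c :* w) :+ (s :- c :* t) := (l :* v :+ s) :- c :* (l :* w :+ t)) refl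
             lam (v i) (w i) c (sum (λ j → dot (M j) v * M j i)) (sum (λ j → dot (M j) w * M j i)) ⟩
      G M v i - c * G M w i ∎
      where open ≡-Reasoning

    dot-G : ∀ (M : Fin n → Vector ℚ m) v w → dot v (G M w) ≡ lam * dot v w + sum (λ j → dot (M j) w * dot (M j) v)
    dot-G M v w = begin
      sum (λ i → v i * (lam * w i + S i))
        ≡⟨ Σ-cong (λ i → solve 4 (λ v l w s → v :* (l :* w :+ s) := l :* (v :* w) :+ v :* s) refl (v i) lam (w i) (S i)) ⟩
      sum (λ i → lam * (v i * w i) + v i * S i)
        ≡⟨ Σ-+ (λ i → lam * (v i * w i)) (λ i → v i * S i) ⟩
      sum (λ i → lam * (v i * w i)) + dot v S
        ≡⟨ cong₂ _+_ (Σ-* lam (λ i → v i * w i)) (dot-Σʳ v (λ j → dot (M j) w) M) ⟩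
      lam * dot v w + sum (λ j → dot (M j) w * dot (M j) v) ∎
      where
      open ≡-Reasoning
      S = λ i → sum (λ j → dot (M j) w * M j i)

    dot-G-nonNeg : ∀ (M : Fin n → Vector ℚ m) v → 0ℚ ≤ dot v (G M v)
    dot-G-nonNeg M v = subst (0ℚ ≤_) (sym (dot-G M v v))
      (nonNeg-+ (nonNeg-* (<⇒≤ 0<lam) (dot-nonNeg v)) (Σ-nonNeg (λ j → square-nonNeg (dot (M j) v))))

    dot-G-sym : ∀ (M : Fin n → Vector ℚ m) v w → dot v (G M w) ≡ dot w (G M v)
    dot-G-sym M v w = trans (dot-G M v w) (trans
      (cong₂ (λ s t → lam * s + t) (dot-comm v w) (Σ-cong (λ j → *-comm (dot (M j) w) (dot (M j) v))))
      (sym (dot-G M w v)))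

    -- Adding a column is a rank-one update, inverted by the Sherman–Morrison formula.
    G-surjective : ∀ (M : Fin n → Vector ℚ m) (v : Vector ℚ m) → Σ[ w ∈ Vector ℚ m ] (∀ i → G M w i ≡ v i)
    G-surjective {zero} M v = (λ i → 1/ lam * v i) , λ i → trans (+-identityʳ _)
      (trans (sym (*-assoc lam (1/ lam) (v i))) (trans (cong (_* v i) (*-inverseʳ lam)) (*-identityˡ (v i))))
      where
      instance
        lam≢0 : ℚ.NonZero lam
        lam≢0 = pos⇒nonZero lam {{ℚ.positive 0<lam}}
    G-surjective {suc n} M v = (λ i → p i - s * z i) , λ i → begin
      lam * (p i - s * z i) + (dot M₀ (λ i → p i - s * z i) * M₀ i + rest (λ i → p i - s * z i) i)
        ≡⟨ solve 3 (λ a b c → a :+ (b :+ c) := b :+ (a :+ c)) refl (lam * (p i - s * z i)) (dot M₀ (λ i → p i - s * z i) * M₀ i) (rest (λ i → p i - s * z i) i) ⟩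
      dot M₀ (λ i → p i - s * z i) * M₀ i + G M′ (λ i → p i - s * z i) i
        ≡⟨ cong₂ (λ a b → a * M₀ i + b) (dot-linʳ M₀ p z s) (trans (G-lin M′ p z s i) (cong₂ (λ a b → a - s * b) (Gp i) (Gz i))) ⟩
      (dot M₀ p - s * d) * M₀ i + (v i - s * M₀ i)
        ≡⟨ cong (λ t → (t - s * d) * M₀ i + (v i - s * M₀ i)) s-eq ⟨
      ((1ℚ + d) * s - s * d) * M₀ i + (v i - s * M₀ i)
        ≡⟨ solve 4 (λ d s x v → ((con 1ℚ :+ d) :* s :- s :* d) :* x :+ (v :- s :* x) := v) refl d s (M₀ i) (v i) ⟩
      v i ∎
      where
      open ≡-Reasoning
      M₀ = M zero
      M′ = M ∘ suc
      p = proj₁ (G-surjective M′ v)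
      Gp = proj₂ (G-surjective M′ v)
      z = proj₁ (G-surjective M′ M₀)
      Gz = proj₂ (G-surjective M′ M₀)
      rest = λ w i → sum (λ j → dot (M′ j) w * M′ j i)
      d = dot M₀ z
      -- With G′ the operator of the remaining columns, d = ⟨M₀, z⟩ = ⟨z, G′ z⟩ is nonnegative, so
      -- the Sherman-Morrison denominator 1 + d cannot vanish.
      0≤d : 0ℚ ≤ d
      0≤d = subst (0ℚ ≤_) (trans (Σ-cong (λ i → cong (z i *_) (Gz i))) (dot-comm z M₀)) (dot-G-nonNeg M′ z)
      0<1+d : 0ℚ < 1ℚ + d
      0<1+d = <-≤-trans 0<1 (p≤p+q 1ℚ 0≤d)
      instance
        1+d≢0 : ℚ.NonZero (1ℚ + d)
        1+d≢0 = pos⇒nonZero (1ℚ + d) {{ℚ.positive 0<1+d}}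
      s = 1/ (1ℚ + d) * dot M₀ p
      s-eq : (1ℚ + d) * s ≡ dot M₀ p
      s-eq = trans (sym (*-assoc (1ℚ + d) (1/ (1ℚ + d)) (dot M₀ p))) (trans (cong (_* dot M₀ p) (*-inverseʳ (1ℚ + d))) (*-identityˡ (dot M₀ p)))

    module _ (M : Fin n → Vector ℚ m) where

      q : Fin n → Vector ℚ m
      q j = proj₁ (G-surjective M (M j))

      Gq : ∀ j i → G M (q j) i ≡ M j i
      Gq j = proj₂ (G-surjective M (M j))


      combination : Vector ℚ n → Vector ℚ m
      combination c i = sum (λ j → c j * q j i)

      -- With w = Σⱼ cⱼ qⱼ and x = Mᵀ w: λ |w|² = ⟨c, x⟩ - |x|² ≤ |c|² / 4.
      combination-bound : ∀ c → 4ℚ * lam * dot (combination c) (combination c) ≤ dot c c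
      combination-bound c = begin
        4ℚ * lam * dot w w
          ≡⟨ solve 3 (λ l w x → con 4ℚ :* l :* w := con 4ℚ :* (l :* w :+ x) :- con 4ℚ :* x) refl lam (dot w w) (dot x x) ⟩
        4ℚ * (lam * dot w w + dot x x) - 4ℚ * dot x x
          ≡⟨ cong (λ t → 4ℚ * t - 4ℚ * dot x x) energy ⟩
        4ℚ * dot c x - 4ℚ * dot x x
          ≡⟨ cong (_- 4ℚ * dot x x) (Σ-* 4ℚ (λ j → c j * x j)) ⟨
        sum (λ j → 4ℚ * (c j * x j)) - 4ℚ * dot x x
          ≡⟨ Σ-lin (λ j → 4ℚ * (c j * x j)) (λ j → x j * x j) 4ℚ ⟨
        sum (λ j → 4ℚ * (c j * x j) - 4ℚ * (x j * x j))
          ≤⟨ Σ-mono (λ j → 0≤q-p⇒p≤q (subst (0ℚ ≤_)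
               (solve 2 (λ c x → (c :- (x :+ x)) :* (c :- (x :+ x)) := c :* c :- (con 4ℚ :* (c :* x) :- con 4ℚ :* (x :* x))) refl (c j) (x j))
               (square-nonNeg (c j - (x j + x j))))) ⟩
        dot c c ∎
        where
        open ≤-Reasoning
        w = combination c
        x : Vector ℚ n
        x j = dot (M j) w
        -- Both sides are ⟨w, G w⟩: by symmetry G moves from w to each qⱼ, where it returns Mⱼ.
        energy : lam * dot w w + dot x x ≡ dot c x
        energy = begin-equality
          lam * dot w w + dot x x                  ≡⟨ dot-G M w w ⟨
          dot w (G M w)                            ≡⟨ dot-comm w (G M w) ⟩
          dot (G M w) w                            ≡⟨ dot-Σʳ (G M w) c q ⟩
          sum (λ j → c j * dot (q j) (G M w))      ≡⟨ Σ-cong (λ j → cong (c j *_) (trans (dot-G-sym M (q j) w)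
                                                        (trans (Σ-cong (λ i → cong (w i *_) (Gq j i))) (dot-comm w (M j))))) ⟩
          dot c x                                  ∎

      -- The energy ⟨y, G y⟩ of y = qⱼ - τ Mⱼ is nonnegative.
      alignment-bound : ∀ τ → 0ℚ ≤ τ → (τ + τ) * lam ≡ 1ℚ →
        sum (λ j → sum (λ j′ → dot (M j′) (M j) * dot (M j′) (M j))) ≤ lam * sum (λ j → dot (M j) (M j)) →
        τ * sum (λ j → dot (M j) (M j)) ≤ sum (λ j → dot (q j) (M j))
      alignment-bound τ 0≤τ 2τλ≡1 S≤λI = 0≤q-p⇒p≤q (begin
        0ℚ
          ≡⟨ trans (cong (λ t → τ * (I - t * I)) 2τλ≡1) (solve 2 (λ τ I → τ :* (I :- con 1ℚ :* I) := con 0ℚ) refl τ I) ⟨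
        -- In terms of singular values this is the tangent bound 1 / x ≥ 2 τ - τ² x at x = λ + σ²,
        -- weighted by σ². The point of contact is 1 / τ = 2 λ; this τ maximises 2 τ I - 2 λ τ² I,
        -- the lower bound that results for D.
        τ * (I - (τ + τ) * lam * I)
          ≡⟨ solve 3 (λ τ l I → τ :* (I :- (τ :+ τ) :* l :* I) := τ :* (I :- τ :* (l :* I :+ l :* I))) refl τ lam I ⟩
        τ * (I - τ * (lam * I + lam * I))
          ≤⟨ *-monoˡ-≤-nonNeg τ {{ℚ.nonNegative 0≤τ}} (+-monoʳ-≤ I (neg-antimono-≤ (*-monoˡ-≤-nonNeg τ {{ℚ.nonNegative 0≤τ}} (+-monoʳ-≤ (lam * I) S≤λI)))) ⟩
        τ * (I - τ * (lam * I + S))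
          ≡⟨ solve 4 (λ D τ I X → τ :* (I :- τ :* X) := (D :- τ :* I) :- ((D :- τ :* I) :- τ :* (I :- τ :* X))) refl D τ I (lam * I + S) ⟩
        (D - τ * I) - ((D - τ * I) - τ * (I - τ * (lam * I + S)))
          ≤⟨ +-monoʳ-≤ (D - τ * I) (neg-antimono-≤ (subst (0ℚ ≤_) total (Σ-nonNeg (λ j → dot-G-nonNeg M (y j))))) ⟩
        (D - τ * I) - 0ℚ
          ≡⟨ +-identityʳ (D - τ * I) ⟩
        D - τ * I ∎)
        where
        open ≤-Reasoning
        I = sum (λ j → dot (M j) (M j))
        S = sum (λ j → sum (λ j′ → dot (M j′) (M j) * dot (M j′) (M j)))
        D = sum (λ j → dot (q j) (M j))
        y : Fin n → Vector ℚ m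
        y j i = q j i - τ * M j i
        s : Vector ℚ n
        s j = sum (λ j′ → dot (M j′) (M j) * dot (M j′) (M j))
        expand : ∀ j → dot (y j) (G M (y j)) ≡
          (dot (q j) (M j) - τ * dot (M j) (M j)) - τ * (dot (M j) (M j) - τ * (lam * dot (M j) (M j) + s j))
        expand j = begin-equality
          dot (y j) (G M (y j))
            ≡⟨ Σ-cong (λ i → cong (y j i *_) (trans (G-lin M (q j) (M j) τ i) (cong (_- τ * G M (M j) i) (Gq j i)))) ⟩
          dot (y j) (λ i → M j i - τ * G M (M j) i)
            ≡⟨ dot-linʳ (y j) (M j) (G M (M j)) τ ⟩
          dot (y j) (M j) - τ * dot (y j) (G M (M j))
            ≡⟨ cong₂ (λ a b → a - τ * b) (dot-linˡ (q j) (M j) (M j) τ) (dot-linˡ (q j) (M j) (G M (M j)) τ) ⟩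
          (dot (q j) (M j) - τ * dot (M j) (M j)) - τ * (dot (q j) (G M (M j)) - τ * dot (M j) (G M (M j)))
            ≡⟨ cong₂ (λ a b → (dot (q j) (M j) - τ * dot (M j) (M j)) - τ * (a - τ * b))
                     (trans (dot-G-sym M (q j) (M j)) (Σ-cong (λ i → cong (M j i *_) (Gq j i)))) (dot-G M (M j) (M j)) ⟩
          (dot (q j) (M j) - τ * dot (M j) (M j)) - τ * (dot (M j) (M j) - τ * (lam * dot (M j) (M j) + s j)) ∎
        total : sum (λ j → dot (y j) (G M (y j))) ≡ (D - τ * I) - τ * (I - τ * (lam * I + S))
        total = begin-equality
          sum (λ j → dot (y j) (G M (y j)))
            ≡⟨ Σ-cong expand ⟩
          sum (λ j → (e j - τ * i j) - τ * (i j - τ * (lam * i j + s j)))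
            ≡⟨ Σ-lin (λ j → e j - τ * i j) (λ j → i j - τ * (lam * i j + s j)) τ ⟩
          sum (λ j → e j - τ * i j) - τ * sum (λ j → i j - τ * (lam * i j + s j))
            ≡⟨ cong₂ (λ a b → a - τ * b) (Σ-lin e i τ) (trans (Σ-lin i (λ j → lam * i j + s j) τ)
                 (cong (λ t → I - τ * t) (trans (Σ-+ (λ j → lam * i j) s) (cong (_+ S) (Σ-* lam i))))) ⟩
          (D - τ * I) - τ * (I - τ * (lam * I + S)) ∎
          where
          e i : Vector ℚ n
          e j = dot (q j) (M j)
          i j = dot (M j) (M j)

      -- The pairing of q with U V equals ∑ₗ ⟨uₗ, q vₗ⟩, so Cauchy-Schwarz reduces it to the
      -- operator norm bound for q. The families u and v are arbitrary, which lets the bound apply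
      -- to approximate factorizations of M.
      factorization-bound : ∀ (u : Fin k → Vector ℚ m) (v : Fin k → Vector ℚ n) →
        let T = sum (λ j → dot (q j) (λ i → sum (λ l → v l j * u l i)))
        in 4ℚ * lam * (T * T) ≤ sum (λ l → dot (u l) (u l)) * sum (λ l → dot (v l) (v l))
      factorization-bound u v = begin
        4ℚ * lam * (T * T)      ≡⟨ cong (λ t → 4ℚ * lam * (t * t)) T≡ ⟩
        4ℚ * lam * (T′ * T′)    ≤⟨ *-monoˡ-≤-nonNeg (4ℚ * lam) {{ℚ.nonNegative 0≤4λ}} (cauchy-schwarz u w) ⟩
        4ℚ * lam * (A * B)      ≡⟨ solve 3 (λ l a b → l :* (a :* b) := a :* (l :* b)) refl (4ℚ * lam) A B ⟩
        A * (4ℚ * lam * B)      ≡⟨ cong (A *_) (Σ-* (4ℚ * lam) (λ l → dot (w l) (w l))) ⟨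
        A * sum (λ l → 4ℚ * lam * dot (w l) (w l))
                                ≤⟨ *-monoˡ-≤-nonNeg A {{ℚ.nonNegative (Σ-nonNeg (λ l → dot-nonNeg (u l)))}} (Σ-mono (λ l → combination-bound (v l))) ⟩
        A * sum (λ l → dot (v l) (v l)) ∎
        where
        open ≤-Reasoning
        w : Fin _ → Vector ℚ m
        w l = combination (v l)
        T  = sum (λ j → dot (q j) (λ i → sum (λ l → v l j * u l i)))
        T′ = sum (λ l → dot (u l) (w l))
        A  = sum (λ l → dot (u l) (u l))
        B  = sum (λ l → dot (w l) (w l))
        0≤4λ : 0ℚ ≤ 4ℚ * lam
        0≤4λ = nonNeg-* (<⇒≤ (positive⁻¹ 4ℚ)) (<⇒≤ 0<lam)
        T≡ : T ≡ T′
        T≡ = begin-equality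
          sum (λ j → dot (q j) (λ i → sum (λ l → v l j * u l i)))  ≡⟨ Σ-cong (λ j → dot-Σʳ (q j) (λ l → v l j) u) ⟩
          sum (λ j → sum (λ l → v l j * dot (u l) (q j)))          ≡⟨ Σ-swap (λ j l → v l j * dot (u l) (q j)) ⟩
          sum (λ l → sum (λ j → v l j * dot (u l) (q j)))          ≡⟨ Σ-cong (λ l → trans (dot-Σʳ (u l) (v l) q) (Σ-cong (λ j → cong (v l j *_) (dot-comm (q j) (u l))))) ⟨
          sum (λ l → dot (u l) (w l))                              ∎

-- Natural numbers among the rationals, and constant sequences as reals.

module Embedding where
  open import Data.Nat.Base as ℕ using (ℕ; zero; suc)
  import Data.Nat.Properties as ℕ
  import Data.Integer.Base as ℤ
  open import Data.List.Base using (List; []; _∷_; length; lookup)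
  open import Data.Product.Base using (proj₁; proj₂; _,_)
  open import Data.Rational.Base using (ℚ; 0ℚ; 1ℚ; _+_; _*_; _-_; _≤_; _<_; _/_; ∣_∣)
  open import Data.Rational.Properties
  open import Data.Empty using (⊥-elim)
  open import Relation.Binary.Definitions using (tri<; tri≈; tri>)
  open import Relation.Binary.PropositionalEquality
  open import Relation.Nullary using (yes; no)
  open Counting using (∑)
  open LinearAlgebra

  ι : ℕ → ℚ
  ι n = ℤ.+ n / 1

  ι-mono-≤ : ∀ {m n} → m ℕ.≤ n → ι m ≤ ι n
  ι-mono-≤ {m} {n} m≤n = frac-≤ m n 0 0 (ℕ.*-monoˡ-≤ 1 m≤n)

  ι-mono-< : ∀ {m n} → m ℕ.< n → ι m < ι n
  ι-mono-< {m} {n} m<n = frac-< m n 0 0 (ℕ.*-monoˡ-< 1 m<n)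

  ι-nonNeg : ∀ n → 0ℚ ≤ ι n
  ι-nonNeg n = ι-mono-≤ {0} {n} ℕ.z≤n

  ι-injective : ∀ {m n} → ι m ≡ ι n → m ≡ n
  ι-injective {m} {n} eq with ℕ.<-cmp m n
  ... | tri< m<n _ _ = ⊥-elim (<-irrefl eq (ι-mono-< m<n))
  ... | tri≈ _ m≡n _ = m≡n
  ... | tri> _ _ n<m = ⊥-elim (<-irrefl (sym eq) (ι-mono-< n<m))

  ι-+ : ∀ m n → ι (m ℕ.+ n) ≡ ι m + ι n
  ι-+ zero    n = sym (+-identityˡ (ι n))
  ι-+ (suc m) n = begin
    ι (suc (m ℕ.+ n))     ≡⟨ /-suc (m ℕ.+ n) 0 ⟩
    ι (m ℕ.+ n) + ι 1     ≡⟨ cong (_+ ι 1) (ι-+ m n) ⟩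
    ι m + ι n + ι 1       ≡⟨ +-assoc (ι m) (ι n) (ι 1) ⟩
    ι m + (ι n + ι 1)     ≡⟨ cong (ι m +_) (+-comm (ι n) (ι 1)) ⟩
    ι m + (ι 1 + ι n)     ≡⟨ +-assoc (ι m) (ι 1) (ι n) ⟨
    ι m + ι 1 + ι n       ≡⟨ cong (_+ ι n) (/-suc m 0) ⟨
    ι (suc m) + ι n       ∎
    where open ≡-Reasoning

  ι-* : ∀ m n → ι (m ℕ.* n) ≡ ι m * ι n
  ι-* m n = sym (/-*-/ m n 0 0)

  ι-∑ : ∀ {A : Set} (xs : List A) f → ι (∑ xs f) ≡ sum {length xs} (λ i → ι (f (lookup xs i)))
  ι-∑ []       f = refl
  ι-∑ (x ∷ xs) f = trans (ι-+ (f x) (∑ xs f)) (cong (λ s → ι (f x) + s) (ι-∑ xs f))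

  Σ-const : ∀ n c → sum {n} (λ _ → c) ≡ ι n * c
  Σ-const zero    c = sym (*-zeroˡ c)
  Σ-const (suc n) c = begin
    c + sum {n} (λ _ → c)  ≡⟨ cong₂ _+_ (sym (*-identityˡ c)) (Σ-const n c) ⟩
    1ℚ * c + ι n * c       ≡⟨ *-distribʳ-+ c 1ℚ (ι n) ⟨
    (1ℚ + ι n) * c         ≡⟨ cong (_* c) (ι-+ 1 n) ⟨
    ι (suc n) * c          ∎
    where open ≡-Reasoning

  pointwise⇒≃ℝ : ∀ x y → (∀ t → seq x t ≡ seq y t) → x ≃ℝ y
  pointwise⇒≃ℝ x y h ε 0<ε = 0 , λ t _ →
    subst (_< ε) (cong ∣_∣ (sym (trans (cong (_- seq y t) (h t)) (+-inverseʳ (seq y t))))) 0<ε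

  -- With ε = |p - q|, closeness at a single index would read |p - q| < |p - q|. The hypotheses are
  -- pointwise so as to cover dot products of constant vectors, for which real incidence thus
  -- becomes an exact rational equation.
  constant-≃ℝ : ∀ x y {p q} → (∀ t → seq x t ≡ p) → (∀ t → seq y t ≡ q) → x ≃ℝ y → p ≡ q
  constant-≃ℝ x y {p} {q} x≡p y≡q x≃y with p ≟ q
  ... | yes p≡q = p≡q
  ... | no p≢q  = ⊥-elim (<-irrefl refl (subst (_< ∣ p - q ∣) (cong₂ (λ a b → ∣ a - b ∣) (x≡p N) (y≡q N)) (proj₂ close N ℕ.≤-refl)))
    where
    0<∣p-q∣ : 0ℚ < ∣ p - q ∣
    0<∣p-q∣ = ≰⇒> λ ≤0 → p≢q (begin
      p              ≡⟨ +-sub p q ⟨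
      q + (p - q)    ≡⟨ cong (λ s → q + s) (∣p∣≡0⇒p≡0 (p - q) (≤-antisym ≤0 (0≤∣p∣ (p - q)))) ⟩
      q + 0ℚ         ≡⟨ +-identityʳ q ⟩
      q              ∎)
      where open ≡-Reasoning
    close = x≃y ∣ p - q ∣ 0<∣p-q∣
    N = proj₁ close

-- The points and planes in space and their incidence matrix.

module Geometry where
  open import Data.Bool.Base using (Bool; true; false)
  open import Data.Empty using (⊥-elim)
  open import Data.Nat.Base as ℕ using (ℕ; zero; suc)
  open import Data.Fin.Base using (zero; suc)
  open import Data.List.Base using (List; _∷_; length; lookup)
  open import Data.List.Membership.Propositional.Properties using (∈-lookup)
  open import Data.List.Relation.Unary.All as All using ()
  open import Data.List.Relation.Unary.AllPairs using (_∷_)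
  open import Data.List.Relation.Unary.Unique.Propositional using (Unique)
  open import Data.Product.Base using (_×_; _,_)
  open import Data.Rational.Base using (ℚ; 0ℚ; 1ℚ; ½; _+_; _*_; _-_)
  open import Data.Rational.Properties
  open import Data.Rational.Solver using (module +-*-Solver)
  open import Data.Sum.Base using (_⊎_; inj₁; inj₂)
  open import Function.Base using (_∘_)
  open import Function.Bundles using (module Equivalence)
  open import Function.Definitions using (Injective)
  open import Relation.Binary.PropositionalEquality
  open import Relation.Nullary using (Dec; yes; no; does; ¬_)
  open Counting using (ℕ³; Incident; incident?; points; planes)
  open Embedding

  lookup-injective : ∀ {A : Set} {xs : List A} → Unique xs → Injective _≡_ _≡_ (lookup xs)
  lookup-injective (x∉ ∷ uniq) {zero}  {zero}  eq = refl
  lookup-injective {xs = _ ∷ xs} (x∉ ∷ uniq) {zero}  {suc j} eq = ⊥-elim (All.lookup x∉ (∈-lookup {xs = xs} j) eq)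
  lookup-injective {xs = _ ∷ xs} (x∉ ∷ uniq) {suc i} {zero}  eq = ⊥-elim (All.lookup x∉ (∈-lookup {xs = xs} i) (sym eq))
  lookup-injective (x∉ ∷ uniq) {suc i} {suc j} eq = cong suc (lookup-injective uniq eq)

  rational-point : ℚ → ℚ → ℚ → Point 3
  rational-point x y z zero             = fromℚ x
  rational-point x y z (suc zero)       = fromℚ y
  rational-point x y z (suc (suc zero)) = fromℚ z

  point : ℕ³ → Point 3
  point (x , (y , z)) = rational-point (ι x) (ι y) (ι z)

  plane : ℕ³ → Hyperplane 3
  plane (a , (b , β)) = record
    { normal  = rational-point (ι a) (ι b) 1ℚ
    ; offset  = fromℕ β
    ; nonzero = suc (suc zero) , inj₂ (½ , 0<½ , 0 , λ _ _ → p<p+q ½ 0<½)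
    }

  ∈⇒equation : ∀ {a b β x y z} → rational-point x y z ∈ plane (a , (b , β)) → ι a * x + (ι b * y + z) ≡ ι β
  ∈⇒equation {a} {b} {β} {x} {y} {z} p∈h = trans
    (solve 5 (λ a b x y z → a :* x :+ (b :* y :+ z) := a :* x :+ (b :* y :+ (con 1ℚ :* z :+ con 0ℚ))) refl (ι a) (ι b) x y z)
    (constant-≃ℝ (Hyperplane.normal (plane (a , (b , β))) · rational-point x y z) (fromℕ β) (λ _ → refl) (λ _ → refl) p∈h)
    where open +-*-Solver

  equation⇒∈ : ∀ {a b β x y z} → ι a * x + (ι b * y + z) ≡ ι β → rational-point x y z ∈ plane (a , (b , β))
  equation⇒∈ {a} {b} {β} {x} {y} {z} eq = pointwise⇒≃ℝ (Hyperplane.normal (plane (a , (b , β))) · rational-point x y z) (fromℕ β) λ _ → trans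
    (solve 5 (λ a b x y z → a :* x :+ (b :* y :+ (con 1ℚ :* z :+ con 0ℚ)) := a :* x :+ (b :* y :+ z)) refl (ι a) (ι b) x y z)
    eq
    where open +-*-Solver

  ι-form : ∀ a b x y z → ι (a ℕ.* x ℕ.+ b ℕ.* y ℕ.+ z) ≡ ι a * ι x + (ι b * ι y + ι z)
  ι-form a b x y z = begin
    ι (a ℕ.* x ℕ.+ b ℕ.* y ℕ.+ z)        ≡⟨ ι-+ (a ℕ.* x ℕ.+ b ℕ.* y) z ⟩
    ι (a ℕ.* x ℕ.+ b ℕ.* y) + ι z        ≡⟨ cong (λ s → s + ι z) (ι-+ (a ℕ.* x) (b ℕ.* y)) ⟩
    ι (a ℕ.* x) + ι (b ℕ.* y) + ι z      ≡⟨ cong₂ (λ s t → s + t + ι z) (ι-* a x) (ι-* b y) ⟩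
    ι a * ι x + ι b * ι y + ι z          ≡⟨ +-assoc (ι a * ι x) (ι b * ι y) (ι z) ⟩
    ι a * ι x + (ι b * ι y + ι z)        ∎
    where open ≡-Reasoning

  Incident⇒∈ : ∀ h p → Incident h p → point p ∈ plane h
  Incident⇒∈ (a , (b , β)) (x , (y , z)) eq = equation⇒∈ {a} {b} {β} {ι x} {ι y} {ι z} (trans (sym (ι-form a b x y z)) (cong ι eq))

  ∈⇒Incident : ∀ h p → point p ∈ plane h → Incident h p
  ∈⇒Incident (a , (b , β)) (x , (y , z)) p∈h = ι-injective (trans (ι-form a b x y z) (∈⇒equation {a} {b} {β} {ι x} {ι y} {ι z} p∈h))

  point-injective : ∀ p q → point p ≈ₚ point q → p ≡ q
  point-injective (x , (y , z)) (x′ , (y′ , z′)) p≈q =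
    cong₂ _,_ (coordinate (p≈q zero)) (cong₂ _,_ (coordinate (p≈q (suc zero))) (coordinate (p≈q (suc (suc zero)))))
    where
    coordinate : ∀ {m n} → fromℕ m ≃ℝ fromℕ n → m ≡ n
    coordinate {m} {n} eq = ι-injective (constant-≃ℝ (fromℕ m) (fromℕ n) (λ _ → refl) (λ _ → refl) eq)

  -- The points (0, 0, β), (1, 0, β - a) and (0, 1, β - b) of the first plane determine β, a and b.
  -- Their last coordinates may be negative, which is why membership is treated at rational points.
  plane-injective : ∀ h g → plane h ≐ₕ plane g → h ≡ g
  plane-injective (a , (b , β)) (a′ , (b′ , β′)) h≐g = cong₂ _,_ a≡ (cong₂ _,_ b≡ β≡)
    where
    open +-*-Solver
    transfer : ∀ x y z → ι a * x + (ι b * y + z) ≡ ι β → ι a′ * x + (ι b′ * y + z) ≡ ι β′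
    transfer x y z eq = ∈⇒equation {a′} {b′} {β′} {x} {y} {z}
      (Equivalence.to (h≐g (rational-point x y z)) (equation⇒∈ {a} {b} {β} {x} {y} {z} eq))
    β≡ : β ≡ β′
    β≡ = ι-injective (trans (solve 3 (λ a b β → β := a :* con 0ℚ :+ (b :* con 0ℚ :+ β)) refl (ι a′) (ι b′) (ι β))
      (transfer 0ℚ 0ℚ (ι β) (solve 3 (λ a b β → a :* con 0ℚ :+ (b :* con 0ℚ :+ β) := β) refl (ι a) (ι b) (ι β))))
    a≡ : a ≡ a′
    a≡ = ι-injective (begin
      ι a
        ≡⟨ solve 4 (λ a a′ b′ β → a := a :+ ((a′ :* con 1ℚ :+ (b′ :* con 0ℚ :+ (β :- a))) :- (a′ :* con 1ℚ :+ (b′ :* con 0ℚ :+ (β :- a))))) refl (ι a) (ι a′) (ι b′) (ι β) ⟩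
      ι a + ((ι a′ * 1ℚ + (ι b′ * 0ℚ + (ι β - ι a))) - (ι a′ * 1ℚ + (ι b′ * 0ℚ + (ι β - ι a))))
        ≡⟨ cong (λ s → ι a + ((ι a′ * 1ℚ + (ι b′ * 0ℚ + (ι β - ι a))) - s))
             (trans (transfer 1ℚ 0ℚ (ι β - ι a) (solve 3 (λ a b β → a :* con 1ℚ :+ (b :* con 0ℚ :+ (β :- a)) := β) refl (ι a) (ι b) (ι β))) (cong ι (sym β≡))) ⟩
      ι a + ((ι a′ * 1ℚ + (ι b′ * 0ℚ + (ι β - ι a))) - ι β)
        ≡⟨ solve 4 (λ a a′ b′ β → a :+ ((a′ :* con 1ℚ :+ (b′ :* con 0ℚ :+ (β :- a))) :- β) := a′) refl (ι a) (ι a′) (ι b′) (ι β) ⟩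
      ι a′ ∎)
      where open ≡-Reasoning
    b≡ : b ≡ b′
    b≡ = ι-injective (begin
      ι b
        ≡⟨ solve 4 (λ b a′ b′ β → b := b :+ ((a′ :* con 0ℚ :+ (b′ :* con 1ℚ :+ (β :- b))) :- (a′ :* con 0ℚ :+ (b′ :* con 1ℚ :+ (β :- b))))) refl (ι b) (ι a′) (ι b′) (ι β) ⟩
      ι b + ((ι a′ * 0ℚ + (ι b′ * 1ℚ + (ι β - ι b))) - (ι a′ * 0ℚ + (ι b′ * 1ℚ + (ι β - ι b))))
        ≡⟨ cong (λ s → ι b + ((ι a′ * 0ℚ + (ι b′ * 1ℚ + (ι β - ι b))) - s))
             (trans (transfer 0ℚ 1ℚ (ι β - ι b) (solve 3 (λ a b β → a :* con 0ℚ :+ (b :* con 1ℚ :+ (β :- b)) := β) refl (ι a) (ι b) (ι β))) (cong ι (sym β≡))) ⟩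
      ι b + ((ι a′ * 0ℚ + (ι b′ * 1ℚ + (ι β - ι b))) - ι β)
        ≡⟨ solve 4 (λ b a′ b′ β → b :+ ((a′ :* con 0ℚ :+ (b′ :* con 1ℚ :+ (β :- b))) :- β) := b′) refl (ι b) (ι a′) (ι b′) (ι β) ⟩
      ι b′ ∎)
      where open ≡-Reasoning

  pointSet : ∀ {n} (ps : List ℕ³) → Unique ps → length ps ℕ.≤ n → SetOfAtMost n (_≈ₚ_ {3})
  pointSet ps uniq size≤ = record
    { size = length ps ; size≤n = size≤ ; element = point ∘ lookup ps
    ; injective = λ eq → lookup-injective uniq (point-injective _ _ eq) }

  planeSet : ∀ {n} (hs : List ℕ³) → Unique hs → length hs ℕ.≤ n → SetOfAtMost n (_≐ₕ_ {3})
  planeSet hs uniq size≤ = record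
    { size = length hs ; size≤n = size≤ ; element = plane ∘ lookup hs
    ; injective = λ eq → lookup-injective uniq (plane-injective _ _ eq) }

  incidenceMatrix : ∀ hs ps → Matrix Bool (length hs) (length ps)
  incidenceMatrix hs ps i j = does (incident? (lookup hs i) (lookup ps j))

  isIncidenceMatrix : ∀ {k l} hs ps (hs! : Unique hs) (ps! : Unique ps) (hs≤ : length hs ℕ.≤ k) (ps≤ : length ps ℕ.≤ l) →
    IsIncidenceMatrix (planeSet hs hs! hs≤) (pointSet ps ps! ps≤) (incidenceMatrix hs ps)
  isIncidenceMatrix hs ps _ _ _ _ i j = entry (incident? (lookup hs i) (lookup ps j))
    where
    entry : (d : Dec (Incident (lookup hs i) (lookup ps j))) →
      (does d ≡ true  ×   point (lookup ps j) ∈ plane (lookup hs i)) ⊎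
      (does d ≡ false × ¬ point (lookup ps j) ∈ plane (lookup hs i))
    entry (yes h) = inj₁ (refl , Incident⇒∈ (lookup hs i) (lookup ps j) h)
    entry (no ¬h) = inj₂ (refl , λ p∈h → ¬h (∈⇒Incident (lookup hs i) (lookup ps j) p∈h))

-- From rational approximations of a factorization to its cost.

module Norms where
  open import Data.Bool.Base using (Bool; true; false)
  open import Data.Nat.Base as ℕ using (ℕ; zero; suc)
  import Data.Nat.Properties as ℕ
  open import Data.Fin.Base using (Fin; zero; suc; splitAt)
  import Data.Integer.Base as ℤ
  open import Data.Product.Base using (_,_; proj₁; proj₂)
  open import Data.Rational.Base as ℚ using (ℚ; 0ℚ; 1ℚ; ½; _+_; _*_; _-_; -_; _≤_; _<_; _/_; _⊔_; ∣_∣)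
  open import Data.Rational.Properties
  open import Data.Rational.Solver using (module +-*-Solver)
  open import Data.Sum.Base using (_⊎_; inj₁; inj₂; map₁)
  open import Data.Vec.Functional using (Vector)
  open import Function.Base using (_∘_; flip)
  open import Relation.Binary.PropositionalEquality
  open LinearAlgebra
  open Embedding

  private
    variable
      m n k : ℕ

  eventually-∀ : {P : Fin n → ℕ → Set} → (∀ i → Eventually (P i)) → Eventually (λ t → ∀ i → P i t)
  eventually-∀ {zero}  h = 0 , λ _ _ ()
  eventually-∀ {suc n} h =
    let N₀ , h₀ = h zero
        N′ , h′ = eventually-∀ (h ∘ suc)
    in N₀ ℕ.⊔ N′ , λ { t le zero → h₀ t (≤⊔ˡ {N₀} {N′} le) ; t le (suc i) → h′ t (≤⊔ʳ {N₀} {N′} le) i }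

  entry : Bool → ℚ
  entry true  = 1ℚ
  entry false = 0ℚ

  seq-toℂ : ∀ b t → seq (re (toℂ b)) t ≡ entry b
  seq-toℂ true  t = refl
  seq-toℂ false t = refl

  seq-∑ℝ : ∀ (f : Vector ℝ n) t → seq (∑ℝ f) t ≡ sum (λ i → seq (f i) t)
  seq-∑ℝ {zero}  f t = refl
  seq-∑ℝ {suc n} f t = cong (λ s → seq (f zero) t + s) (seq-∑ℝ (f ∘ suc) t)

  seq-re-∑ℂ : ∀ (f : Vector ℂ n) t → seq (re (∑ℂ f)) t ≡ sum (λ i → seq (re (f i)) t)
  seq-re-∑ℂ {zero}  f t = refl
  seq-re-∑ℂ {suc n} f t = cong (λ s → seq (re (f zero)) t + s) (seq-re-∑ℂ (f ∘ suc) t)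

  max-nonNeg : ∀ (f : Vector ℝ n) t → 0ℚ ≤ seq (max f) t
  max-nonNeg {zero}  f t = ≤-refl
  max-nonNeg {suc n} f t = ≤-trans (max-nonNeg (f ∘ suc) t) (p≤q⊔p (seq (f zero) t) _)

  ≤max : ∀ (f : Vector ℝ n) i t → seq (f i) t ≤ seq (max f) t
  ≤max f zero    t = p≤p⊔q (seq (f zero) t) _
  ≤max f (suc i) t = ≤-trans (≤max (f ∘ suc) i t) (p≤q⊔p (seq (f zero) t) _)

  η : ℕ → ℚ
  η t = ℤ.+ 1 / suc t

  norm² : Matrix ℂ m k → ℕ → Fin m → ℚ
  norm² U t i = sum (λ l → seq ∣ U i l ∣² t)

  -- The approximate root lies below the true one by less than `η t`, so the correction must be
  -- added before squaring.
  row-bound : ∀ (U : Matrix ℂ m k) t i → norm² U t i ≤ (seq ‖ U ‖row t + η t) * (seq ‖ U ‖row t + η t)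
  row-bound U t i = begin
    norm² U t i                                    ≡⟨ seq-∑ℝ (λ l → ∣ U i l ∣²) t ⟨
    seq (∑ℝ (λ l → ∣ U i l ∣²)) t                  ≤⟨ p≤p⊔q _ 0ℚ ⟩
    p                                              ≤⟨ <⇒≤ (proj₂ (√≈-spec t p 0≤p)) ⟩
    (√≈ t p + η t) * (√≈ t p + η t)                ≤⟨ *-mono-≤-nonNeg (nonNeg-+ (√≈-nonNeg t p) (/-nonNeg 1 t))
                                                                      (nonNeg-+ (max-nonNeg (λ i → ‖ U i ‖₂) t) (/-nonNeg 1 t)) ≤α ≤α ⟩
    (seq ‖ U ‖row t + η t) * (seq ‖ U ‖row t + η t) ∎
    where
    open ≤-Reasoning
    p = seq (∑ℝ (λ l → ∣ U i l ∣²)) t ⊔ 0ℚ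
    0≤p : 0ℚ ≤ p
    0≤p = p≤q⊔p (seq (∑ℝ (λ l → ∣ U i l ∣²)) t) 0ℚ
    ≤α : √≈ t p + η t ≤ seq ‖ U ‖row t + η t
    ≤α = +-monoˡ-≤ (η t) (≤max (λ i → ‖ U i ‖₂) i t)

  Σ-splitAt : ∀ m {n} (f : Fin m ⊎ Fin n → ℚ) → sum (λ l → f (splitAt m {n} l)) ≡ sum (f ∘ inj₁) + sum (f ∘ inj₂)
  Σ-splitAt zero    f = sym (+-identityˡ _)
  Σ-splitAt (suc m) f = trans (cong (λ s → f (inj₁ zero) + s) (Σ-splitAt m (f ∘ map₁ suc))) (sym (+-assoc (f (inj₁ zero)) _ _))

  column : Matrix Bool m n → Fin n → Vector ℚ m
  column M j i = entry (M i j)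

  module _ {M : Matrix Bool m n} (F : Factorization (toℂᴹ M)) where
    open Factorization F using (inner; U; V; factors)

    -- The real part of a complex inner product of dimension K is a real inner product of dimension K + K.
    private
      left : ℕ → Fin inner ⊎ Fin inner → Vector ℚ m
      left t (inj₁ l) i = seq (re (U i l)) t
      left t (inj₂ l) i = - seq (im (U i l)) t

      right : ℕ → Fin inner ⊎ Fin inner → Vector ℚ n
      right t (inj₁ l) j = seq (re (V l j)) t
      right t (inj₂ l) j = seq (im (V l j)) t

    u : ℕ → Fin (inner ℕ.+ inner) → Vector ℚ m
    u t l = left t (splitAt inner l)

    v : ℕ → Fin (inner ℕ.+ inner) → Vector ℚ n
    v t l = right t (splitAt inner l)

    product-entry : ∀ t i j → sum (λ l → v t l j * u t l i) ≡ seq (re ((U *ᴹ V) i j)) t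
    product-entry t i j = begin
      sum (λ l → v t l j * u t l i)
        ≡⟨ Σ-splitAt inner (λ s → right t s j * left t s i) ⟩
      sum (λ l → Vr l * Ur l) + sum (λ l → Vi l * - Ui l)
        ≡⟨ Σ-+ (λ l → Vr l * Ur l) (λ l → Vi l * - Ui l) ⟨
      sum (λ l → Vr l * Ur l + Vi l * - Ui l)
        ≡⟨ Σ-cong (λ l → solve 4 (λ vr ur vi ui → vr :* ur :+ vi :* (:- ui) := ur :* vr :+ :- (ui :* vi)) refl (Vr l) (Ur l) (Vi l) (Ui l)) ⟩
      sum (λ l → seq (re (U i l *ℂ V l j)) t)
        ≡⟨ seq-re-∑ℂ (λ l → U i l *ℂ V l j) t ⟨
      seq (re ((U *ᴹ V) i j)) t ∎
      where
      open ≡-Reasoning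
      open +-*-Solver
      Ur Ui Vr Vi : Fin inner → ℚ
      Ur l = seq (re (U i l)) t
      Ui l = seq (im (U i l)) t
      Vr l = seq (re (V l j)) t
      Vi l = seq (im (V l j)) t

    u-bound : ∀ t → let α = seq ‖ U ‖row t + η t in sum (λ l → dot (u t l) (u t l)) ≤ ι m * (α * α)
    u-bound t = begin
      sum (λ l → dot (u t l) (u t l))
        ≡⟨ Σ-splitAt inner (λ s → dot (left t s) (left t s)) ⟩
      sum (λ l → dot (left t (inj₁ l)) (left t (inj₁ l))) + sum (λ l → dot (left t (inj₂ l)) (left t (inj₂ l)))
        ≡⟨ Σ-+ (λ l → dot (left t (inj₁ l)) (left t (inj₁ l))) (λ l → dot (left t (inj₂ l)) (left t (inj₂ l))) ⟨
      sum (λ l → dot (left t (inj₁ l)) (left t (inj₁ l)) + dot (left t (inj₂ l)) (left t (inj₂ l)))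
        ≡⟨ Σ-cong (λ l → trans (sym (Σ-+ (λ i → left t (inj₁ l) i * left t (inj₁ l) i) (λ i → left t (inj₂ l) i * left t (inj₂ l) i)))
                               (Σ-cong (λ i → solve 2 (λ a b → a :* a :+ (:- b) :* (:- b) := a :* a :+ b :* b) refl (seq (re (U i l)) t) (seq (im (U i l)) t)))) ⟩
      sum (λ l → sum (λ i → seq ∣ U i l ∣² t))
        ≡⟨ Σ-swap (λ l i → seq ∣ U i l ∣² t) ⟩
      sum (norm² U t)
        ≤⟨ Σ-mono (row-bound U t) ⟩
      sum {m} (λ i → (seq ‖ U ‖row t + η t) * (seq ‖ U ‖row t + η t))
        ≡⟨ Σ-const m _ ⟩
      ι m * ((seq ‖ U ‖row t + η t) * (seq ‖ U ‖row t + η t)) ∎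
      where
      open ≤-Reasoning
      open +-*-Solver

    v-bound : ∀ t → let β = seq ‖ V ‖col t + η t in sum (λ l → dot (v t l) (v t l)) ≤ ι n * (β * β)
    v-bound t = begin
      sum (λ l → dot (v t l) (v t l))
        ≡⟨ Σ-splitAt inner (λ s → dot (right t s) (right t s)) ⟩
      sum (λ l → dot (right t (inj₁ l)) (right t (inj₁ l))) + sum (λ l → dot (right t (inj₂ l)) (right t (inj₂ l)))
        ≡⟨ Σ-+ (λ l → dot (right t (inj₁ l)) (right t (inj₁ l))) (λ l → dot (right t (inj₂ l)) (right t (inj₂ l))) ⟨
      sum (λ l → dot (right t (inj₁ l)) (right t (inj₁ l)) + dot (right t (inj₂ l)) (right t (inj₂ l)))
        ≡⟨ Σ-cong (λ l → Σ-+ (λ j → right t (inj₁ l) j * right t (inj₁ l) j) (λ j → right t (inj₂ l) j * right t (inj₂ l) j)) ⟨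
      sum (λ l → sum (λ j → seq ∣ V l j ∣² t))
        ≡⟨ Σ-swap (λ l j → seq ∣ V l j ∣² t) ⟩
      sum (norm² (flip V) t)
        ≤⟨ Σ-mono (row-bound (flip V) t) ⟩
      sum {n} (λ i → (seq ‖ V ‖col t + η t) * (seq ‖ V ‖col t + η t))
        ≡⟨ Σ-const n _ ⟩
      ι n * ((seq ‖ V ‖col t + η t) * (seq ‖ V ‖col t + η t)) ∎
      where open ≤-Reasoning

    -- Overestimates the cost, since √≈ t is only accurate up to η t.
    cost⁺ : ℕ → ℚ
    cost⁺ t = (seq ‖ U ‖row t + η t) * (seq ‖ V ‖col t + η t)

    cost⁺-nonNeg : ∀ t → 0ℚ ≤ cost⁺ t
    cost⁺-nonNeg t = nonNeg-* (nonNeg-+ (max-nonNeg (λ i → ‖ U i ‖₂) t) (/-nonNeg 1 t))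
                              (nonNeg-+ (max-nonNeg (λ j → ‖ flip V j ‖₂) t) (/-nonNeg 1 t))

    entries-close : ∀ δ → 0ℚ < δ → Eventually λ t → ∀ i j → ∣ column M j i - sum (λ l → v t l j * u t l i) ∣ < δ
    entries-close δ 0<δ = eventually-∀ λ i → eventually-∀ λ j →
      let N , h = proj₁ (factors i j) δ 0<δ
      in N , λ t le → subst₂ (λ a b → ∣ a - b ∣ < δ) (seq-toℂ (M i j) t) (sym (product-entry t i j)) (h t le)

    -- The matrix q is fixed while t varies, so once the product of the approximations is entrywise
    -- within δ of M, its pairing T with q is at least D / 2, where D ≥ τ I = I / (2 λ). Combined
    -- with `factorization-bound` this gives the claim; the factor `4ℚ` on the right is the price of
    -- the halving.
    cost-lower-bound : ∀ lam → 0ℚ < lam → let I = sum (λ j → dot (column M j) (column M j)) in 0ℚ < I →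
      sum (λ j → sum (λ j′ → dot (column M j′) (column M j) * dot (column M j′) (column M j))) ≤ lam * I →
      Eventually λ t → I * I ≤ (4ℚ * lam) * (ι m * ι n * (cost⁺ t * cost⁺ t))
    cost-lower-bound lam 0<lam 0<I S≤λI = N , bound
      where
      open Regularised lam 0<lam
      open +-*-Solver
      I = sum (λ j → dot (column M j) (column M j))
      D = sum (λ j → dot (q (column M) j) (column M j))
      τδ = divide-pos 0<1 (<-≤-trans 0<lam (p≤p+q lam (<⇒≤ 0<lam)))
      τ = proj₁ τδ
      0<τ = proj₁ (proj₂ τδ)
      2τλ≡1 : (τ + τ) * lam ≡ 1ℚ
      2τλ≡1 = trans (solve 2 (λ τ l → (τ :+ τ) :* l := (l :+ l) :* τ) refl τ lam) (proj₂ (proj₂ τδ))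
      τI≤D : τ * I ≤ D
      τI≤D = alignment-bound (column M) τ (<⇒≤ 0<τ) 2τλ≡1 S≤λI
      0<D : 0ℚ < D
      0<D = <-≤-trans (pos-* 0<τ 0<I) τI≤D
      ‖q‖₁ = sum (λ j → sum (λ i → ∣ q (column M) j i ∣))
      -- The added 1 makes B positive, so that δ = D / (2 B) exists; the total error δ ‖q‖₁ is then
      -- at most D / 2.
      B = ‖q‖₁ + 1ℚ
      0<B : 0ℚ < B
      0<B = <-≤-trans 0<1 (subst (1ℚ ≤_) (+-comm 1ℚ ‖q‖₁) (p≤p+q 1ℚ (Σ-nonNeg (λ j → Σ-nonNeg (λ i → 0≤∣p∣ (q (column M) j i))))))
      δB = divide-pos (half-pos 0<D) 0<B
      δ = proj₁ δB
      0<δ = proj₁ (proj₂ δB)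
      N = proj₁ (entries-close δ 0<δ)
      bound : ∀ t → N ℕ.≤ t → I * I ≤ (4ℚ * lam) * (ι m * ι n * (cost⁺ t * cost⁺ t))
      bound t le = begin
        I * I
          ≡⟨ solve 1 (λ I → I :* I := con 1ℚ :* con 1ℚ :* (I :* I)) refl I ⟩
        1ℚ * 1ℚ * (I * I)
          ≡⟨ cong (λ s → s * s * (I * I)) 2τλ≡1 ⟨
        (τ + τ) * lam * ((τ + τ) * lam) * (I * I)
          ≡⟨ solve 3 (λ τ l I → (τ :+ τ) :* l :* ((τ :+ τ) :* l) :* (I :* I)
                                := con 4ℚ :* l :* (con 4ℚ :* l :* ((τ :* I :* con ½) :* (τ :* I :* con ½)))) refl τ lam I ⟩
        4ℚ * lam * (4ℚ * lam * ((τ * I * ½) * (τ * I * ½)))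
          ≤⟨ scale (scale (*-mono-≤-nonNeg 0≤τI½ (≤-trans 0≤τI½ τI½≤T) τI½≤T τI½≤T)) ⟩
        4ℚ * lam * (4ℚ * lam * (T * T))
          ≤⟨ scale (factorization-bound (column M) (u t) (v t)) ⟩
        4ℚ * lam * (sum (λ l → dot (u t l) (u t l)) * sum (λ l → dot (v t l) (v t l)))
          ≤⟨ scale (*-mono-≤-nonNeg (Σ-nonNeg (λ l → dot-nonNeg (u t l))) (nonNeg-* (ι-nonNeg n) (square-nonNeg β)) (u-bound t) (v-bound t)) ⟩
        4ℚ * lam * ((ι m * (α * α)) * (ι n * (β * β)))
          ≡⟨ cong (4ℚ * lam *_) (solve 4 (λ m a n b → (m :* (a :* a)) :* (n :* (b :* b)) := m :* n :* ((a :* b) :* (a :* b))) refl (ι m) α (ι n) β) ⟩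
        4ℚ * lam * (ι m * ι n * (cost⁺ t * cost⁺ t)) ∎
        where
        open ≤-Reasoning
        α = seq ‖ U ‖row t + η t
        β = seq ‖ V ‖col t + η t
        W : Fin n → Vector ℚ m
        W j i = sum (λ l → v t l j * u t l i)
        T = sum (λ j → dot (q (column M) j) (W j))
        scale : ∀ {x y} → x ≤ y → 4ℚ * lam * x ≤ 4ℚ * lam * y
        scale = *-monoˡ-≤-nonNeg (4ℚ * lam) {{ℚ.nonNegative (nonNeg-* (<⇒≤ (positive⁻¹ 4ℚ)) (<⇒≤ 0<lam))}}
        perturb : ∀ i j → q (column M) j i * column M j i ≤ q (column M) j i * W j i + δ * ∣ q (column M) j i ∣
        perturb i j = begin
          x * y                      ≡⟨ solve 3 (λ x y w → x :* y := x :* w :+ x :* (y :- w)) refl x y w ⟩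
          x * w + x * (y - w)        ≤⟨ +-monoʳ-≤ (x * w) (≤-trans (p≤∣p∣ (x * (y - w))) (≤-reflexive (∣p*q∣≡∣p∣*∣q∣ x (y - w)))) ⟩
          x * w + ∣ x ∣ * ∣ y - w ∣  ≤⟨ +-monoʳ-≤ (x * w) (*-monoˡ-≤-nonNeg ∣ x ∣ {{∣-∣-nonNeg x}} (<⇒≤ (proj₂ (entries-close δ 0<δ) t le i j))) ⟩
          x * w + ∣ x ∣ * δ          ≡⟨ cong (λ s → x * w + s) (*-comm ∣ x ∣ δ) ⟩
          x * w + δ * ∣ x ∣          ∎
          where
          x = q (column M) j i
          y = column M j i
          w = W j i
        D≤ : D ≤ T + D * ½
        D≤ = begin
          D
            ≤⟨ Σ-mono (λ j → Σ-mono (λ i → perturb i j)) ⟩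
          sum (λ j → sum (λ i → q (column M) j i * W j i + δ * ∣ q (column M) j i ∣))
            ≡⟨ Σ-cong (λ j → trans (Σ-+ (λ i → q (column M) j i * W j i) (λ i → δ * ∣ q (column M) j i ∣))
                                   (cong (λ s → dot (q (column M) j) (W j) + s) (Σ-* δ (λ i → ∣ q (column M) j i ∣)))) ⟩
          sum (λ j → dot (q (column M) j) (W j) + δ * sum (λ i → ∣ q (column M) j i ∣))
            ≡⟨ trans (Σ-+ (λ j → dot (q (column M) j) (W j)) (λ j → δ * sum (λ i → ∣ q (column M) j i ∣)))
                     (cong (λ s → T + s) (Σ-* δ (λ j → sum (λ i → ∣ q (column M) j i ∣)))) ⟩
          T + δ * ‖q‖₁
            ≤⟨ +-monoʳ-≤ T (*-monoˡ-≤-nonNeg δ {{ℚ.nonNegative (<⇒≤ 0<δ)}} (p≤p+q ‖q‖₁ (<⇒≤ 0<1))) ⟩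
          T + δ * B
            ≡⟨ cong (λ s → T + s) (trans (*-comm δ B) (proj₂ (proj₂ δB))) ⟩
          T + D * ½ ∎
        0≤τI½ : 0ℚ ≤ τ * I * ½
        0≤τI½ = <⇒≤ (half-pos (pos-* 0<τ 0<I))
        τI½≤T : τ * I * ½ ≤ T
        τI½≤T = ≤-trans (*-monoʳ-≤-nonNeg ½ τI≤D) (0≤q-p⇒p≤q (subst (0ℚ ≤_)
          (solve 2 (λ T D → (T :+ D :* con ½) :- D := T :- D :* con ½) refl T D) (p≤q⇒0≤q-p D≤)))

    -- With α and β the approximate norms, `cost⁺` exceeds the cost by (α + β + η) η, which tends to
    -- 0 because Cauchy sequences are bounded.
    ≤ℝ-cost : ∀ x → Eventually (λ t → seq x t ≤ cost⁺ t) → x ≤ℝ cost F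
    ≤ℝ-cost x (N , x≤) ε 0<ε =
      let A , 0<A , N₁ , α< = bounded ‖ U ‖row
          B , 0<B , N₂ , β< = bounded ‖ V ‖col
          C = A + B + 1ℚ
          0<C = <-trans (<-trans 0<A (p<p+q A 0<B)) (p<p+q (A + B) 0<1)
          ε′ , 0<ε′ , Cε′≡ = divide-pos (half-pos 0<ε) 0<C
          N₃ , η≤ = archimedean 0<ε′
          M₁ = N ℕ.⊔ N₁
          M₂ = N₂ ℕ.⊔ N₃
      in M₁ ℕ.⊔ M₂ , λ t le →
        let le₁ = ≤⊔ˡ {M₁} {M₂} le
            le₂ = ≤⊔ʳ {M₁} {M₂} le
            α = seq ‖ U ‖row t
            β = seq ‖ V ‖col t
            e = η t
            0≤e = /-nonNeg 1 t
            e≤1 = 1/-≤ {0} {t} ℕ.z≤n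
            α≤A = ≤-trans (p≤∣p∣ α) (<⇒≤ (α< t (≤⊔ʳ {N} {N₁} le₁)))
            β≤B = ≤-trans (p≤∣p∣ β) (<⇒≤ (β< t (≤⊔ˡ {N₂} {N₃} le₂)))
        in begin-strict
          seq x t                  ≤⟨ x≤ t (≤⊔ˡ {N} {N₁} le₁) ⟩
          (α + e) * (β + e)        ≡⟨ solve 3 (λ a b e → (a :+ e) :* (b :+ e) := a :* b :+ (a :+ b :+ e) :* e) refl α β e ⟩
          α * β + (α + β + e) * e  ≤⟨ +-monoʳ-≤ (α * β) (≤-trans (*-monoʳ-≤-nonNeg e {{ℚ.nonNegative 0≤e}} (+-mono-≤ (+-mono-≤ α≤A β≤B) e≤1))
                                                                (*-monoˡ-≤-nonNeg C {{ℚ.nonNegative (<⇒≤ 0<C)}} (η≤ t (≤⊔ʳ {N₂} {N₃} le₂)))) ⟩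
          α * β + C * ε′           ≡⟨ cong (λ s → α * β + s) Cε′≡ ⟩
          α * β + ε * ½            <⟨ +-monoʳ-< (α * β) (subst (ε * ½ <_) (½-double ε) (p<p+q (ε * ½) (half-pos 0<ε))) ⟩
          α * β + ε                ∎
      where
      open ≤-Reasoning
      open +-*-Solver

-- The grid size in terms of n.

module Parameters where
  open import Data.Nat.Base
  open import Data.Nat.Properties
  open import Data.Nat.DivMod using (_/_; _%_; m/n*n≤m; m≡m%n+[m/n]*n; m%n<n)
  open import Data.Nat.Logarithm using (⌊log₂_⌋; ⌊log₂⌋-mono-≤)
  open import Data.Nat.Solver using (module +-*-Solver)
  open import Data.List.Base using (length)
  open import Relation.Binary.PropositionalEquality
  open Counting using (points; planes; height; height≤; length-box)

  -- There are up to 3 r⁴ planes. Subtracting 2 from the logarithm makes room for 4 r⁴ = 2^(2 + 4k),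
  -- and truncation sends small n to the one-point grid.
  exponent : ℕ → ℕ
  exponent n = (⌊log₂ n ⌋ ∸ 2) / 4

  module _ (n : ℕ) (2≤n : 2 ≤ n) where
    private
      l = ⌊log₂ n ⌋
      k = exponent n
      r = 2 ^ k

      1≤l : 1 ≤ l
      1≤l = ⌊log₂⌋-mono-≤ 2≤n

      2^l≤n : 2 ^ l ≤ n
      2^l≤n = ⌊log₂⌋-lower n {{>-nonZero (<-trans z<s 2≤n)}}

      r⁴≡ : ∀ k → 2 ^ (k * 4) ≡ 2 ^ k * 2 ^ k * (2 ^ k * 2 ^ k)
      r⁴≡ k = begin
        2 ^ (k * 4)                          ≡⟨ ^-*-assoc 2 k 4 ⟨
        (2 ^ k) ^ 4                          ≡⟨ solve 1 (λ r → r :* (r :* (r :* (r :* con 1))) := r :* r :* (r :* r)) refl (2 ^ k) ⟩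
        2 ^ k * 2 ^ k * (2 ^ k * 2 ^ k)      ∎
        where
        open ≡-Reasoning
        open +-*-Solver

    -- This is what turns the factor k + 1 of the energy estimate into the logarithm of n.
    exponent<log : suc k ≤ l
    exponent<log with k | m/n*n≤m (l ∸ 2) 4
    ... | zero   | _ = 1≤l
    ... | suc k′ | h = begin
      suc (suc k′)        ≤⟨ s≤s (m≤m*n (suc k′) 4) ⟩
      suc (suc k′ * 4)    ≤⟨ s≤s h ⟩
      suc (l ∸ 2)         ≤⟨ s≤s (∸-monoʳ-≤ l (s≤s (z≤n {1}))) ⟩
      suc (l ∸ 1)         ≡⟨ m+[n∸m]≡n 1≤l ⟩
      l                   ∎
      where open ≤-Reasoning

    -- 64 = 2 · 4 · 8: rounding the logarithm down loses a factor 2, the subtracted 2 a factor 4,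
    -- and the remainder modulo 4 a factor of at most 8.
    n≤64r⁴ : n ≤ 64 * (r * r * (r * r))
    n≤64r⁴ = begin
      n                          ≤⟨ <⇒≤ (⌊log₂⌋-upper n) ⟩
      2 ^ suc l                  ≤⟨ ^-monoʳ-≤ 2 suc-l≤ ⟩
      2 ^ (6 + k * 4)            ≡⟨ ^-distribˡ-+-* 2 6 (k * 4) ⟩
      64 * 2 ^ (k * 4)           ≡⟨ cong (64 *_) (r⁴≡ k) ⟩
      64 * (r * r * (r * r))     ∎
      where
      open ≤-Reasoning
      suc-l≤ : suc l ≤ 6 + k * 4
      suc-l≤ = begin
        suc l                             ≤⟨ s≤s (m≤n+m∸n l 2) ⟩
        3 + (l ∸ 2)                       ≡⟨ cong (3 +_) (m≡m%n+[m/n]*n (l ∸ 2) 4) ⟩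
        3 + ((l ∸ 2) % 4 + k * 4)         ≤⟨ +-monoʳ-≤ 3 (+-monoˡ-≤ (k * 4) (≤-pred (m%n<n (l ∸ 2) 4))) ⟩
        6 + k * 4                         ∎

    private
      -- The case k = 0 is separate: the general bound would allow three planes there, too many for
      -- n = 2, whereas the grid has a single point and a single plane.
      box≤n : ∀ k m → m ≤ 3 * (2 ^ k * 2 ^ k) → (k ≡ 0 → m ≤ 1) → k * 4 ≤ l ∸ 2 → 2 ^ k * (2 ^ k * m) ≤ n
      box≤n zero m m≤ m≤1 h = ≤-trans (≤-reflexive (trans (*-identityˡ (1 * m)) (*-identityˡ m))) (≤-trans (m≤1 refl) (<⇒≤ 2≤n))
      box≤n k@(suc _) m m≤ _ h = begin
        r′ * (r′ * m)                       ≤⟨ *-monoʳ-≤ r′ (*-monoʳ-≤ r′ m≤) ⟩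
        r′ * (r′ * (3 * (r′ * r′)))         ≤⟨ m≤m+n _ (r′ * r′ * (r′ * r′)) ⟩
        r′ * (r′ * (3 * (r′ * r′))) + r′ * r′ * (r′ * r′)
                                            ≡⟨ solve 1 (λ r → r :* (r :* (con 3 :* (r :* r))) :+ r :* r :* (r :* r) := con 4 :* (r :* r :* (r :* r))) refl r′ ⟩
        4 * (r′ * r′ * (r′ * r′))           ≡⟨ cong (4 *_) (r⁴≡ k) ⟨
        4 * 2 ^ (k * 4)                     ≡⟨ ^-distribˡ-+-* 2 2 (k * 4) ⟨
        2 ^ (2 + k * 4)                     ≤⟨ ^-monoʳ-≤ 2 (≤-trans (+-monoʳ-≤ 2 h) (≤-reflexive (m+[n∸m]≡n 2≤l))) ⟩
        2 ^ l                               ≤⟨ 2^l≤n ⟩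
        n                                   ∎
        where
        open ≤-Reasoning
        open +-*-Solver
        r′ = 2 ^ k
        2≤l : 2 ≤ l
        2≤l = <⇒≤ (m∸n≢0⇒n<m λ l∸2≡0 → n≮0 (≤-trans h (≤-reflexive l∸2≡0)))

    points≤n : length (points r) ≤ n
    points≤n = subst (_≤ n) (sym (length-box r (r * r)))
      (box≤n k (r * r) (m≤n*m (r * r) 3) (λ k≡0 → ≤-reflexive (cong (λ k → 2 ^ k * 2 ^ k) k≡0)) (m/n*n≤m (l ∸ 2) 4))

    planes≤n : length (planes r) ≤ n
    planes≤n = subst (_≤ n) (sym (length-box r (height r)))
      (box≤n k (height r) (height≤ r) (λ k≡0 → ≤-reflexive (cong (λ k → height (2 ^ k)) k≡0)) (m/n*n≤m (l ∸ 2) 4))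

-- Upper bounds for the approximations of c n^(1/4) / √(log n).

module Target where
  open import Data.Nat.Base as ℕ using (ℕ; suc)
  import Data.Nat.Properties as ℕ
  open import Data.Nat.Logarithm using (⌊log₂_⌋; ⌊log₂⌋-mono-≤; ⌊log₂[2^n]⌋≡n)
  import Data.Integer.Base as ℤ
  open import Data.Product.Base using (_,_; proj₁; proj₂)
  open import Data.Rational.Base as ℚ using (ℚ; 0ℚ; 1ℚ; ½; _+_; _*_; _-_; -_; _≤_; _<_; _/_; _⊔_)
  open import Data.Rational.Properties
  open import Data.Rational.Solver using (module +-*-Solver)
  open import Relation.Binary.PropositionalEquality
  open LinearAlgebra using (square-nonNeg; 0≤q-p⇒p≤q; p≤q⇒0≤q-p)
  open Embedding
  open Norms using (η)

  square-cancel-≤ : ∀ {p q} → 0ℚ ≤ q → p * p ≤ q * q → p ≤ q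
  square-cancel-≤ {p} {q} 0≤q p²≤q² = ≮⇒≥ λ q<p → <-irrefl refl (begin-strict
    q * q  ≤⟨ *-monoˡ-≤-nonNeg q {{ℚ.nonNegative 0≤q}} (<⇒≤ q<p) ⟩
    q * p  <⟨ *-monoˡ-<-pos p {{ℚ.positive (≤-<-trans 0≤q q<p)}} q<p ⟩
    p * p  ≤⟨ p²≤q² ⟩
    q * q  ∎)
    where open ≤-Reasoning

  -- The target satisfies x² (k + 1) ≤ 32 c² r², where 8 of the 32 is √64 from `n≤64r⁴` and 4 comes
  -- from replacing √(log₂ n) by twice its approximation. The cost satisfies r² ≤ 1152 (k + 1) ω²,
  -- so 32 · 1152 c² ≤ 1 is required; 1/256 is the largest power of two that meets this.
  c : ℚ
  c = ℤ.+ 1 / 256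

  c-positive : 0ℝ <ℝ fromℚ c
  c-positive = c * ½ , half-pos 0<c , 0 , λ _ _ → subst₂ _<_ (sym (+-identityˡ (c * ½))) (½-double c) (p<p+q (c * ½) (half-pos 0<c))
    where
    0<c : 0ℚ < c
    0<c = positive⁻¹ c

  -- Raising 2^⌊log₂ n⌋ ≤ n to the power t + 1 gives the bound at every index and not only in the
  -- limit.
  log₂≈-lower : ∀ n → 2 ℕ.≤ n → ∀ t → ι ⌊log₂ n ⌋ ≤ log₂≈ n t
  log₂≈-lower n 2≤n t = frac-≤ ⌊log₂ n ⌋ ⌊log₂ n ℕ.^ suc t ⌋ 0 t (begin
    ⌊log₂ n ⌋ ℕ.* suc t                       ≡⟨ ⌊log₂[2^n]⌋≡n (⌊log₂ n ⌋ ℕ.* suc t) ⟨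
    ⌊log₂ 2 ℕ.^ (⌊log₂ n ⌋ ℕ.* suc t) ⌋       ≡⟨ cong ⌊log₂_⌋ (ℕ.^-*-assoc 2 ⌊log₂ n ⌋ (suc t)) ⟨
    ⌊log₂ (2 ℕ.^ ⌊log₂ n ⌋) ℕ.^ suc t ⌋       ≤⟨ ⌊log₂⌋-mono-≤ (ℕ.^-monoˡ-≤ (suc t) (⌊log₂⌋-lower n {{ℕ.>-nonZero (ℕ.<-trans ℕ.z<s 2≤n)}})) ⟩
    ⌊log₂ n ℕ.^ suc t ⌋                       ≡⟨ ℕ.*-identityʳ _ ⟨
    ⌊log₂ n ℕ.^ suc t ⌋ ℕ.* 1                 ∎)
    where open ℕ.≤-Reasoning

  √-square≤ : ∀ x t → seq (√ x) t * seq (√ x) t ≤ seq x t ⊔ 0ℚ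
  √-square≤ x t = proj₁ (√≈-spec t (seq x t ⊔ 0ℚ) (p≤q⊔p (seq x t) 0ℚ))

  ≤√-square : ∀ x t → seq x t ≤ (seq (√ x) t + η t) * (seq (√ x) t + η t)
  ≤√-square x t = ≤-trans (p≤p⊔q (seq x t) 0ℚ) (<⇒≤ (proj₂ (√≈-spec t (seq x t ⊔ 0ℚ) (p≤q⊔p (seq x t) 0ℚ))))

  √-nonNeg : ∀ x t → 0ℚ ≤ seq (√ x) t
  √-nonNeg x t = √≈-nonNeg t (seq x t ⊔ 0ℚ)

  ⊔0≤ : ∀ p {q} → p ≤ q → 0ℚ ≤ q → p ⊔ 0ℚ ≤ q
  ⊔0≤ p = ⊔-lub

  -- Here l underestimates a root that is at least 1, with error at most e. Staying above ½, it is
  -- nonzero, so `inverse l` is a genuine inverse, and it dominates e.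
  ½-rounding : ∀ {l e κ} → 0ℚ ≤ l → 0ℚ ≤ e → e ≤ ½ → 1ℚ ≤ κ → κ ≤ (l + e) * (l + e) → ½ ≤ l
  ½-rounding {l} {e} {κ} 0≤l 0≤e e≤½ 1≤κ κ≤ =
    0≤q-p⇒p≤q (subst (0ℚ ≤_) (solve 1 (λ l → (l :+ con ½) :- con 1ℚ := l :- con ½) refl l) (p≤q⇒0≤q-p 1≤l+½))
    where
    open +-*-Solver
    1≤l+½ : 1ℚ ≤ l + ½
    1≤l+½ = ≤-trans (square-cancel-≤ {1ℚ} {l + e} (nonNeg-+ 0≤l 0≤e) (≤-trans 1≤κ κ≤)) (+-monoʳ-≤ l e≤½)

  -- As e ≤ ½ ≤ l, κ is at most (2 l)². The constants then cancel exactly: 2048 · 4 · 8 · c² = 1.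
  quotient-bound : ∀ {l e κ b σ} → 0ℚ ≤ l → 0ℚ ≤ e → e ≤ ½ → 1ℚ ≤ κ → κ ≤ (l + e) * (l + e) → b * b ≤ ι 8 * σ →
    let x = c * (b * inverse l) in ι 2048 * (κ * (x * x)) ≤ σ
  quotient-bound {l} {e} {κ} {b} {σ} 0≤l 0≤e e≤½ 1≤κ κ≤ b²≤ = begin
    ι 2048 * (κ * (x * x))
      ≤⟨ *-monoˡ-≤-nonNeg (ι 2048) (*-monoʳ-≤-nonNeg (x * x) {{ℚ.nonNegative (square-nonNeg x)}} κ≤[2l]²) ⟩
    ι 2048 * ((l + l) * (l + l) * (x * x))
      ≡⟨ solve 3 (λ l b i → con (ι 2048) :* ((l :+ l) :* (l :+ l) :* ((con c :* (b :* i)) :* (con c :* (b :* i))))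
                            := con (ℤ.+ 1 / 8) :* ((i :* l) :* (i :* l) :* (b :* b))) refl l b (inverse l) ⟩
    ℤ.+ 1 / 8 * ((inverse l * l) * (inverse l * l) * (b * b))
      ≡⟨ cong (λ y → ℤ.+ 1 / 8 * (y * y * (b * b))) (inverse-* (<-≤-trans 0<½ ½≤l)) ⟩
    ℤ.+ 1 / 8 * (1ℚ * 1ℚ * (b * b))
      ≤⟨ *-monoˡ-≤-nonNeg (ℤ.+ 1 / 8) (*-monoˡ-≤-nonNeg (1ℚ * 1ℚ) b²≤) ⟩
    ℤ.+ 1 / 8 * (1ℚ * 1ℚ * (ι 8 * σ))
      ≡⟨ solve 1 (λ s → con (ℤ.+ 1 / 8) :* (con 1ℚ :* con 1ℚ :* (con (ι 8) :* s)) := s) refl σ ⟩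
    σ ∎
    where
    open ≤-Reasoning
    open +-*-Solver
    x = c * (b * inverse l)
    ½≤l : ½ ≤ l
    ½≤l = ½-rounding {l} {e} {κ} 0≤l 0≤e e≤½ 1≤κ κ≤
    l+e≤ : l + e ≤ l + l
    l+e≤ = +-monoʳ-≤ l (≤-trans e≤½ ½≤l)
    κ≤[2l]² : κ ≤ (l + l) * (l + l)
    κ≤[2l]² = ≤-trans κ≤ (*-mono-≤-nonNeg (nonNeg-+ 0≤l 0≤e) (nonNeg-+ 0≤l 0≤l) l+e≤ l+e≤)

  √√-bound : ∀ x t {σ} → 0ℚ ≤ σ → seq x t ≤ ι 64 * (σ * σ) → seq (√ (√ x)) t * seq (√ (√ x)) t ≤ ι 8 * σ
  √√-bound x t {σ} 0≤σ x≤ = ≤-trans (√-square≤ (√ x) t) (⊔0≤ (seq (√ x) t) √x≤8σ 0≤8σ)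
    where
    open +-*-Solver
    0≤8σ : 0ℚ ≤ ι 8 * σ
    0≤8σ = nonNeg-* (ι-nonNeg 8) 0≤σ
    √x≤8σ : seq (√ x) t ≤ ι 8 * σ
    √x≤8σ = square-cancel-≤ {seq (√ x) t} {ι 8 * σ} 0≤8σ (≤-trans (√-square≤ x t)
      (⊔0≤ (seq x t) (≤-trans x≤ (≤-reflexive (solve 1 (λ s → con (ι 64) :* (s :* s) := con (ι 8) :* s :* (con (ι 8) :* s)) refl σ)))
                     (nonNeg-* 0≤8σ 0≤8σ)))

  ratio-bound : ∀ x y (0<√y : 0ℝ <ℝ √ y) z → z ≡ fromℚ c *ℝ (√ (√ x) ÷ℝ √ y [ 0<√y ]) →
    ∀ t {κ σ} → 1 ℕ.≤ t → 0ℚ ≤ σ → 1ℚ ≤ κ → seq x t ≤ ι 64 * (σ * σ) → κ ≤ seq y t →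
    ι 2048 * (κ * (seq z t * seq z t)) ≤ σ
  -- `1 ≤ t` gives `η t ≤ ½`, the error that `½-rounding` tolerates.
  ratio-bound x y 0<√y z refl t {κ} {σ} 1≤t 0≤σ 1≤κ x≤ κ≤y = quotient-bound {seq (√ y) t} {η t} {κ} {seq (√ (√ x)) t} {σ}
    (√-nonNeg y t) (/-nonNeg 1 t) (1/-≤ {1} {t} 1≤t) 1≤κ (≤-trans κ≤y (≤√-square y t)) (√√-bound x t 0≤σ x≤)

open import Data.Bool.Base using (Bool)
open import Data.Nat.Base using (ℕ; _≤_)
open import Data.Product.Base using (_×_; Σ-syntax; _,_)

-- The configuration for a given n, and the target against the cost.

module Comparison (n : ℕ) (2≤n : 2 ≤ n) where
  open import Data.Bool.Base using (Bool)
  open import Data.Fin.Base using (Fin)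
  open import Data.List.Base using (length; lookup)
  import Data.Nat.Base as ℕ
  import Data.Nat.Properties as ℕ
  import Data.Nat.Solver as ℕ
  open import Data.Product.Base using (_,_; proj₁; proj₂)
  open import Data.Rational.Base as ℚ using (ℚ; 0ℚ; 1ℚ; _+_; _*_)
  open import Data.Rational.Properties
  open import Data.Rational.Solver using (module +-*-Solver)
  open import Relation.Binary.PropositionalEquality
  open import Relation.Nullary using (Dec; yes; no; does)
  open Counting
  open LinearAlgebra
  open Embedding
  open Geometry
  open Norms
  open Parameters
  open Target using (c; square-cancel-≤; ratio-bound; log₂≈-lower)

  private
    k = exponent n
    κ = ℕ.suc k
    r = 2 ℕ.^ k
    hs = planes r
    ps = points r
    ρ = ι (r ℕ.* r)
    -- With this λ the hypothesis S ≤ λ I of `cost-lower-bound` is `rectangles≤`.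
    lam = ι (96 ℕ.* (κ ℕ.* (r ℕ.* r)))

  pointsₙ : SetOfAtMost n (_≈ₚ_ {3})
  pointsₙ = pointSet ps (points-unique r) (points≤n n 2≤n)

  planesₙ : SetOfAtMost n (_≐ₕ_ {3})
  planesₙ = planeSet hs (planes-unique r) (planes≤n n 2≤n)

  matrixₙ : Matrix Bool (length hs) (length ps)
  matrixₙ = incidenceMatrix hs ps

  incidenceₙ : IsIncidenceMatrix planesₙ pointsₙ matrixₙ
  incidenceₙ = isIncidenceMatrix hs ps (planes-unique r) (points-unique r) (planes≤n n 2≤n) (points≤n n 2≤n)

  target : ℝ
  target = fromℚ c *ℝ (√ (√ (fromℕ n)) ÷ℝ √ (log₂ n) [ √-pos (log₂ n) (log₂-pos n 2≤n) ])

  private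
    1≤r : 1 ℕ.≤ r
    1≤r = ℕ.>-nonZero⁻¹ r {{ℕ.m^n≢0 2 k}}

    0<ρ : 0ℚ ℚ.< ρ
    0<ρ = ι-mono-< {0} (ℕ.*-mono-≤ 1≤r 1≤r)

    1≤κ : 1ℚ ℚ.≤ ι κ
    1≤κ = ι-mono-≤ {1} {κ} (ℕ.s≤s ℕ.z≤n)

    0<κ : 0ℚ ℚ.< ι κ
    0<κ = <-≤-trans 0<1 1≤κ

    entry-does : ∀ {P : Set} (P? : Dec P) → entry (does P?) ≡ ι (𝟙 P?)
    entry-does (yes _) = refl
    entry-does (no _)  = refl

    dot-column : ∀ j j′ → dot (column matrixₙ j) (column matrixₙ j′) ≡ ι (common r (lookup ps j) (lookup ps j′))
    dot-column j j′ = trans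
      (Σ-cong (λ i → trans (cong₂ _*_ (entry-does (incident? (lookup hs i) (lookup ps j))) (entry-does (incident? (lookup hs i) (lookup ps j′))))
                           (sym (ι-* (𝟙 (incident? (lookup hs i) (lookup ps j))) (𝟙 (incident? (lookup hs i) (lookup ps j′)))))))
      (sym (ι-∑ hs (λ h → 𝟙 (incident? h (lookup ps j)) ℕ.* 𝟙 (incident? h (lookup ps j′)))))

    I = sum (λ j → dot (column matrixₙ j) (column matrixₙ j))
    S = sum (λ j → sum (λ j′ → dot (column matrixₙ j′) (column matrixₙ j) * dot (column matrixₙ j′) (column matrixₙ j)))

    I≡ : I ≡ ι (incidences r)
    I≡ = trans (Σ-cong (λ j → dot-column j j)) (sym (ι-∑ ps (λ p → common r p p)))

    S≡ : S ≡ ι (rectangles r)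
    S≡ = begin
      S
        ≡⟨ Σ-swap (λ j j′ → dot (column matrixₙ j′) (column matrixₙ j) * dot (column matrixₙ j′) (column matrixₙ j)) ⟩
      sum (λ j → sum (λ j′ → dot (column matrixₙ j) (column matrixₙ j′) * dot (column matrixₙ j) (column matrixₙ j′)))
        ≡⟨ Σ-cong (λ j → Σ-cong (λ j′ → trans (cong (λ x → x * x) (dot-column j j′)) (sym (ι-* (f j j′) (f j j′))))) ⟩
      sum (λ j → sum (λ j′ → ι (f j j′ ℕ.* f j j′)))
        ≡⟨ Σ-cong (λ j → ι-∑ ps (λ p′ → common r (lookup ps j) p′ ℕ.* common r (lookup ps j) p′)) ⟨
      sum (λ j → ι (∑ ps (λ p′ → common r (lookup ps j) p′ ℕ.* common r (lookup ps j) p′)))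
        ≡⟨ ι-∑ ps (λ p → ∑ ps (λ p′ → common r p p′ ℕ.* common r p p′)) ⟨
      ι (rectangles r) ∎
      where
      open ≡-Reasoning
      f : Fin (length ps) → Fin (length ps) → ℕ
      f j j′ = common r (lookup ps j) (lookup ps j′)

    S≤λI : S ℚ.≤ lam * I
    S≤λI = begin
      S                                                         ≡⟨ S≡ ⟩
      ι (rectangles r)                                          ≤⟨ ι-mono-≤ (rectangles≤ k) ⟩
      ι (96 ℕ.* (κ ℕ.* (r ℕ.* r)) ℕ.* incidences r)             ≡⟨ ι-* (96 ℕ.* (κ ℕ.* (r ℕ.* r))) (incidences r) ⟩
      lam * ι (incidences r)                                    ≡⟨ cong (lam *_) I≡ ⟨
      lam * I                                                   ∎
      where open ≤-Reasoning

    ρ³≤I : ρ * (ρ * ρ) ℚ.≤ I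
    ρ³≤I = begin
      ρ * (ρ * ρ)                                               ≡⟨ trans (ι-* s (s ℕ.* s)) (cong (ρ *_) (ι-* s s)) ⟨
      ι (s ℕ.* (s ℕ.* s))                                       ≡⟨ cong ι (solve 1 (λ r → r :* r :* (r :* r :* (r :* r)) := r :* (r :* (r :* r)) :* (r :* r)) refl r) ⟩
      ι (r⁶ r)                                                  ≤⟨ ι-mono-≤ (r⁶≤incidences r) ⟩
      ι (incidences r)                                          ≡⟨ I≡ ⟨
      I                                                         ∎
      where
      open ≤-Reasoning
      open ℕ.+-*-Solver
      s = r ℕ.* r

    0<I : 0ℚ ℚ.< I
    0<I = <-≤-trans (pos-* 0<ρ (pos-* 0<ρ 0<ρ)) ρ³≤I

    lam≡ : lam ≡ ι 96 * (ι κ * ρ)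
    lam≡ = trans (ι-* 96 (κ ℕ.* (r ℕ.* r))) (cong (ι 96 *_) (ι-* κ (r ℕ.* r)))

    0<lam : 0ℚ ℚ.< lam
    0<lam = subst (0ℚ ℚ.<_) (sym lam≡) (pos-* (positive⁻¹ (ι 96)) (pos-* 0<κ 0<ρ))

    sizes≤ : ι (length hs) * ι (length ps) ℚ.≤ ι 3 * (ρ * ρ * (ρ * ρ))
    sizes≤ = begin
      ι (length hs) * ι (length ps)                             ≡⟨ ι-* (length hs) (length ps) ⟨
      ι (length hs ℕ.* length ps)                               ≡⟨ cong ι (cong₂ ℕ._*_ (length-box r (height r)) (length-box r s)) ⟩
      ι (r ℕ.* (r ℕ.* height r) ℕ.* (r ℕ.* (r ℕ.* s)))          ≤⟨ ι-mono-≤ (ℕ.*-monoˡ-≤ (r ℕ.* (r ℕ.* s)) (ℕ.*-monoʳ-≤ r (ℕ.*-monoʳ-≤ r (height≤ r)))) ⟩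
      ι (r ℕ.* (r ℕ.* (3 ℕ.* s)) ℕ.* (r ℕ.* (r ℕ.* s)))         ≡⟨ cong ι (solve 1 (λ r → r :* (r :* (con 3 :* (r :* r))) :* (r :* (r :* (r :* r)))
                                                                     := con 3 :* (r :* r :* (r :* r) :* (r :* r :* (r :* r)))) refl r) ⟩
      ι (3 ℕ.* (s ℕ.* s ℕ.* (s ℕ.* s)))                         ≡⟨ trans (ι-* 3 (s ℕ.* s ℕ.* (s ℕ.* s))) (cong (ι 3 *_)
                                                                     (trans (ι-* (s ℕ.* s) (s ℕ.* s)) (cong₂ _*_ (ι-* s s) (ι-* s s)))) ⟩
      ι 3 * (ρ * ρ * (ρ * ρ))                                   ∎
      where
      open ≤-Reasoning
      open ℕ.+-*-Solver
      s = r ℕ.* r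

    target-bound : ∀ t → 1 ℕ.≤ t → ι 2048 * (ι κ * (seq target t * seq target t)) ℚ.≤ ρ
    target-bound t 1≤t = ratio-bound (fromℕ n) (log₂ n) (√-pos (log₂ n) (log₂-pos n 2≤n)) target refl t {ι κ} {ρ} 1≤t (<⇒≤ 0<ρ) 1≤κ
      (≤-trans (ι-mono-≤ (n≤64r⁴ n 2≤n))
               (≤-reflexive (trans (ι-* 64 (r ℕ.* r ℕ.* (r ℕ.* r))) (cong (ι 64 *_) (ι-* (r ℕ.* r) (r ℕ.* r))))))
      (≤-trans (ι-mono-≤ (exponent<log n 2≤n)) (log₂≈-lower n 2≤n t))

  -- With ρ = r², the chain ρ⁶ ≤ A² ≤ 4 · 96 κ ρ · 3 ρ⁴ ω² is divided by ρ⁵ and leaves ρ ≤ 1152 κ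
  -- ω². The target has the constant 2048 in place of 1152, and the difference is slack.
  compare : ∀ {ρ κ A N ω x} → 0ℚ ℚ.< ρ → 0ℚ ℚ.< κ → 0ℚ ℚ.≤ ω → ρ * (ρ * ρ) ℚ.≤ A →
    A * A ℚ.≤ 4ℚ * (ι 96 * (κ * ρ)) * (N * (ω * ω)) → N ℚ.≤ ι 3 * (ρ * ρ * (ρ * ρ)) →
    ι 2048 * (κ * (x * x)) ℚ.≤ ρ → x ℚ.≤ ω
  compare {ρ} {κ} {A} {N} {ω} {x} 0<ρ 0<κ 0≤ω ρ³≤A A²≤ N≤ x²≤ = square-cancel-≤ {x} {ω} 0≤ω
    (*-cancelˡ-≤-pos κ {{ℚ.positive 0<κ}} (*-cancelˡ-≤-pos (ι 2048) (begin
      ι 2048 * (κ * (x * x))                  ≤⟨ x²≤ ⟩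
      ρ                                       ≤⟨ ρ≤ ⟩
      ι 1152 * (κ * (ω * ω))                  ≤⟨ *-monoʳ-≤-nonNeg (κ * (ω * ω)) {{ℚ.nonNegative (nonNeg-* (<⇒≤ 0<κ) (square-nonNeg ω))}} (ι-mono-≤ 1152≤2048) ⟩
      ι 2048 * (κ * (ω * ω))                  ∎)))
    where
    open ≤-Reasoning
    open +-*-Solver
    1152≤2048 : 1152 ℕ.≤ 2048
    1152≤2048 = ℕ.m≤m+n 1152 896
    0<ρ² = pos-* 0<ρ 0<ρ
    0<ρ⁵ : 0ℚ ℚ.< ρ * (ρ * ρ * (ρ * ρ))
    0<ρ⁵ = pos-* 0<ρ (pos-* 0<ρ² 0<ρ²)
    0≤ρ³ = <⇒≤ (pos-* 0<ρ 0<ρ²)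
    ρ≤ : ρ ℚ.≤ ι 1152 * (κ * (ω * ω))
    ρ≤ = *-cancelˡ-≤-pos (ρ * (ρ * ρ * (ρ * ρ))) {{ℚ.positive 0<ρ⁵}} (begin
      ρ * (ρ * ρ * (ρ * ρ)) * ρ
        ≡⟨ solve 1 (λ ρ → ρ :* (ρ :* ρ :* (ρ :* ρ)) :* ρ := ρ :* (ρ :* ρ) :* (ρ :* (ρ :* ρ))) refl ρ ⟩
      ρ * (ρ * ρ) * (ρ * (ρ * ρ))
        ≤⟨ *-mono-≤-nonNeg 0≤ρ³ (≤-trans 0≤ρ³ ρ³≤A) ρ³≤A ρ³≤A ⟩
      A * A
        ≤⟨ A²≤ ⟩
      4ℚ * (ι 96 * (κ * ρ)) * (N * (ω * ω))
        ≤⟨ *-monoˡ-≤-nonNeg (4ℚ * (ι 96 * (κ * ρ))) {{ℚ.nonNegative (nonNeg-* (<⇒≤ (positive⁻¹ 4ℚ)) (nonNeg-* (ι-nonNeg 96) (<⇒≤ (pos-* 0<κ 0<ρ))))}}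
             (*-monoʳ-≤-nonNeg (ω * ω) {{ℚ.nonNegative (square-nonNeg ω)}} N≤) ⟩
      4ℚ * (ι 96 * (κ * ρ)) * (ι 3 * (ρ * ρ * (ρ * ρ)) * (ω * ω))
        ≡⟨ solve 3 (λ ρ κ ω → con 4ℚ :* (con (ι 96) :* (κ :* ρ)) :* (con (ι 3) :* (ρ :* ρ :* (ρ :* ρ)) :* (ω :* ω))
                              := ρ :* (ρ :* ρ :* (ρ :* ρ)) :* (con (ι 1152) :* (κ :* (ω :* ω)))) refl ρ κ ω ⟩
      ρ * (ρ * ρ * (ρ * ρ)) * (ι 1152 * (κ * (ω * ω))) ∎)

  target≤cost : ∀ (F : Factorization (toℂᴹ matrixₙ)) → target ≤ℝ cost F
  target≤cost F = ≤ℝ-cost F target (N ℕ.⊔ 1 , λ t le → compare {ρ} {ι κ} {I} {ι (length hs) * ι (length ps)} {cost⁺ F t} {seq target t}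
    0<ρ 0<κ (cost⁺-nonNeg F t) ρ³≤I
    (subst (λ l → I * I ℚ.≤ 4ℚ * l * (ι (length hs) * ι (length ps) * (cost⁺ F t * cost⁺ F t))) lam≡ (h t (≤⊔ˡ {N} {1} le)))
    sizes≤ (target-bound t (≤⊔ʳ {N} {1} le)))
    where
    bound = cost-lower-bound F lam 0<lam 0<I S≤λI
    N = proj₁ bound
    h = proj₂ bound

theorem3p3 : Σ[ c ∈ ℝ ] 0ℝ <ℝ c ×
    (∀ (n : ℕ) (2≤n : 2 ≤ n) →
    Σ[ P ∈ SetOfAtMost n (_≈ₚ_ {3}) ]
    Σ[ 𝓗 ∈ SetOfAtMost n (_≐ₕ_ {3}) ]
    Σ[ M ∈ Matrix Bool (size 𝓗) (size P) ]
    IsIncidenceMatrix 𝓗 P M ×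
    (γ₂ toℂᴹ M ≥
    (c *ℝ (√ (√ (fromℕ n)) ÷ℝ √ (log₂ n) [ √-pos (log₂ n) (log₂-pos n 2≤n) ]))))
theorem3p3 = fromℚ Target.c , Target.c-positive , λ n 2≤n → let open Comparison n 2≤n in
  pointsₙ , planesₙ , matrixₙ , incidenceₙ , target≤cost
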